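{- Let $(L,G)$ be a generator-enriched lattice. (a) The minor poset $\mathrm{M}(L,G)$ is Eulerian. (b) If $G\neq\emptyset$, the order complex $\Delta(\mathrm{M}(L,G)\setminus\{\emptyset,(L,G)\})$ of the proper part of $\mathrm{M}(L,G)$ is a PL-sphere. In particular, $\mathrm{M}(L,G)$ is isomorphic to the face poset of a regular CW sphere.
   Context: A generator-enriched lattice is a pair $(L,G)$ where $L$ is a finite lattice and $G\subseteq L\setminus\{\widehat 0\}$ generates $L$ under joins (the empty join is $\widehat 0$). Elements of $G$ are called generators. For a set $H\subseteq L$ and $z\in L$ with $z<h$ for all $h\in H$, $\langle H|z\rangle=(\{z\vee\bigvee_{x\in X}x: X\subseteq H\},H)$, a generator-enriched lattice with minimum $z$ (joins computed in $L$). For $I\subseteq G$, the deletion is $(L,G)\setminus I=\langle G\setminus I\,|\,\widehat 0\rangle$ and the contraction is $(L,G)/I=\langle\{g\vee i_0: g\in G\}\setminus\{i_0\}\,|\,i_0\rangle$ where $i_0=\bigvee_{i\in I}i$. A minor of $(L,G)$ is any generator-enriched lattice obtained from $(L,G)$ by a (possibly empty) sequence of deletions and contractions. The minor poset $\mathrm{M}(L,G)$ consists of all minors of $(L,G)$ together with an adjoined minimum element $\emptyset$, ordered by $(K_1,H_1)\le(K_2,H_2)$ when $(K_1,H_1)$ is a minor of $(K_2,H_2)$; its maximum is $(L,G)$. A graded poset $P$ with $\widehat 0$ and $\widehat 1$ is Eulerian if $\sum_{x\le z\le y}(-1)^{\mathrm{rk}(z)}=0$ for all $x<y$ in $P$.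 The order complex $\Delta(Q)$ of a poset $Q$ is the simplicial complex of finite chains of $Q$. A simplicial complex is a PL-sphere when there is a piecewise linear homeomorphism from it to the boundary of a simplex. A regular CW sphere is a finite regular CW complex homeomorphic to a sphere; the face poset of such a complex is the set of its closed cells ordered by inclusion, with an adjoined minimum $\widehat 0$ (the empty face) and an adjoined maximum $\widehat 1$ not corresponding to a cell. -}

module Defs where

open import Algebra.Bundles using (CommutativeRing)
open import Algebra.Core using (Op₂)
import Algebra.Properties.Ring as RingProperties
open import Data.Fin.Base using (Fin)
open import Data.Fin.Properties using (_≟_; any?)
open import Data.Fin.Subset using (Subset; _∈_; _∉_; _⊆_)
import Data.Fin.Subset as Subset
open import Data.Fin.Subset.Properties
  using (_∈?_; _⊆?_; anySubset?; ⊆-antisym; ∉⊥; ∈⊤; ⊆⊤; p─q⊆p; x∈⁅x⁆;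
         x∈⁅y⁆⇒x≡y; p⊆p∪q; q⊆p∪q; x∈p∪q⁻; x∈p∪q⁺)
open import Data.Bool.Base using (true; false)
open import Data.Empty using (⊥-elim)
open import Data.Integer.Base as ℤ using (0ℤ; -1ℤ)
open import Data.List.Base using (List; []; _∷_; foldr; filter; map; allFin)
import Data.List.Membership.Propositional as List
import Data.List.Membership.Setoid as SetoidMembership
open import Data.List.Membership.Propositional.Properties
  using (∈-filter⁺; ∈-filter⁻; ∈-allFin)
import Data.List.Relation.Binary.Subset.Setoid as SetoidSubset
open import Data.List.Relation.Unary.Any using (here; there)
open import Data.List.Relation.Unary.Enumerates.Setoid using (IsEnumeration)
open import Data.List.Relation.Unary.Unique.Setoid using (Unique)
open import Data.Nat.Base as ℕ using (ℕ)
open import Data.Product.Base using (Σ; ∃; _×_; _,_; proj₁; proj₂)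
open import Data.Sum.Base using (_⊎_; inj₁; inj₂)
open import Data.Unit.Base using (tt)
open import Data.Vec.Base using (tabulate)
open import Data.Vec.Properties using (lookup∘tabulate; []=⇒lookup; lookup⇒[]=)
open import Function.Base using (_∘_; _on_)
open import Function.Bundles using (Func; Bijection; Inverse; _⇔_)
open import Function.Definitions using (Injective)
open import Level using (0ℓ; _⊔_) renaming (suc to lsuc)
open import Relation.Binary.Bundles using (Poset; Setoid)
import Relation.Binary.Construct.Add.Extrema.NonStrict as Extrema
import Relation.Binary.Construct.Add.Infimum.NonStrict as Infimum
import Relation.Binary.Construct.Interior.Symmetric as Symmetric
import Relation.Binary.Construct.NonStrictToStrict as NonStrictToStrict
import Relation.Binary.Construct.On as On
open import Relation.Binary.Construct.Closure.ReflexiveTransitive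
  using (Star; ε; _◅_; _◅◅_)
open import Relation.Binary.Core using (Rel)
open import Relation.Binary.Definitions using (Minimum; Maximum)
open import Relation.Binary.Lattice.Structures using (IsBoundedLattice)
open import Relation.Binary.Morphism.Structures using (IsOrderIsomorphism)
open import Relation.Binary.PropositionalEquality
  using (_≡_; refl; sym; trans; cong; cong₂; subst; setoid; isEquivalence)
open import Relation.Binary.Structures using (IsTotalOrder; IsPartialOrder)
open import Relation.Nullary using (¬_; Dec; yes; no; does)
open import Relation.Nullary.Construct.Add.Infimum using (⊥₋; [_])
open import Relation.Nullary.Decidable using (_×-dec_)
open import Relation.Unary using (Pred; Decidable; U; _∩_; ⋃; _≐_; _≬_)
import Relation.Unary as Unary

------------------------------------------------------------------------
-- Posets

module _ {c ℓ₁ ℓ₂} (P : Poset c ℓ₁ ℓ₂) where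

  open Poset P
  open NonStrictToStrict _≈_ _≤_ using (_<_)
  open SetoidMembership Eq.setoid using () renaming (_∈_ to _∈ˡ_)

  Covers : Rel Carrier (c ⊔ ℓ₁ ⊔ ℓ₂)
  Covers x y = x < y × (∀ z → ¬ (x < z × z < y))

  -- The alternating sum is taken along an arbitrary duplicate-free listing of
  -- the interval; `finite` ensures that such listings exist.
  record Eulerian : Set (c ⊔ ℓ₁ ⊔ ℓ₂) where
    field
      finite      : ∃ (IsEnumeration Eq.setoid)
      0̂ 1̂         : Carrier
      minimum     : Minimum _≤_ 0̂
      maximum     : Maximum _≤_ 1̂
      rk          : Carrier → ℕ
      rk-cong     : ∀ {x y} → x ≈ y → rk x ≡ rk y
      rk-0̂        : rk 0̂ ≡ 0
      rk-cover    : ∀ {x y} → Covers x y → rk y ≡ ℕ.suc (rk x)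
      alternating : ∀ {x y} → x < y →
                    ∀ zs → Unique Eq.setoid zs →
                    (∀ z → z ∈ˡ zs ⇔ (x ≤ z × z ≤ y)) →
                    foldr ℤ._+_ 0ℤ (map (λ z → -1ℤ ℤ.^ rk z) zs) ≡ 0ℤ

_≅_ : ∀ {c ℓ₁ ℓ₂ c′ ℓ₁′ ℓ₂′} → Poset c ℓ₁ ℓ₂ → Poset c′ ℓ₁′ ℓ₂′ → Set _
P ≅ Q = ∃ (IsOrderIsomorphism P._≈_ Q._≈_ P._≤_ Q._≤_)
  where module P = Poset P
        module Q = Poset Q

------------------------------------------------------------------------
-- Generator-enriched lattices

-- A finite lattice is taken to have underlying set Fin size, so that equality
-- of subsets is propositional.
record GeneratorEnrichedLattice : Set₁ where
  infix  4 _≤_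
  infixr 6 _∨_
  field
    size             : ℕ
    _≤_              : Rel (Fin size) 0ℓ
    _∨_ _∧_          : Op₂ (Fin size)
    1̂ 0̂              : Fin size
    isBoundedLattice : IsBoundedLattice _≡_ _≤_ _∨_ _∧_ 1̂ 0̂

  ⋁ : Subset size → Fin size
  ⋁ X = foldr _∨_ 0̂ (filter (_∈? X) (allFin size))

  field
    G         : Subset size
    0̂∉G       : 0̂ ∉ G
    generates : ∀ x → ∃ λ X → X ⊆ G × x ≡ ⋁ X

-- The subset { x | P x }.
⟪_⟫ : ∀ {n ℓ} {P : Pred (Fin n) ℓ} → Decidable P → Subset n
⟪ P? ⟫ = tabulate (does ∘ P?)

module _ {n ℓ} {P : Pred (Fin n) ℓ} (P? : Decidable P) where

  ∈⟪⟫⁺ : ∀ {x} → P x → x ∈ ⟪ P? ⟫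
  ∈⟪⟫⁺ {x} px = lookup⇒[]= x _ (trans (lookup∘tabulate (does ∘ P?) x) (go (P? x)))
    where
    go : (d : Dec (P x)) → does d ≡ true
    go (yes _) = refl
    go (no ¬p) = ⊥-elim (¬p px)

  ∈⟪⟫⁻ : ∀ {x} → x ∈ ⟪ P? ⟫ → P x
  ∈⟪⟫⁻ {x} x∈ =
    go (P? x) (trans (sym (lookup∘tabulate (does ∘ P?) x)) ([]=⇒lookup x∈))
    where
    go : (d : Dec (P x)) → does d ≡ true → P x
    go (yes p) _  = p
    go (no  _) ()

module Minors (LG : GeneratorEnrichedLattice) where

  open GeneratorEnrichedLattice LG
  open Subset using (_∪_; _─_; _-_)
  open IsBoundedLattice isBoundedLattice
    using (x≤x∨y; y≤x∨y; ∨-least; minimum; antisym)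
    renaming (refl to ≤-refl; trans to ≤-trans)

  -- The pairs (K , H) of subsets of L.
  Enriched : Set
  Enriched = Subset size × Subset size

  _IsMinimumOf_ : Fin size → Subset size → Set
  z IsMinimumOf K = z ∈ K × (∀ {x} → x ∈ K → z ≤ x)

  isJoin? : ∀ H z → Decidable λ x → ∃ λ X → X ⊆ H × x ≡ z ∨ ⋁ X
  isJoin? H z x = anySubset? λ X → X ⊆? H ×-dec x ≟ z ∨ ⋁ X

  ⟨_∣_⟩ : Subset size → Fin size → Enriched
  ⟨ H ∣ z ⟩ = ⟪ isJoin? H z ⟫ , H

  isTranslate? : ∀ H i → Decidable λ x → ∃ λ g → g ∈ H × x ≡ g ∨ i
  isTranslate? H i x = any? λ g → g ∈? H ×-dec x ≟ g ∨ i

  -- Joins in K agree with those in L, except that the empty join is the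
  -- minimum z of K; hence z ∨ ⋁ I for the join of I in K.
  infix 4 _⟶_
  data _⟶_ : Rel Enriched 0ℓ where
    deletion    : ∀ {K H z I} → z IsMinimumOf K → I ⊆ H →
                  (K , H) ⟶ ⟨ H ─ I ∣ z ⟩
    contraction : ∀ {K H z I} → z IsMinimumOf K → I ⊆ H →
                  let i₀ = z ∨ ⋁ I in
                  (K , H) ⟶ ⟨ ⟪ isTranslate? H i₀ ⟫ - i₀ ∣ i₀ ⟩

  whole : Enriched
  whole = Subset.⊤ , G

  Minor : Set
  Minor = ∃ (Star _⟶_ whole)

  infix 4 _≤ᴹ_ _≈ᴹ_
  _≤ᴹ_ : Rel Minor 0ℓ
  (A , _) ≤ᴹ (B , _) = Star _⟶_ B A

  _≈ᴹ_ : Rel Minor 0ℓ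
  _≈ᴹ_ = _≡_ on proj₁

  -- Antisymmetry of _≤ᴹ_: a step shrinks the underlying set, and shrinks the
  -- set of generators when it leaves the underlying set unchanged.

  ∈-elements⁺ : ∀ {X x} → x ∈ X → x List.∈ filter (_∈? X) (allFin size)
  ∈-elements⁺ {X} {x} = ∈-filter⁺ (_∈? X) (∈-allFin x)

  ∈-elements⁻ : ∀ {X x} → x List.∈ filter (_∈? X) (allFin size) → x ∈ X
  ∈-elements⁻ {X} = proj₂ ∘ ∈-filter⁻ (_∈? X) {xs = allFin size}

  foldr-upper : ∀ xs {x} → x List.∈ xs → x ≤ foldr _∨_ 0̂ xs
  foldr-upper (x ∷ xs) (here refl)  = x≤x∨y x _
  foldr-upper (y ∷ xs) (there x∈xs) =
    ≤-trans (foldr-upper xs x∈xs) (y≤x∨y y _)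

  foldr-least : ∀ xs {u} → (∀ {x} → x List.∈ xs → x ≤ u) → foldr _∨_ 0̂ xs ≤ u
  foldr-least []       _  = minimum _
  foldr-least (x ∷ xs) ub =
    ∨-least (ub (here refl)) (foldr-least xs (ub ∘ there))

  ⋁-upper : ∀ {X x} → x ∈ X → x ≤ ⋁ X
  ⋁-upper {X} x∈X = foldr-upper _ (∈-elements⁺ {X} x∈X)

  ⋁-least : ∀ {X u} → (∀ {x} → x ∈ X → x ≤ u) → ⋁ X ≤ u
  ⋁-least {X} ub = foldr-least _ (ub ∘ ∈-elements⁻ {X})

  ∨-absorb : ∀ {x y} → y ≤ x → x ∨ y ≡ x
  ∨-absorb y≤x = antisym (∨-least ≤-refl y≤x) (x≤x∨y _ _)

  JoinClosed : Subset size → Set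
  JoinClosed S = ∀ {x y} → x ∈ S → y ∈ S → x ∨ y ∈ S

  closed-⋁ : ∀ {S i X} → JoinClosed S → i ∈ S → X ⊆ S → i ∨ ⋁ X ∈ S
  closed-⋁ {S} {i} {X} cl i∈S X⊆S = go _ (X⊆S ∘ ∈-elements⁻ {X})
    where
    go : ∀ xs → (∀ {x} → x List.∈ xs → x ∈ S) → i ∨ foldr _∨_ 0̂ xs ∈ S
    go []       _  = subst (_∈ S) (sym (∨-absorb (minimum i))) i∈S
    go (x ∷ xs) in-S = subst (_∈ S) exchange
                         (cl (in-S (here refl)) (go xs (in-S ∘ there)))
      where
      r = foldr _∨_ 0̂ xs
      exchange : x ∨ i ∨ r ≡ i ∨ x ∨ r
      exchange = antisym
        (∨-least (≤-trans (x≤x∨y x r) (y≤x∨y i _))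
          (∨-least (x≤x∨y i _) (≤-trans (y≤x∨y x r) (y≤x∨y i _))))
        (∨-least (≤-trans (x≤x∨y i r) (y≤x∨y x _))
          (∨-least (x≤x∨y x _) (≤-trans (y≤x∨y i r) (y≤x∨y x _))))

  carrier : Subset size → Fin size → Subset size
  carrier H z = ⟪ isJoin? H z ⟫

  carrier-min : ∀ {H z} → z IsMinimumOf carrier H z
  carrier-min {H} {z} =
    ∈⟪⟫⁺ (isJoin? H z)
      (Subset.⊥ , ⊥-elim ∘ ∉⊥ ,
       sym (∨-absorb (⋁-least (⊥-elim ∘ ∉⊥)))) ,
    λ x∈ → let (X , _ , eq) = ∈⟪⟫⁻ (isJoin? H z) x∈ in
           subst (z ≤_) (sym eq) (x≤x∨y z _)

  carrier-closed : ∀ {H z} → JoinClosed (carrier H z)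
  carrier-closed {H} {z} {x} {y} x∈ y∈
    with X , X⊆H , refl ← ∈⟪⟫⁻ (isJoin? H z) x∈
       | Y , Y⊆H , refl ← ∈⟪⟫⁻ (isJoin? H z) y∈
    = ∈⟪⟫⁺ (isJoin? H z) (X ∪ Y , X∪Y⊆H , antisym below above)
    where
    X∪Y⊆H : X ∪ Y ⊆ H
    X∪Y⊆H w∈ with x∈p∪q⁻ X Y w∈
    ... | inj₁ w∈X = X⊆H w∈X
    ... | inj₂ w∈Y = Y⊆H w∈Y
    mono : ∀ {A} → A ⊆ X ∪ Y → z ∨ ⋁ A ≤ z ∨ ⋁ (X ∪ Y)
    mono A⊆ = ∨-least (x≤x∨y z _)
                (⋁-least (λ a → ≤-trans (⋁-upper (A⊆ a)) (y≤x∨y z _)))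
    below : (z ∨ ⋁ X) ∨ (z ∨ ⋁ Y) ≤ z ∨ ⋁ (X ∪ Y)
    below = ∨-least (mono (p⊆p∪q Y)) (mono (q⊆p∪q X Y))
    above : z ∨ ⋁ (X ∪ Y) ≤ (z ∨ ⋁ X) ∨ (z ∨ ⋁ Y)
    above = ∨-least (≤-trans (x≤x∨y z _) (x≤x∨y _ _)) (⋁-least ub)
      where
      ub : ∀ {w} → w ∈ X ∪ Y → w ≤ (z ∨ ⋁ X) ∨ (z ∨ ⋁ Y)
      ub w∈ with x∈p∪q⁻ X Y w∈
      ... | inj₁ w∈X =
        ≤-trans (⋁-upper w∈X) (≤-trans (y≤x∨y z _) (x≤x∨y _ _))
      ... | inj₂ w∈Y =
        ≤-trans (⋁-upper w∈Y) (≤-trans (y≤x∨y z _) (y≤x∨y _ _))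

  carrier-gen : ∀ {H z} → (∀ {h} → h ∈ H → z ≤ h) → H ⊆ carrier H z
  carrier-gen {H} {z} z≤ {h} h∈H =
    ∈⟪⟫⁺ (isJoin? H z)
      (Subset.⁅ h ⁆ ,
       (λ x∈ → subst (_∈ H) (sym (x∈⁅y⁆⇒x≡y h x∈)) h∈H) ,
       antisym (≤-trans (⋁-upper (x∈⁅x⁆ h)) (y≤x∨y z _))
         (∨-least (z≤ h∈H)
           (⋁-least (λ x∈ → subst (_≤ h) (sym (x∈⁅y⁆⇒x≡y h x∈)) ≤-refl))))

  Good : Enriched → Set
  Good (K , H) = ∃ λ z → K ≡ carrier H z × (∀ {h} → h ∈ H → z ≤ h)

  min-unique : ∀ {K z w} → z IsMinimumOf K → w IsMinimumOf K → z ≡ w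
  min-unique (z∈ , z≤) (w∈ , w≤) = antisym (z≤ w∈) (w≤ z∈)

  whole-good : Good whole
  whole-good = 0̂ ,
    ⊆-antisym (λ {x} _ → let (X , X⊆G , eq) = generates x in
      ∈⟪⟫⁺ (isJoin? G 0̂)
        (X , X⊆G , trans eq (antisym (y≤x∨y 0̂ _) (∨-least (minimum _) ≤-refl))))
      ⊆⊤ ,
    λ _ → minimum _

  translate : ∀ {H i x} → x ∈ ⟪ isTranslate? H i ⟫ - i → ∃ λ g → g ∈ H × x ≡ g ∨ i
  translate {H} {i} = ∈⟪⟫⁻ (isTranslate? H i) ∘ p─q⊆p ⟪ isTranslate? H i ⟫ _

  step-good : ∀ {A B} → Good A → A ⟶ B → Good B
  step-good (z , refl , z≤) (deletion {H = H} {I = I} m I⊆H) =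
    _ , refl , λ h∈ → proj₂ m (carrier-gen z≤ (p─q⊆p H I h∈))
  step-good (z , refl , z≤) (contraction {H = H} m I⊆H) =
    _ , refl , λ h∈ → let (g , _ , eq) = translate {H} h∈ in
                      subst (_ ≤_) (sym eq) (y≤x∨y g _)

  step-⊆ : ∀ {A B} → Good A → A ⟶ B → proj₁ B ⊆ proj₁ A
  step-⊆ (z , refl , z≤) (deletion {H = H} {I = I} m I⊆H) x∈
    with X , X⊆ , refl ← ∈⟪⟫⁻ (isJoin? (H ─ I) _) x∈
    = closed-⋁ carrier-closed (proj₁ m) (carrier-gen z≤ ∘ p─q⊆p H I ∘ X⊆)
  step-⊆ (z , refl , z≤) (contraction {H = H} {z = w} {I = I} m I⊆H) x∈
    with X , X⊆ , refl ← ∈⟪⟫⁻ (isJoin? (⟪ isTranslate? H (w ∨ ⋁ I) ⟫ - (w ∨ ⋁ I)) _) x∈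
    = closed-⋁ carrier-closed i₀∈ λ y∈ →
        let (g , g∈H , eq) = translate {H} (X⊆ y∈) in
        subst (_∈ carrier H z) (sym eq)
          (carrier-closed (carrier-gen z≤ g∈H) i₀∈)
    where
    i₀∈ : w ∨ ⋁ I ∈ carrier H z
    i₀∈ = closed-⋁ carrier-closed (proj₁ m) (carrier-gen z≤ ∘ I⊆H)

  step-gen : ∀ {A B} → Good A → A ⟶ B → proj₁ A ⊆ proj₁ B → proj₂ B ⊆ proj₂ A
  step-gen _ (deletion {H = H} {I = I} _ _) _ = p─q⊆p H I
  step-gen (z , refl , z≤) (contraction {H = H} {z = w} {I = I} m I⊆H) K⊆ {x} x∈
    with g , g∈H , refl ← translate {H} x∈
    = subst (_∈ H) (sym (∨-absorb i₀≤g)) g∈H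
    where
    i₀≤g : w ∨ ⋁ I ≤ g
    i₀≤g = proj₂ carrier-min (K⊆ (carrier-gen z≤ g∈H))

  star-good : ∀ {A B} → Good A → Star _⟶_ A B → Good B
  star-good a ε        = a
  star-good a (s ◅ ss) = star-good (step-good a s) ss

  star-⊆ : ∀ {A B} → Good A → Star _⟶_ A B → proj₁ B ⊆ proj₁ A
  star-⊆ a ε        x∈ = x∈
  star-⊆ a (s ◅ ss) x∈ = step-⊆ a s (star-⊆ (step-good a s) ss x∈)

  star-gen : ∀ {A B} → Good A → Star _⟶_ A B → proj₁ A ⊆ proj₁ B → proj₂ B ⊆ proj₂ A
  star-gen a ε        _    x∈ = x∈
  star-gen a (s ◅ ss) A⊆B x∈ =
    step-gen a s (star-⊆ (step-good a s) ss ∘ A⊆B)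
      (star-gen (step-good a s) ss (A⊆B ∘ step-⊆ a s) x∈)

  ≤ᴹ-antisym : ∀ {A B} → A ≤ᴹ B → B ≤ᴹ A → A ≈ᴹ B
  ≤ᴹ-antisym {_ , p} {_ , q} B⟶A A⟶B =
    cong₂ _,_ (⊆-antisym A⊆B B⊆A)
      (⊆-antisym (star-gen b B⟶A B⊆A) (star-gen a A⟶B A⊆B))
    where
    a   = star-good whole-good p
    b   = star-good whole-good q
    A⊆B = star-⊆ b B⟶A
    B⊆A = star-⊆ a A⟶B

  ≤ᴹ-isPartialOrder : IsPartialOrder _≈ᴹ_ _≤ᴹ_
  ≤ᴹ-isPartialOrder = record
    { isPreorder = record
      { isEquivalence = On.isEquivalence proj₁ isEquivalence
      ; reflexive     = λ { refl → ε }
      ; trans         = λ B⟶A C⟶B → C⟶B ◅◅ B⟶A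
      }
    ; antisym = λ {A} {B} → ≤ᴹ-antisym {A} {B}
    }

  M : Poset 0ℓ 0ℓ 0ℓ
  M = record
    { isPartialOrder = Infimum.≤₋-isPartialOrder _≤ᴹ_ ≤ᴹ-isPartialOrder }

  ∅ᴹ : Poset.Carrier M
  ∅ᴹ = ⊥₋

  wholeᴹ : Poset.Carrier M
  wholeᴹ = [ whole , ε ]

  properPart : Poset 0ℓ 0ℓ 0ℓ
  properPart = On.poset M (proj₁ {B = λ x → ¬ x ≈ ∅ᴹ × ¬ x ≈ wholeᴹ})
    where open Poset M

------------------------------------------------------------------------
-- Simplicial complexes

-- A finite set of vertices is represented by any list of its elements, so
-- faces are closed under passing to a list with fewer, reordered or repeated
-- elements.
record SimplicialComplex : Set₁ where
  field
    vertices : Setoid 0ℓ 0ℓ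
  open Setoid vertices public renaming (Carrier to Vertex)
  open SetoidMembership vertices public
    using () renaming (_∈_ to _∈ᵛ_; _∉_ to _∉ᵛ_)
  open SetoidSubset vertices public using () renaming (_⊆_ to _⊆ᵛ_)
  field
    IsFace      : Pred (List Vertex) 0ℓ
    down-closed : ∀ {σ τ} → σ ⊆ᵛ τ → IsFace τ → IsFace σ

orderComplex : Poset 0ℓ 0ℓ 0ℓ → SimplicialComplex
orderComplex P = record
  { vertices    = Eq.setoid
  ; IsFace      = λ σ → ∀ {x y} → x ∈ᵛ σ → y ∈ᵛ σ → x ≤ y ⊎ y ≤ x
  ; down-closed = λ σ⊆τ chain x∈σ y∈σ → chain (σ⊆τ x∈σ) (σ⊆τ y∈σ)
  }
  where
  open Poset P
  open SetoidMembership Eq.setoid using () renaming (_∈_ to _∈ᵛ_)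

-- The boundary of the n-simplex on the vertices Fin (suc n).
∂simplex : ℕ → SimplicialComplex
∂simplex n = record
  { vertices    = setoid (Fin (ℕ.suc n))
  ; IsFace      = λ σ → ∃ λ i → i List.∉ σ
  ; down-closed = λ σ⊆τ (i , i∉τ) → i , i∉τ ∘ σ⊆τ
  }

------------------------------------------------------------------------
-- The real numbers

-- ℝ is characterised, up to unique isomorphism, as a Dedekind-complete totally
-- ordered field.
record CompleteOrderedField : Set₁ where
  field
    commutativeRing : CommutativeRing 0ℓ 0ℓ
  open CommutativeRing commutativeRing public
    hiding (refl; sym; trans; reflexive; isEquivalence; setoid; _-_)
    renaming (Carrier to ℝ)
  infix 4 _≤_
  field
    _≤_          : Rel ℝ 0ℓ
    isTotalOrder : IsTotalOrder _≈_ _≤_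
    +-monoˡ-≤    : ∀ {x y} z → x ≤ y → x + z ≤ y + z
    *-nonneg     : ∀ {x y} → 0# ≤ x → 0# ≤ y → 0# ≤ x * y
    0≉1          : ¬ 0# ≈ 1#
    inverse      : ∀ x → ¬ x ≈ 0# → ∃ λ y → x * y ≈ 1#

  UpperBound : Pred ℝ 0ℓ → Pred ℝ 0ℓ
  UpperBound S u = ∀ {x} → S x → x ≤ u

  field
    supremum : ∀ S → ∃ S → ∃ (UpperBound S) →
               ∃ λ s → UpperBound S s × (∀ {u} → UpperBound S u → s ≤ u)

  open NonStrictToStrict _≈_ _≤_ public using (_<_)

------------------------------------------------------------------------
-- Topology

record TopologicalSpace : Set₁ where
  field
    points : Setoid 0ℓ 0ℓ
  open Setoid points public using (_≈_) renaming (Carrier to Point)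
  field
    Open          : Pred (Pred Point 0ℓ) 0ℓ
    open-respects : ∀ {V x y} → Open V → x ≈ y → V x → V y
    open-resp-≐   : ∀ {V W} → V ≐ W → Open V → Open W
    open-U        : Open U
    open-∩        : ∀ {V W} → Open V → Open W → Open (V ∩ W)
    open-⋃        : ∀ {I : Set} {V : I → Pred Point 0ℓ} →
                    (∀ i → Open (V i)) → Open (⋃ I V)

open TopologicalSpace using (points; Point; Open)

Hausdorff : TopologicalSpace → Set₁
Hausdorff X = ∀ x y → ¬ x ≈ y → ∃ λ V → ∃ λ W →
              Open X V × Open X W × V x × W y × ¬ (V ≬ W)
  where open TopologicalSpace X using (_≈_)

module _ (X Y : TopologicalSpace) where

  Continuous : (Point X → Point Y) → Set₁
  Continuous f = ∀ V → Open Y V → Open X (V ∘ f)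

  -- A homeomorphism onto the image of f with the subspace topology.
  record IsEmbedding (f : Func (points X) (points Y)) : Set₁ where
    open Func f
    field
      injective  : Injective Eq₁._≈_ Eq₂._≈_ to
      continuous : Continuous to
      inducing   : ∀ V → Open X V → ∃ λ W → Open Y W × V ≐ (W ∘ to)

module _ (X Y : TopologicalSpace) where

  record Homeomorphism : Set₁ where
    field
      inverse : Inverse (points X) (points Y)
    open Inverse inverse public using (to; from)
    field
      to-continuous   : Continuous X Y to
      from-continuous : Continuous Y X from

module Topology (real : CompleteOrderedField) where

  open CompleteOrderedField real
  private
    module ≤ = IsTotalOrder isTotalOrder
    module R = CommutativeRing commutativeRing
  open R using (_-_)

  ∑ : ∀ {A : Set} → List A → (A → ℝ) → ℝ
  ∑ xs f = foldr _+_ 0# (map f xs)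

  Near : ∀ {I : Set} → ℝ → Rel (I → ℝ) 0ℓ
  Near δ p q = ∀ i → p i - q i < δ × q i - p i < δ

  -- X with the topology and the equality pulled back along c from ℝ^I; only
  -- used with X essentially a subset of ℝ^I, and I finite, when the topology
  -- of the maximum metric is the usual one.
  euclidean : ∀ {X I : Set} → (X → I → ℝ) → TopologicalSpace
  euclidean {X} {I} c = record
    { points        = points′
    ; Open          = Open′
    ; open-respects = λ {V} {x} {y} o x≈y Vx →
        let (δ , 0<δ , near) = o Vx in near λ i →
          ≈⇒<δ (x≈y i) 0<δ , ≈⇒<δ (R.sym (x≈y i)) 0<δ
    ; open-resp-≐   = λ (V⊆W , W⊆V) o Wx →
        let (δ , 0<δ , near) = o (W⊆V Wx) in δ , 0<δ , V⊆W ∘ near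
    ; open-U        = λ _ → 1# , 0<1 , λ _ → tt
    ; open-∩        = λ o o′ (Vx , Wx) → meet (o Vx) (o′ Wx)
    ; open-⋃        = λ o (i , Vx) →
        let (δ , 0<δ , near) = o i Vx in δ , 0<δ , λ n → i , near n
    }
    where
    points′ : Setoid 0ℓ 0ℓ
    points′ = record
      { Carrier       = X
      ; _≈_           = λ x y → ∀ i → c x i ≈ c y i
      ; isEquivalence = record
        { refl  = λ i → R.refl
        ; sym   = λ p i → R.sym (p i)
        ; trans = λ p q i → R.trans (p i) (q i)
        }
      }

    Around : X → Pred X 0ℓ → Set
    Around x V = ∃ λ δ → 0# < δ × (∀ {y} → Near δ (c x) (c y) → V y)

    Open′ : Pred (Pred X 0ℓ) 0ℓ
    Open′ V = ∀ {x} → V x → Around x V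

    ≈⇒<δ : ∀ {a b δ} → a ≈ b → 0# < δ → a - b < δ
    ≈⇒<δ {a} {b} a≈b (0≤δ , 0≉δ) =
      ≤.trans (≤.reflexive a-b≈0) 0≤δ , λ eq → 0≉δ (R.trans (R.sym a-b≈0) eq)
      where
      a-b≈0 : a - b ≈ 0#
      a-b≈0 = R.trans (R.+-congʳ a≈b) (R.-‿inverseʳ b)

    0≤1 : 0# ≤ 1#
    0≤1 with ≤.total 0# 1#
    ... | inj₁ 0≤1 = 0≤1
    ... | inj₂ 1≤0 = ≤.trans (*-nonneg 0≤-1 0≤-1) (≤.reflexive square)
      where
      open RingProperties R.ring using (-‿distribˡ-*; -‿involutive)
      0≤-1 : 0# ≤ - 1#
      0≤-1 = ≤.trans (≤.reflexive (R.sym (R.-‿inverseʳ 1#)))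
               (≤.trans (+-monoˡ-≤ (- 1#) 1≤0) (≤.reflexive (R.+-identityˡ _)))
      square : - 1# * - 1# ≈ 1#
      square = R.trans (R.sym (-‿distribˡ-* 1# (- 1#)))
                 (R.trans (R.-‿cong (R.*-identityˡ _)) (-‿involutive 1#))

    0<1 : 0# < 1#
    0<1 = 0≤1 , 0≉1

    <-≤-trans : ∀ {a b d} → a < b → b ≤ d → a < d
    <-≤-trans = NonStrictToStrict.<-≤-trans _≈_ _≤_
                  R.sym ≤.trans ≤.antisym ≤.≤-respʳ-≈

    meet : ∀ {x V W} → Around x V → Around x W → Around x (V ∩ W)
    meet (δ , 0<δ , near) (δ′ , 0<δ′ , near′) with ≤.total δ δ′
    ... | inj₁ δ≤δ′ = δ , 0<δ , λ n →
      near n , near′ (λ i → let (l , r) = n i in <-≤-trans l δ≤δ′ , <-≤-trans r δ≤δ′)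
    ... | inj₂ δ′≤δ = δ′ , 0<δ′ , λ n →
      near (λ i → let (l , r) = n i in <-≤-trans l δ′≤δ , <-≤-trans r δ′≤δ) , near′ n

  ∥_∥² : ∀ {d} → (Fin d → ℝ) → ℝ
  ∥ p ∥² = ∑ (allFin _) λ i → p i * p i

  ball : ℕ → TopologicalSpace
  ball d = euclidean {Σ (Fin d → ℝ) λ p → ∥ p ∥² ≤ 1#} proj₁

  -- The d-sphere, in ℝ^(d+1).
  sphere : ℕ → TopologicalSpace
  sphere d = euclidean {Σ (Fin (ℕ.suc d) → ℝ) λ p → ∥ p ∥² ≈ 1#} proj₁

  ----------------------------------------------------------------------
  -- Geometric realisation and PL-spheres

  module _ (K : SimplicialComplex) where

    open SimplicialComplex K
      using (vertices; Vertex; IsFace; _∈ᵛ_; _∉ᵛ_) renaming (_≈_ to _≈ᵛ_)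

    SupportedOn : List Vertex → Pred (Vertex → ℝ) 0ℓ
    SupportedOn σ p = ∀ v → v ∉ᵛ σ → p v ≈ 0#

    -- A point of |K|, in barycentric coordinates.
    record RealisationPoint : Set where
      field
        coord      : Vertex → ℝ
        coord-cong : ∀ {v w} → v ≈ᵛ w → coord v ≈ coord w
        nonneg     : ∀ v → 0# ≤ coord v
        face       : List Vertex
        isFace     : IsFace face
        unique     : Unique vertices face
        support    : SupportedOn face coord
        total      : ∑ face coord ≈ 1#

    open RealisationPoint

    ∣_∣ : TopologicalSpace
    ∣_∣ = euclidean coord

    -- f agrees on each simplex with an affine map; u gives the images of the
    -- vertices.
    SimplexwiseLinear : ∀ {J : Set} → (RealisationPoint → J → ℝ) → Set
    SimplexwiseLinear {J} f =
      ∃ λ (u : Vertex → J → ℝ) →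
        ∀ p j → f p j ≈ ∑ (face p) λ v → coord p v * u v j

  open RealisationPoint

  -- A finite complex together with a bijection onto |K| that is linear on each
  -- simplex and carries each simplex into a simplex of K.
  record Subdivision (K : SimplicialComplex) : Set₁ where
    open SimplicialComplex using (IsFace; vertices)
    field
      complex     : SimplicialComplex
      finite      : ∃ (IsEnumeration (vertices complex))
      bijection   : Bijection (points ∣ complex ∣) (points ∣ K ∣)
    open Bijection bijection public using (to)
    field
      linear      : SimplexwiseLinear complex (coord ∘ to)
      subordinate : ∀ σ → IsFace complex σ → ∃ λ τ → IsFace K τ ×
                    (∀ p → SupportedOn complex σ (coord p) →
                           SupportedOn K τ (coord (to p)))

  PiecewiseLinear : (K L : SimplicialComplex) → (Point ∣ K ∣ → Point ∣ L ∣) → Set₁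
  PiecewiseLinear K L f =
    Σ (Subdivision K) λ K′ → let open Subdivision K′ in
      SimplexwiseLinear complex (coord ∘ f ∘ to)

  IsPLSphere : SimplicialComplex → Set₁
  IsPLSphere K = ∃ λ n → Σ (Homeomorphism ∣ K ∣ ∣ ∂simplex n ∣) λ h →
                 PiecewiseLinear K (∂simplex n) (Homeomorphism.to h)

  ----------------------------------------------------------------------
  -- Regular CW complexes

  -- Finite regular CW complexes, given by characteristic maps.
  record RegularCWComplex : Set₁ where
    field
      space          : TopologicalSpace
      hausdorff      : Hausdorff space
      cells          : ℕ
      dim            : Fin cells → ℕ
      characteristic : ∀ i → Func (points (ball (dim i))) (points space)
      embedding      : ∀ i → IsEmbedding (ball (dim i)) space (characteristic i)

    open TopologicalSpace space using () renaming (_≈_ to _≈ˣ_)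

    χ : ∀ i → Point (ball (dim i)) → Point space
    χ i = Func.to (characteristic i)

    ClosedCell : Fin cells → Pred (Point space) 0ℓ
    ClosedCell i x = ∃ λ b → χ i b ≈ˣ x

    OpenCell : Fin cells → Pred (Point space) 0ℓ
    OpenCell i x = ∃ λ b → ∥ proj₁ b ∥² < 1# × χ i b ≈ˣ x

    field
      covering : ∀ x → ∃ λ i → OpenCell i x
      disjoint : ∀ {i j x} → OpenCell i x → OpenCell j x → i ≡ j
      boundary : ∀ i b → ∥ proj₁ b ∥² ≈ 1# →
                 ∃ λ j → dim j ℕ.< dim i × OpenCell j (χ i b)

    _⊑_ : Rel (Fin cells) 0ℓ
    i ⊑ j = ClosedCell i Unary.⊆ ClosedCell j

    -- Cells are identified when they are equal as subsets of the space.
    cellPoset : Poset 0ℓ 0ℓ 0ℓ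
    cellPoset = Symmetric.poset {R = _⊑_} (λ x∈ → x∈) (λ i⊑j j⊑k → j⊑k ∘ i⊑j)

    facePoset : Poset 0ℓ 0ℓ 0ℓ
    facePoset = record
      { isPartialOrder =
          Extrema.≤±-isPartialOrder _⊑_ (Poset.isPartialOrder cellPoset) }

  IsSphere : RegularCWComplex → Set₁
  IsSphere C = ∃ λ d → Homeomorphism (RegularCWComplex.space C) (sphere d)

-- A minor is a pair (z , H) with z ∈ L and H ⊆ {g ∨ z : g ∈ G} ∖ {z}, and its
-- rank in M is |H| + 1.
--
-- An alternating sum over an interval vanishes by toggling a generator whenever
-- some generator may be kept or dropped over every z.  Removing the generators
-- of the lower end one at a time reduces all other intervals to those starting
-- at a vertex (t , ∅) with t the join of H, and these are evaluated by Möbius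
-- inversion, since the minors below any minor have alternating sum 1.
--
-- For the topology, give (z , H) the vector of ℝ^G with entry 1 at g ≤ z, 0 at
-- g with g ∨ z ∈ H, and −1 otherwise.  These vectors span a complete simplicial
-- fan whose cones are the chains of proper minors: the least member of a chain
-- is read off the signs of a positive combination x of its vectors, as
-- z = ⋁ {g : x g > 0} and H = {g ∨ z : x g = 0} ∖ {z}, and subtracting a
-- multiple of its vector from x leaves a combination of a chain above it.
-- The fan of ∂Δⁿ and this one have a common subdivision, in which every vector
-- decomposes along a chain of supports; rescaling its rays gives the PL
-- homeomorphism.  The same fan for each minor parametrises its closed cell by a
-- ball.  Continuity follows from compactness and closed graphs.

module Submission where

open import Axiom.ExcludedMiddle using (ExcludedMiddle)
open import Data.Fin.Subset using (Nonempty)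
open import Data.Product.Base using (Σ; _×_)
open import Level using (0ℓ; suc)
open import Defs

open import Algebra.Bundles using (CommutativeRing; RawRing)
import Algebra.Properties.Group as GroupProperties
import Algebra.Properties.Ring as RingProperties
import Algebra.Properties.Semiring.Mult.TCOptimised as SemiringMult
import Algebra.Solver.Ring as RingSolver
import Algebra.Solver.Ring.AlmostCommutativeRing as ACR
import Data.Bool.Properties as Bool
open import Data.Empty using (⊥; ⊥-elim)
open import Data.Fin.Base as Fin using (Fin)
open import Data.Fin.Properties using (_≟_; any?; all?)
import Data.Fin.Subset as Subset
open import Data.Fin.Subset using (Subset; inside; outside; _∈_; _∉_; _⊆_; _─_; ∣_∣) renaming (_-_ to _∖_)
open import Data.Fin.Subset.Properties using (_∈?_; nonempty?; ⊆-refl; ⊆-trans; ⊆-antisym; ∉⊥; ∣⊥∣≡0; Empty-unique; p─⊥≡p; p─q⊆p; x∈p∧x∉q⇒x∈p─q; x∈p∧x≢y⇒x∈p-y; p⊆q⇒∣p∣≤∣q∣; p⊂q⇒∣p∣<∣q∣)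
open import Data.Integer.Base as ℤ using (ℤ; 0ℤ; 1ℤ; -1ℤ; +_; -[1+_])
import Data.Integer.Properties as ℤ
open import Data.List.Base using (List; []; _∷_; _++_; map; foldr; filter; length; lookup; cartesianProduct; allFin)
import Data.List.Membership.Propositional as List
open import Data.List.Membership.Propositional.Properties using (∈-map⁺; ∈-map⁻; ∈-++⁺ˡ; ∈-++⁺ʳ; ∈-cartesianProduct⁺; ∈-allFin; ∈-filter⁺; ∈-filter⁻; ∈-lookup)
open import Data.List.Membership.Propositional.Properties.WithK using (unique∧set⇒bag)
import Data.List.Membership.Setoid as SetoidMembership
import Data.List.Membership.Setoid.Properties as SetoidMembershipₚ
import Data.List.Properties as List
open import Data.List.Relation.Binary.BagAndSetEquality using (∼bag⇒↭)
open import Data.List.Relation.Binary.Permutation.Propositional as Perm using (_↭_)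
import Data.List.Relation.Unary.All as All
import Data.List.Relation.Unary.AllPairs as AllPairs
open import Data.List.Relation.Unary.Any as Any using (here; there)
open import Data.List.Relation.Unary.Any.Properties as Any using (lookup-index)
open import Data.List.Relation.Unary.Enumerates.Setoid using (IsEnumeration)
open import Data.List.Relation.Unary.Unique.Propositional using (Unique)
import Data.List.Relation.Unary.Unique.Propositional.Properties as Unique
import Data.List.Relation.Unary.Unique.Setoid as SetoidUnique
import Data.List.Relation.Unary.Unique.Setoid.Properties as SetoidUniqueₚ
open import Data.Maybe.Base using (Maybe; just; nothing)
open import Data.Nat.Base as ℕ using (ℕ; z≤n; s≤s)
import Data.Nat.Properties as ℕ
open import Data.Product.Base using (∃; _,_; proj₁; proj₂)
open import Data.Product.Properties using (≡-dec)
open import Data.Sum.Base as Sum using (_⊎_; inj₁; inj₂)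
import Data.Unit.Base as Unit
open import Data.Vec.Base using ([]; _∷_; here; there; _[_]≔_)
open import Data.Vec.Properties as Vec using ([]≔-updates)
open import Function.Base using (_∘_)
open import Function.Bundles using (Equivalence; _⇔_; mk⇔)
open import Level using (lift; lower)
open import Relation.Binary.Bundles using (Poset; Setoid)
import Relation.Binary.Construct.Add.Extrema.NonStrict as Extrema
import Relation.Binary.Construct.Add.Infimum.Equality as InfEq
import Relation.Binary.Construct.Add.Infimum.NonStrict as Infimum
open Infimum using (⊥₋≤_; [_])
import Relation.Binary.Construct.Add.Supremum.NonStrict as Supremum
import Relation.Binary.Construct.Closure.ReflexiveTransitive as Closure
open Closure using (Star; _◅_)
import Relation.Binary.Construct.NonStrictToStrict as NonStrictToStrict
open import Relation.Binary.Definitions using (DecidableEquality)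
open import Relation.Binary.Lattice.Structures using (IsBoundedLattice)
import Relation.Binary.PropositionalEquality as ≡
open ≡ using (_≡_; _≢_; refl; sym; trans; cong; cong₂; subst; subst₂; module ≡-Reasoning)
open import Relation.Binary.Structures using (IsTotalOrder)
open import Relation.Nullary using (¬_; Dec; yes; no)
import Relation.Nullary.Construct.Add.Extrema as Ext
open Ext using (_±; ⊥±; ⊤±)
open import Relation.Nullary.Construct.Add.Infimum using (⊥₋; [_])
open import Relation.Nullary.Decidable using (_×-dec_; _→-dec_; map′; ¬?; decidable-stable)
open import Relation.Unary using (Pred; Decidable; _≐_; _≬_)

-- For a Boolean lattice generated by its atoms, the minors are the faces of the cube [-1, 1]^G and
-- the vectors of the fan are the barycentres of these faces; this is where the signs come from. In
-- general the sign at a generator is not monotone along a chain: a generator deleted from a larger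
-- minor may lie below the join z of a smaller one, so that -1 turns into 1 and the coordinate of a
-- positive combination can have any sign. The proof therefore rests on the generators that no
-- member of the chain deletes: they suffice to recover z and H, and on them the summands do not
-- cancel. Decompositions along the fan arise by repeated subtraction, without a formula that would
-- show them to depend continuously on the vector. Hence the maps built from them are pinned down by
-- conditions that survive limits, and continuity is deduced from uniqueness.

-- Finite sums over lists in a commutative ring.

module FiniteSums {c ℓ} (R : CommutativeRing c ℓ) where

  open CommutativeRing R renaming (refl to ≈-refl; sym to ≈-sym; trans to ≈-trans; reflexive to ≈-reflexive)
  open import Relation.Binary.Reasoning.Setoid setoid

  ∑ : ∀ {a} {A : Set a} → List A → (A → Carrier) → Carrier
  ∑ xs f = foldr _+_ 0# (map f xs)

  -- An Iverson bracket: a sum over an interval becomes a sum over all cells with such terms, so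
  -- that sums can be split and exchanged termwise.
  term : ∀ {p} {P : Set p} → Dec P → Carrier → Carrier
  term (yes _) x = x
  term (no _)  x = 0#

  term-yes : ∀ {p} {P : Set p} (d : Dec P) {x} → P → term d x ≈ x
  term-yes (yes _) _ = ≈-refl
  term-yes (no ¬p) p = ⊥-elim (¬p p)

  term-no : ∀ {p} {P : Set p} (d : Dec P) {x} → ¬ P → term d x ≈ 0#
  term-no (yes p) ¬p = ⊥-elim (¬p p)
  term-no (no _)  _  = ≈-refl

  term-cong : ∀ {p q} {P : Set p} {Q : Set q} (d : Dec P) (e : Dec Q) {x y} →
              (P → Q) → (Q → P) → x ≈ y → term d x ≈ term e y
  term-cong (yes p) (yes q) f g eq = eq
  term-cong (yes p) (no ¬q) f g eq = ⊥-elim (¬q (f p))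
  term-cong (no ¬p) (yes q) f g eq = ⊥-elim (¬p (g q))
  term-cong (no ¬p) (no ¬q) f g eq = ≈-refl

  module _ {a} {A : Set a} where

    ∑-cong-∈ : ∀ xs {f g : A → Carrier} → (∀ {x} → x List.∈ xs → f x ≈ g x) → ∑ xs f ≈ ∑ xs g
    ∑-cong-∈ []       eq = ≈-refl
    ∑-cong-∈ (x ∷ xs) eq = +-cong (eq (here refl)) (∑-cong-∈ xs (eq ∘ there))

    ∑-cong : ∀ xs {f g : A → Carrier} → (∀ x → f x ≈ g x) → ∑ xs f ≈ ∑ xs g
    ∑-cong xs eq = ∑-cong-∈ xs (λ {x} _ → eq x)

    ∑-zero : ∀ xs {f : A → Carrier} → (∀ {x} → x List.∈ xs → f x ≈ 0#) → ∑ xs f ≈ 0#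
    ∑-zero []       eq = ≈-refl
    ∑-zero (x ∷ xs) eq = ≈-trans (+-cong (eq (here refl)) (∑-zero xs (eq ∘ there))) (+-identityˡ 0#)

    ∑-++ : ∀ xs ys {f : A → Carrier} → ∑ (xs ++ ys) f ≈ ∑ xs f + ∑ ys f
    ∑-++ []       ys = ≈-sym (+-identityˡ _)
    ∑-++ (x ∷ xs) ys = ≈-trans (+-congˡ (∑-++ xs ys)) (≈-sym (+-assoc _ _ _))

    interchange : ∀ w x y z → (w + x) + (y + z) ≈ (w + y) + (x + z)
    interchange w x y z = begin
      (w + x) + (y + z) ≈⟨ +-assoc w x (y + z) ⟩
      w + (x + (y + z)) ≈⟨ +-congˡ (≈-sym (+-assoc x y z)) ⟩
      w + ((x + y) + z) ≈⟨ +-congˡ (+-congʳ (+-comm x y)) ⟩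
      w + ((y + x) + z) ≈⟨ +-congˡ (+-assoc y x z) ⟩
      w + (y + (x + z)) ≈⟨ ≈-sym (+-assoc w y (x + z)) ⟩
      (w + y) + (x + z) ∎

    ∑-+ : ∀ xs (f g : A → Carrier) → ∑ xs (λ x → f x + g x) ≈ ∑ xs f + ∑ xs g
    ∑-+ []       f g = ≈-sym (+-identityˡ 0#)
    ∑-+ (x ∷ xs) f g = ≈-trans (+-congˡ (∑-+ xs f g)) (interchange _ _ _ _)

    ∑-*ˡ : ∀ k xs (f : A → Carrier) → ∑ xs (λ x → k * f x) ≈ k * ∑ xs f
    ∑-*ˡ k []       f = ≈-sym (zeroʳ k)
    ∑-*ˡ k (x ∷ xs) f = ≈-trans (+-congˡ (∑-*ˡ k xs f)) (≈-sym (distribˡ k _ _))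

    ∑-*ʳ : ∀ k xs (f : A → Carrier) → ∑ xs (λ x → f x * k) ≈ ∑ xs f * k
    ∑-*ʳ k xs f = ≈-trans (∑-cong xs λ x → *-comm (f x) k) (≈-trans (∑-*ˡ k xs f) (*-comm k _))

    ∑-↭ : ∀ {xs ys} (f : A → Carrier) → xs ↭ ys → ∑ xs f ≈ ∑ ys f
    ∑-↭ f Perm.refl         = ≈-refl
    ∑-↭ f (Perm.prep x p)   = +-congˡ (∑-↭ f p)
    ∑-↭ f (Perm.swap {xs = xs} {ys = ys} x y p) = begin
      f x + (f y + ∑ xs f) ≈⟨ +-congˡ (+-congˡ (∑-↭ f p)) ⟩
      f x + (f y + ∑ ys f) ≈⟨ ≈-sym (+-assoc _ _ _) ⟩
      (f x + f y) + ∑ ys f ≈⟨ +-congʳ (+-comm _ _) ⟩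
      (f y + f x) + ∑ ys f ≈⟨ +-assoc _ _ _ ⟩
      f y + (f x + ∑ ys f) ∎
    ∑-↭ f (Perm.trans p q)  = ≈-trans (∑-↭ f p) (∑-↭ f q)

    -- Duplicate-free lists with the same members agree as bags, hence up to permutation. Sums
    -- thereby depend only on the set that is listed.
    ∑-unique : ∀ {xs ys} (f : A → Carrier) → Unique xs → Unique ys →
               (∀ {x} → x List.∈ xs → x List.∈ ys) → (∀ {x} → x List.∈ ys → x List.∈ xs) →
               ∑ xs f ≈ ∑ ys f
    ∑-unique f u v i j = ∑-↭ f (∼bag⇒↭ (unique∧set⇒bag u v (mk⇔ i j)))

    ∑-filter : ∀ {p} {P : Pred A p} (P? : Decidable P) xs (f : A → Carrier) →
               ∑ (filter P? xs) f ≈ ∑ xs (λ x → term (P? x) (f x))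
    ∑-filter P? []       f = ≈-refl
    ∑-filter P? (x ∷ xs) f with P? x
    ... | yes _ = +-congˡ (∑-filter P? xs f)
    ... | no  _ = ≈-trans (∑-filter P? xs f) (≈-sym (+-identityˡ _))

    ∑-single : ∀ {xs x} {f : A → Carrier} → Unique xs → x List.∈ xs →
               (∀ {y} → y ≢ x → f y ≈ 0#) → ∑ xs f ≈ f x
    ∑-single {_ ∷ xs} (x∉ AllPairs.∷ u) (here refl) z =
      ≈-trans (+-congˡ (∑-zero xs λ y∈ → z (λ { refl → All.lookup x∉ y∈ refl }))) (+-identityʳ _)
    ∑-single (x∉ AllPairs.∷ u) (there x∈) z =
      ≈-trans (+-cong (z (λ { refl → All.lookup x∉ x∈ refl })) (∑-single u x∈ z)) (+-identityˡ _)

    ∑-single-term : ∀ {xs x} {f : A → Carrier} {p} {P : Pred A p} (P? : Decidable P) →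
                    Unique xs → x List.∈ xs → P x → (∀ {y} → P y → y ≡ x) →
                    ∑ xs (λ y → term (P? y) (f y)) ≈ f x
    ∑-single-term P? u x∈ px only = ≈-trans
      (∑-single u x∈ (λ {y} y≢x → term-no (P? y) (y≢x ∘ only))) (term-yes (P? _) px)

    ∑-⊆ : ∀ {xs ys} {f : A → Carrier} (mem? : Decidable (List._∈ xs)) → Unique xs → Unique ys →
          (∀ {x} → x List.∈ xs → x List.∈ ys) →
          (∀ {x} → ¬ x List.∈ xs → f x ≈ 0#) → ∑ xs f ≈ ∑ ys f
    ∑-⊆ {xs} {ys} {f} mem? u v sub z = begin
      ∑ xs f              ≈⟨ ∑-unique f u (Unique.filter⁺ mem? v)
                               (λ x∈ → ∈-filter⁺ mem? (sub x∈) x∈) (proj₂ ∘ ∈-filter⁻ mem? {xs = ys}) ⟩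
      ∑ (filter mem? ys) f  ≈⟨ ∑-filter mem? ys f ⟩
      ∑ ys _              ≈⟨ ∑-cong ys (λ x → helper (mem? x)) ⟩
      ∑ ys f              ∎
      where
      helper : ∀ {x} (d : Dec (x List.∈ xs)) → term d (f x) ≈ f x
      helper (yes _)  = ≈-refl
      helper (no x∉) = ≈-sym (z x∉)

  ∑-map : ∀ {a b} {A : Set a} {B : Set b} (h : A → B) xs {f : B → Carrier} →
          ∑ (map h xs) f ≈ ∑ xs (f ∘ h)
  ∑-map h xs = ≈-reflexive (cong (foldr _+_ 0#) (sym (List.map-∘ xs)))

  ∑-swap : ∀ {a b} {A : Set a} {B : Set b} xs ys (f : A → B → Carrier) →
           ∑ xs (λ x → ∑ ys (f x)) ≈ ∑ ys (λ y → ∑ xs (λ x → f x y))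
  ∑-swap []       ys f = ≈-sym (∑-zero ys (λ _ → ≈-refl))
  ∑-swap (x ∷ xs) ys f = ≈-trans (+-congˡ (∑-swap xs ys f)) (≈-sym (∑-+ ys (f x) _))

  ∑-× : ∀ {a b} {A : Set a} {B : Set b} (xs : List A) (ys : List B) (f : A × B → Carrier) →
        ∑ (cartesianProduct xs ys) f ≈ ∑ xs (λ x → ∑ ys (λ y → f (x , y)))
  ∑-× []       ys f = ≈-refl
  ∑-× (x ∷ xs) ys f = ≈-trans (∑-++ (map (x ,_) ys) _) (+-cong (∑-map (x ,_) ys) (∑-× xs ys f))

-- Finite subsets: listing, cardinality, enumeration.

subset-ext : ∀ {n} {p q : Subset n} → (∀ {x} → x ∈ p → x ∈ q) → (∀ {x} → x ∈ q → x ∈ p) → p ≡ q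
subset-ext f g = ⊆-antisym f g

allSubsets : ∀ n → List (Subset n)
allSubsets ℕ.zero    = [] ∷ []
allSubsets (ℕ.suc n) = map (outside ∷_) (allSubsets n) ++ map (inside ∷_) (allSubsets n)

∈-allSubsets : ∀ {n} (p : Subset n) → p List.∈ allSubsets n
∈-allSubsets []            = here refl
∈-allSubsets (outside ∷ p) = ∈-++⁺ˡ (∈-map⁺ (outside ∷_) (∈-allSubsets p))
∈-allSubsets (inside ∷ p)  = ∈-++⁺ʳ _ (∈-map⁺ (inside ∷_) (∈-allSubsets p))

allSubsets-unique : ∀ n → Unique (allSubsets n)
allSubsets-unique ℕ.zero    = All.[] AllPairs.∷ AllPairs.[]
allSubsets-unique (ℕ.suc n) =
  Unique.++⁺ (Unique.map⁺ (λ { refl → refl }) (allSubsets-unique n))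
             (Unique.map⁺ (λ { refl → refl }) (allSubsets-unique n)) disjoint
  where
  disjoint : ∀ {x} → ¬ (x List.∈ map (outside ∷_) (allSubsets n) × x List.∈ map (inside ∷_) (allSubsets n))
  disjoint (a , b) with ∈-map⁻ (outside ∷_) a | ∈-map⁻ (inside ∷_) b
  ... | _ , _ , refl | _ , _ , ()

∣p-x∣ : ∀ {n} {p : Subset n} {x} → x ∈ p → ∣ p ∣ ≡ ℕ.suc ∣ p ∖ x ∣
∣p-x∣ {p = inside ∷ p} here = cong (ℕ.suc ∘ ∣_∣) (sym (p─⊥≡p p))
∣p-x∣ {p = outside ∷ p} (there x∈) = ∣p-x∣ x∈
∣p-x∣ {p = inside ∷ p}  (there x∈) = cong ℕ.suc (∣p-x∣ x∈)

x∉p-x : ∀ {n} {p : Subset n} x → x ∉ p ∖ x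
x∉p-x {p = _ ∷ _} Fin.zero    ()
x∉p-x {p = _ ∷ _} (Fin.suc x) (there e) = x∉p-x x e

∈-minus : ∀ {n} (p : Subset n) {x y} → x ∈ p ∖ y → x ∈ p × x ≢ y
∈-minus p {x} {y} x∈ = p─q⊆p p _ x∈ , λ { refl → x∉p-x x x∈ }

∈-─⁻ : ∀ {n} (p q : Subset n) {x} → x ∈ p ─ q → x ∈ p × x ∉ q
∈-─⁻ (_ ∷ p) (outside ∷ q) {Fin.zero} here        = here , λ ()
∈-─⁻ (_ ∷ p) (inside ∷ q)  {Fin.zero} ()
∈-─⁻ (_ ∷ p) (outside ∷ q) {Fin.suc x} (there e) =
  let (a , b) = ∈-─⁻ p q e in there a , λ { (there c) → b c }
∈-─⁻ (_ ∷ p) (inside ∷ q)  {Fin.suc x} (there e) =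
  let (a , b) = ∈-─⁻ p q e in there a , λ { (there c) → b c }

∣p∣≡suc⇒nonempty : ∀ {n k} {p : Subset n} → ∣ p ∣ ≡ ℕ.suc k → Nonempty p
∣p∣≡suc⇒nonempty {n} {p = p} eq with nonempty? p
... | yes e = e
... | no ¬e with () ← trans (sym eq) (trans (cong ∣_∣ (Empty-unique ¬e)) (∣⊥∣≡0 n))

-- Induction on the size of `p`, removing a related pair each time. With a relation instead of a
-- function, the equation `k ≡ g ∨ b` can be used in both directions to match generators with their
-- translates.
card-≤ : ∀ {m n} (p : Subset m) (q : Subset n) (R : Fin m → Fin n → Set) →
         (∀ {x} → x ∈ p → ∃ λ y → y ∈ q × R x y) →
         (∀ {x x′ y} → x ∈ p → x′ ∈ p → R x y → R x′ y → x ≡ x′) → ∣ p ∣ ℕ.≤ ∣ q ∣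
card-≤ p q R total inj = go ∣ p ∣ p q refl total inj
  where
  go : ∀ k p q → ∣ p ∣ ≡ k → (∀ {x} → x ∈ p → ∃ λ y → y ∈ q × R x y) →
       (∀ {x x′ y} → x ∈ p → x′ ∈ p → R x y → R x′ y → x ≡ x′) → ∣ p ∣ ℕ.≤ ∣ q ∣
  go ℕ.zero p q eq total inj = subst (ℕ._≤ ∣ q ∣) (sym eq) z≤n
  go (ℕ.suc k) p q eq total inj with ∣p∣≡suc⇒nonempty {p = p} eq
  ... | x , x∈ with total x∈
  ... | y , y∈ , r = subst₂ ℕ._≤_ (sym (∣p-x∣ x∈)) (sym (∣p-x∣ y∈))
      (s≤s (go k (p ∖ x) (q ∖ y) (ℕ.suc-injective (trans (sym (∣p-x∣ x∈)) eq)) total′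
        (λ a b → inj (proj₁ (∈-minus p a)) (proj₁ (∈-minus p b)))))
    where
    total′ : ∀ {x′} → x′ ∈ p ∖ x → ∃ λ y′ → y′ ∈ q ∖ y × R x′ y′
    total′ x′∈ with ∈-minus p x′∈
    ... | x′∈p , x′≢x with total x′∈p
    ... | y′ , y′∈ , r′ = y′ ,
        x∈p∧x≢y⇒x∈p-y y′∈ (λ { refl → x′≢x (inj x′∈p x∈ r′ r) }) , r′

enumerate : ∀ {n} (p : Subset n) → Fin ∣ p ∣ → Fin n
enumerate (outside ∷ p) i       = Fin.suc (enumerate p i)
enumerate (inside ∷ p)  Fin.zero    = Fin.zero
enumerate (inside ∷ p)  (Fin.suc i) = Fin.suc (enumerate p i)

enumerate-∈ : ∀ {n} (p : Subset n) i → enumerate p i ∈ p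
enumerate-∈ (outside ∷ p) i       = there (enumerate-∈ p i)
enumerate-∈ (inside ∷ p)  Fin.zero    = here
enumerate-∈ (inside ∷ p)  (Fin.suc i) = there (enumerate-∈ p i)

enumerate-onto : ∀ {n} (p : Subset n) {x} → x ∈ p → ∃ λ i → enumerate p i ≡ x
enumerate-onto (inside ∷ p)  here      = Fin.zero , refl
enumerate-onto (inside ∷ p)  (there e) = let (i , eq) = enumerate-onto p e in Fin.suc i , cong Fin.suc eq
enumerate-onto (outside ∷ p) (there e) = let (i , eq) = enumerate-onto p e in i , cong Fin.suc eq

suc-inj : ∀ {n} {x y : Fin n} → Fin.suc x ≡ Fin.suc y → x ≡ y
suc-inj refl = refl

enumerate-injective : ∀ {n} (p : Subset n) {i j} → enumerate p i ≡ enumerate p j → i ≡ j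
enumerate-injective (outside ∷ p) eq = enumerate-injective p (suc-inj eq)
enumerate-injective (inside ∷ p) {Fin.zero}  {Fin.zero}  eq = refl
enumerate-injective (inside ∷ p) {Fin.suc i} {Fin.suc j} eq =
  cong Fin.suc (enumerate-injective p (suc-inj eq))

-- Minors as pairs of a minimum and a set of generators.

module Cells (LG : GeneratorEnrichedLattice) where

  open GeneratorEnrichedLattice LG
  open Minors LG
  open IsBoundedLattice isBoundedLattice public
    using (x≤x∨y; y≤x∨y; ∨-least; minimum; antisym)
    renaming (refl to ≤-refl; trans to ≤-trans; reflexive to ≤-reflexive)

  Cell : Set
  Cell = Fin size × Subset size

  _≟ᶜ_ : DecidableEquality Cell
  _≟ᶜ_ = ≡-dec _≟_ (Vec.≡-dec Bool._≟_)

  abstract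
    _≤?_ : ∀ x y → Dec (x ≤ y)
    x ≤? y = map′ (λ eq → subst (x ≤_) eq (x≤x∨y x y))
                  (λ x≤y → antisym (∨-least x≤y ≤-refl) (y≤x∨y x y)) (x ∨ y ≟ y)

  allCells : List Cell
  allCells = cartesianProduct (allFin size) (allSubsets size)

  ∈-allCells : ∀ c → c List.∈ allCells
  ∈-allCells (z , H) = ∈-cartesianProduct⁺ (∈-allFin z) (∈-allSubsets H)

  allCells-unique : Unique allCells
  allCells-unique = Unique.cartesianProduct⁺ (Unique.allFin⁺ size) (allSubsets-unique size)

  -- Membership of `z′` in the lattice generated by `H` over `z`, as a least-upper-bound property:
  -- `z′` is the join of `z` and the members of `H` below `z′`. No set of joinands has to be carried
  -- along.
  Spans : Subset size → Fin size → Fin size → Set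
  Spans H z z′ = z ≤ z′ × (∀ {u} → z ≤ u → (∀ {h} → h ∈ H → h ≤ z′ → h ≤ u) → z′ ≤ u)

  below : Subset size → Fin size → Subset size
  below H u = ⟪ (λ h → (h ∈? H) ×-dec (h ≤? u)) ⟫

  ∈-below⁺ : ∀ {H u h} → h ∈ H → h ≤ u → h ∈ below H u
  ∈-below⁺ {H} {u} h∈ h≤ = ∈⟪⟫⁺ (λ h → (h ∈? H) ×-dec (h ≤? u)) (h∈ , h≤)

  ∈-below⁻ : ∀ {H u h} → h ∈ below H u → h ∈ H × h ≤ u
  ∈-below⁻ {H} {u} = ∈⟪⟫⁻ (λ h → (h ∈? H) ×-dec (h ≤? u))

  -- All members of `H` below `z′` form a canonical set of joinands; comparing their join with `z′`
  -- also decides `Spans`.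
  spans-⋁ : ∀ {H z z′} → Spans H z z′ → z ∨ ⋁ (below H z′) ≡ z′
  spans-⋁ {H} {z} {z′} (z≤z′ , least) = antisym
    (∨-least z≤z′ (⋁-least (proj₂ ∘ ∈-below⁻ {H})))
    (least (x≤x∨y _ _) (λ h∈ h≤ → ≤-trans (⋁-upper (∈-below⁺ h∈ h≤)) (y≤x∨y _ _)))

  ⋁-spans : ∀ {H z X} → X ⊆ H → Spans H z (z ∨ ⋁ X)
  ⋁-spans {X = X} X⊆H = x≤x∨y _ _ , λ z≤u ub →
    ∨-least z≤u (⋁-least (λ x∈ → ub (X⊆H x∈) (≤-trans (⋁-upper {X} x∈) (y≤x∨y _ _))))

  abstract
    spans? : ∀ H z z′ → Dec (Spans H z z′)
    spans? H z z′ = map′ (λ eq → subst (Spans H z) eq (⋁-spans (proj₁ ∘ ∈-below⁻ {H})))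
                         spans-⋁ (z ∨ ⋁ (below H z′) ≟ z′)

  Valid : Cell → Set
  Valid (z , H) = ∀ {h} → h ∈ H → z ≤ h × h ≢ z

  infix 4 _⊴_
  -- One contraction followed by one deletion, in closed form. `⊴-trans` shows that longer sequences
  -- reach nothing else.
  _⊴_ : Cell → Cell → Set
  (z₁ , H₁) ⊴ (z₂ , H₂) = Spans H₂ z₂ z₁ × (∀ {h} → h ∈ H₁ → ∃ λ g → g ∈ H₂ × h ≡ g ∨ z₁)

  abstract
    _⊴?_ : ∀ x y → Dec (x ⊴ y)
    (z₁ , H₁) ⊴? (z₂ , H₂) = spans? H₂ z₂ z₁ ×-dec
      map′ (λ f {h} → f h) (λ f h → f {h})
        (all? λ h → (h ∈? H₁) →-dec any? λ g → (g ∈? H₂) ×-dec (h ≟ g ∨ z₁))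

    valid? : ∀ x → Dec (Valid x)
    valid? (z , H) = map′ (λ f {h} → f h) (λ f h → f {h})
      (all? λ h → (h ∈? H) →-dec ((z ≤? h) ×-dec ¬? (h ≟ z)))

  spans-refl : ∀ {H z} → Spans H z z
  spans-refl = ≤-refl , λ z≤u _ → z≤u

  ⊴-refl : ∀ {x} → Valid x → x ⊴ x
  ⊴-refl v = spans-refl , λ h∈ → _ , h∈ , sym (∨-absorb (proj₁ (v h∈)))

  ∨-assoc-absorb : ∀ {x y z} → y ≤ z → (x ∨ y) ∨ z ≡ x ∨ z
  ∨-assoc-absorb y≤z = antisym
    (∨-least (∨-least (x≤x∨y _ _) (≤-trans y≤z (y≤x∨y _ _))) (y≤x∨y _ _))
    (∨-least (≤-trans (x≤x∨y _ _) (x≤x∨y _ _)) (y≤x∨y _ _))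

  -- A generator of the middle pair is a translate `g ∨ b` with `g` in `C`; if it lies below `a`, so
  -- does `g`, which can replace it over any bound of `b`. Since `b ≤ a`, joining with `b` and then
  -- `a` is joining with `a`, so two translations compose into one.
  ⊴-trans : ∀ {x y z} → x ⊴ y → y ⊴ z → x ⊴ z
  ⊴-trans {a , A} {b , B} {c , C} ((b≤a , la) , fa) ((c≤b , lb) , fb) =
    (≤-trans c≤b b≤a , λ {u} c≤u ub →
      la (lb c≤u (λ h∈ h≤b → ub h∈ (≤-trans h≤b b≤a)))
         (λ h∈ h≤a → through ub (lb c≤u (λ h∈ h≤b → ub h∈ (≤-trans h≤b b≤a))) (fb h∈) h≤a)) ,
    λ h∈ → let (g , g∈ , eq) = fa h∈ ; (k , k∈ , eq′) = fb g∈ in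
      k , k∈ , trans eq (trans (cong (_∨ a) eq′) (∨-assoc-absorb b≤a))
    where
    through : ∀ {u h} → (∀ {h} → h ∈ C → h ≤ a → h ≤ u) → b ≤ u →
              (∃ λ g → g ∈ C × h ≡ g ∨ b) → h ≤ a → h ≤ u
    through ub b≤u (g , g∈ , refl) h≤a = ∨-least (ub g∈ (≤-trans (x≤x∨y _ _) h≤a)) b≤u

  ⊴-antisym : ∀ {x y} → Valid x → Valid y → x ⊴ y → y ⊴ x → x ≡ y
  ⊴-antisym {a , A} {b , B} vx vy ((b≤a , _) , f) ((a≤b , _) , g)
    with refl ← antisym a≤b b≤a = cong (a ,_) (subset-ext (into vy f) (into vx g))
    where
    into : ∀ {A B : Subset size} → Valid (a , B) →
           (∀ {h} → h ∈ A → ∃ λ g → g ∈ B × h ≡ g ∨ a) → ∀ {h} → h ∈ A → h ∈ B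
    into {B = B} v f h∈ with g , g∈ , refl ← f h∈ =
      subst (_∈ B) (sym (∨-absorb (proj₁ (v g∈)))) g∈

  ⊴-delete : ∀ {z} {A B : Subset size} → Valid (z , B) → A ⊆ B → (z , A) ⊴ (z , B)
  ⊴-delete v A⊆B = spans-refl , λ h∈ → _ , A⊆B h∈ , sym (∨-absorb (proj₁ (v (A⊆B h∈))))

  contractTo : Subset size → Fin size → Subset size
  contractTo H i = ⟪ isTranslate? H i ⟫ ∖ i

  ∈-contract⁺ : ∀ {H i g} → g ∈ H → ¬ g ≤ i → g ∨ i ∈ contractTo H i
  ∈-contract⁺ {H} {i} g∈ g≰ = x∈p∧x≢y⇒x∈p-y (∈⟪⟫⁺ (isTranslate? H i) (_ , g∈ , refl))
    (λ eq → g≰ (subst (_ ≤_) eq (x≤x∨y _ _)))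

  ∈-contract⁻ : ∀ {H i x} → x ∈ contractTo H i → ∃ λ g → g ∈ H × x ≡ g ∨ i × ¬ g ≤ i
  ∈-contract⁻ {H} {i} {x} x∈ with ∈-minus ⟪ isTranslate? H i ⟫ x∈
  ... | x∈′ , x≢i with ∈⟪⟫⁻ (isTranslate? H i) x∈′
  ... | g , g∈ , refl = g , g∈ , refl , λ g≤i → x≢i (antisym (∨-least g≤i ≤-refl) (y≤x∨y _ _))

  valid-contract : ∀ {H i} → Valid (i , contractTo H i)
  valid-contract {H} x∈ with g , g∈ , refl , g≰ ← ∈-contract⁻ {H} x∈ =
    y≤x∨y _ _ , λ eq → g≰ (subst (g ≤_) eq (x≤x∨y _ _))

  ⊴-contract : ∀ {H z i} → Spans H z i → (i , contractTo H i) ⊴ (z , H)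
  ⊴-contract {H} sp = sp , λ x∈ → let (g , g∈ , eq , _) = ∈-contract⁻ {H} x∈ in g , g∈ , eq

  enr : Cell → Enriched
  enr (z , H) = ⟨ H ∣ z ⟩

  enr-injective : ∀ {x y} → enr x ≡ enr y → x ≡ y
  enr-injective {z , H} {z′ , H′} eq with refl ← cong proj₂ eq =
    cong (_, H) (min-unique (carrier-min {H}) (subst (z′ IsMinimumOf_) (sym (cong proj₁ eq)) (carrier-min {H})))

  -- Contracting every generator below `z₁` moves the minimum to exactly `z₁`, by `spans-⋁`;
  -- deleting what then lies outside `H₁` leaves `H₁`.
  ⊴⇒star : ∀ {x y} → Valid x → x ⊴ y → Star _⟶_ (enr y) (enr x)
  ⊴⇒star {z₁ , H₁} {z₂ , H₂} v (sp , f) =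
    subst (λ i → enr (z₂ , H₂) ⟶ ⟨ contractTo H₂ i ∣ i ⟩) (spans-⋁ sp)
      (contraction (carrier-min {H₂}) (proj₁ ∘ ∈-below⁻ {H₂})) ◅
    subst (λ H → ⟨ contractTo H₂ z₁ ∣ z₁ ⟩ ⟶ ⟨ H ∣ z₁ ⟩) (subset-ext to from)
      (deletion (carrier-min {contractTo H₂ z₁}) (p─q⊆p (contractTo H₂ z₁) H₁)) ◅ Closure.ε
    where
    C = contractTo H₂ z₁
    to : ∀ {x} → x ∈ C ─ (C ─ H₁) → x ∈ H₁
    to {x} x∈ with x ∈? H₁ | ∈-─⁻ C (C ─ H₁) x∈
    ... | yes e | _     = e
    ... | no ¬e | c , d = ⊥-elim (d (x∈p∧x∉q⇒x∈p─q c ¬e))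
    from : ∀ {x} → x ∈ H₁ → x ∈ C ─ (C ─ H₁)
    from x∈ with g , g∈ , refl ← f x∈ = x∈p∧x∉q⇒x∈p─q
      (∈-contract⁺ {H₂} g∈ (λ g≤ → proj₂ (v x∈) (antisym (∨-least g≤ ≤-refl) (y≤x∨y _ _))))
      (λ e → proj₂ (∈-─⁻ C H₁ e) x∈)

  step⇒⊴ : ∀ {y A B} → Valid y → A ≡ enr y → A ⟶ B → ∃ λ x → B ≡ enr x × Valid x × x ⊴ y
  step⇒⊴ {z , H} v refl (deletion {I = I} m I⊆H) with refl ← min-unique (carrier-min {H}) m =
    (z , H ─ I) , refl , (λ h∈ → v (p─q⊆p H I h∈)) , ⊴-delete v (p─q⊆p H I)
  step⇒⊴ {z , H} v refl (contraction {I = I} m I⊆H) with refl ← min-unique (carrier-min {H}) m =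
    _ , refl , valid-contract {H} , ⊴-contract (⋁-spans I⊆H)

  star⇒⊴ : ∀ {y A B} → Valid y → A ≡ enr y → Star _⟶_ A B → ∃ λ x → B ≡ enr x × Valid x × x ⊴ y
  star⇒⊴ v eq Closure.ε = _ , eq , v , ⊴-refl v
  star⇒⊴ v eq (s ◅ ss) with step⇒⊴ v eq s
  ... | x , eq′ , v′ , x⊴y with star⇒⊴ v′ eq′ ss
  ... | w , eq″ , v″ , w⊴x = w , eq″ , v″ , ⊴-trans w⊴x x⊴y

  top : Cell
  top = 0̂ , G

  valid-top : Valid top
  valid-top h∈ = minimum _ , λ { refl → 0̂∉G h∈ }

  whole≡enr : whole ≡ enr top
  whole≡enr = cong (_, G) (proj₁ (proj₂ whole-good))

  -- Read off a particular sequence of steps, but by `enr-injective` dependent only on the resulting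
  -- pair.
  cellOf : Minor → Cell
  cellOf (_ , s) = proj₁ (star⇒⊴ valid-top whole≡enr s)

  module _ (m : Minor) where
    private r = star⇒⊴ valid-top whole≡enr (proj₂ m)

    cellOf-enr : proj₁ m ≡ enr (cellOf m)
    cellOf-enr = proj₁ (proj₂ r)

    cellOf-valid : Valid (cellOf m)
    cellOf-valid = proj₁ (proj₂ (proj₂ r))

    cellOf-⊴ : cellOf m ⊴ top
    cellOf-⊴ = proj₂ (proj₂ (proj₂ r))

  minorOf : ∀ x → Valid x → x ⊴ top → Minor
  minorOf x v x⊴ = enr x , subst (λ A → Star _⟶_ A (enr x)) (sym whole≡enr) (⊴⇒star v x⊴)

  cellOf-minorOf : ∀ x (v : Valid x) (x⊴ : x ⊴ top) → cellOf (minorOf x v x⊴) ≡ x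
  cellOf-minorOf x v x⊴ = sym (enr-injective (cellOf-enr (minorOf x v x⊴)))

  cellOf-cong : ∀ m m′ → m ≈ᴹ m′ → cellOf m ≡ cellOf m′
  cellOf-cong m m′ eq = enr-injective (trans (sym (cellOf-enr m)) (trans eq (cellOf-enr m′)))

  cellOf-injective : ∀ m m′ → cellOf m ≡ cellOf m′ → m ≈ᴹ m′
  cellOf-injective m m′ eq = trans (cellOf-enr m) (trans (cong enr eq) (sym (cellOf-enr m′)))

  ≤ᴹ⇒⊴ : ∀ m m′ → m ≤ᴹ m′ → cellOf m ⊴ cellOf m′
  ≤ᴹ⇒⊴ m m′ s with star⇒⊴ (cellOf-valid m′) (cellOf-enr m′) s
  ... | x , eq , _ , x⊴ = subst (_⊴ cellOf m′) (enr-injective (trans (sym eq) (cellOf-enr m))) x⊴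

  ⊴⇒≤ᴹ : ∀ m m′ → cellOf m ⊴ cellOf m′ → m ≤ᴹ m′
  ⊴⇒≤ᴹ m m′ c = subst₂ (Star _⟶_) (sym (cellOf-enr m′)) (sym (cellOf-enr m))
                  (⊴⇒star (cellOf-valid m) c)

-- Gradedness.

module Facets (LG : GeneratorEnrichedLattice) where

  open GeneratorEnrichedLattice LG
  open Minors LG
  open Cells LG

  rank : Cell → ℕ
  rank (_ , H) = ∣ H ∣

  valid-⊆ : ∀ {z} {A B : Subset size} → A ⊆ B → Valid (z , B) → Valid (z , A)
  valid-⊆ A⊆B v h∈ = v (A⊆B h∈)

  -- The generator g may be omitted when it is redundant both for reaching z₁
  -- and for producing the generators over z₁.
  ⊴-without : ∀ {z₁ z₂ H₁ H₂ g} → Valid (z₁ , H₁) → (z₁ , H₁) ⊴ (z₂ , H₂) →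
    (g ≤ z₁ → ∀ {u} → z₂ ≤ u → (∀ {h} → h ∈ H₂ ∖ g → h ≤ z₁ → h ≤ u) → g ≤ u) →
    (¬ g ≤ z₁ → ∃ λ k → k ∈ H₂ ∖ g × k ∨ z₁ ≡ g ∨ z₁) →
    (z₁ , H₁) ⊴ (z₂ , H₂ ∖ g)
  ⊴-without {z₁} {z₂} {H₁} {H₂} {g} v ((z₂≤z₁ , least) , f) low high =
    (z₂≤z₁ , λ {u} z₂≤u ub → least z₂≤u (λ {h} h∈ h≤ → bound z₂≤u ub h∈ h≤ (h ≟ g))) ,
    λ h∈ → let (k , k∈ , eq) = f h∈ in choose h∈ k∈ eq (k ≟ g)
    where
    bound : ∀ {u h} → z₂ ≤ u → (∀ {h} → h ∈ H₂ ∖ g → h ≤ z₁ → h ≤ u) →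
            h ∈ H₂ → h ≤ z₁ → Dec (h ≡ g) → h ≤ u
    bound z₂≤u ub h∈ h≤ (yes refl) = low h≤ z₂≤u ub
    bound z₂≤u ub h∈ h≤ (no h≢g)   = ub (x∈p∧x≢y⇒x∈p-y h∈ h≢g) h≤
    choose : ∀ {h k} → h ∈ H₁ → k ∈ H₂ → h ≡ k ∨ z₁ → Dec (k ≡ g) →
             ∃ λ k → k ∈ H₂ ∖ g × h ≡ k ∨ z₁
    choose h∈ k∈ eq (no k≢g) = _ , x∈p∧x≢y⇒x∈p-y k∈ k≢g , eq
    choose h∈ k∈ refl (yes refl) =
      let (k′ , k′∈ , eq) = high (λ g≤ → proj₂ (v h∈) (antisym (∨-least g≤ ≤-refl) (y≤x∨y _ _)))
      in k′ , k′∈ , sym eq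

  ∨-through : ∀ {x y b z} → b ≤ z → x ∨ b ≡ y ∨ b → x ∨ z ≡ y ∨ z
  ∨-through {x} {y} {b} {z} b≤z eq =
    trans (sym (∨-assoc-absorb b≤z)) (trans (cong (_∨ z) eq) (∨-assoc-absorb b≤z))

  -- If a generator of `y` can be deleted without losing `x`, delete it. Otherwise every generator
  -- is needed, and a generator below `z₁` is contracted; as all are needed, this loses no generator
  -- but the contracted one. Either way exactly one generator disappears.
  facet : ∀ {x y} → Valid x → Valid y → x ⊴ y → x ≢ y →
          ∃ λ w → Valid w × x ⊴ w × w ⊴ y × rank y ≡ ℕ.suc (rank w)
  facet {x@(z₁ , H₁)} {y@(z₂ , H₂)} vx vy x⊴y@((z₂≤z₁ , least) , f) x≢y
    with any? (λ h → (h ∈? H₂) ×-dec (x ⊴? (z₂ , H₂ ∖ h)))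
  ... | yes (h , h∈ , x⊴) = (z₂ , H₂ ∖ h) , valid-⊆ (p─q⊆p H₂ _) vy , x⊴ ,
                            ⊴-delete vy (p─q⊆p H₂ _) , ∣p-x∣ h∈
  ... | no needed with any? (λ h → (h ∈? H₂) ×-dec (h ≤? z₁))
  -- With nothing below `z₁` to contract, `z₂ ≡ z₁`, and a generator of `y` outside `H₁` could be
  -- deleted.
  ... | no none = ⊥-elim (x≢y (sym (cong₂ _,_ z₂≡z₁ H₂≡H₁)))
    where
    z₂≡z₁ : z₂ ≡ z₁
    z₂≡z₁ = antisym z₂≤z₁ (least ≤-refl (λ h∈ h≤ → ⊥-elim (none (_ , h∈ , h≤))))
    absorb : ∀ {g} → g ∈ H₂ → g ∨ z₁ ≡ g
    absorb g∈ = ∨-absorb (subst (_≤ _) z₂≡z₁ (proj₁ (vy g∈)))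
    H₂≡H₁ : H₂ ≡ H₁
    H₂≡H₁ = subset-ext
      (λ {h} h∈ → decidable-stable (h ∈? H₁) λ h∉ → needed (h , h∈ ,
        ((z₂≤z₁ , λ z₂≤u _ → subst (_≤ _) z₂≡z₁ z₂≤u) ,
         λ k∈ → let (g , g∈ , eq) = f k∈ in
           g , x∈p∧x≢y⇒x∈p-y g∈ (λ e → h∉ (subst (_∈ H₁) (trans eq (trans (absorb g∈) e)) k∈)) , eq)))
      (λ h∈ → let (g , g∈ , eq) = f h∈ in subst (_∈ H₂) (sym (trans eq (absorb g∈))) g∈)
  -- Translation by `b` is a bijection from `H₂ ∖ b` to the generators of the contraction: by
  -- `below⇒≡` nothing else is absorbed into `b`, and by `distinct` no two generators are
  -- identified.
  ... | yes (b , b∈ , b≤z₁) = (b , contractTo H₂ b) , valid-contract {H₂} , x⊴w , ⊴-contract spans-b ,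
      trans (∣p-x∣ b∈) (cong ℕ.suc (ℕ.≤-antisym
        (card-≤ (H₂ ∖ b) (contractTo H₂ b) (λ g k → k ≡ g ∨ b)
          (λ g∈ → let (g∈H , g≢b) = ∈-minus H₂ g∈ in
            _ , ∈-contract⁺ {H₂} g∈H (below⇒≡ g∈H g≢b) , refl)
          (λ {g} {g′} g∈ g′∈ e e′ → decidable-stable (g ≟ g′) λ g≢g′ →
            let (g∈H , g≢b) = ∈-minus H₂ g∈ ; (g′∈H , g′≢b) = ∈-minus H₂ g′∈ in
            distinct g∈H g≢b g′∈H g′≢b g≢g′ (trans (sym e) e′)))
        (card-≤ (contractTo H₂ b) (H₂ ∖ b) (λ k g → k ≡ g ∨ b)
          (λ k∈ → let (g , g∈ , eq , g≰b) = ∈-contract⁻ {H₂} k∈ in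
            g , x∈p∧x≢y⇒x∈p-y g∈ (λ e → g≰b (≤-reflexive e)) , eq)
          (λ _ _ e e′ → trans e (sym e′)))))
    where
    b-∈ : ∀ {g} → g ≢ b → b ∈ H₂ ∖ g
    b-∈ g≢b = x∈p∧x≢y⇒x∈p-y b∈ (g≢b ∘ sym)
    below⇒≡ : ∀ {g} → g ∈ H₂ → g ≢ b → ¬ g ≤ b
    below⇒≡ {g} g∈ g≢b g≤b = needed (g , g∈ , ⊴-without vx x⊴y
      (λ _ _ ub → ≤-trans g≤b (ub (b-∈ g≢b) b≤z₁))
      (λ g≰ → ⊥-elim (g≰ (≤-trans g≤b b≤z₁))))
    -- If `g` and `g′` have the same join with `b`, then `g′` and `b` together do the work of `g`.
    distinct : ∀ {g g′} → g ∈ H₂ → g ≢ b → g′ ∈ H₂ → g′ ≢ b → g ≢ g′ → ¬ g ∨ b ≡ g′ ∨ b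
    distinct {g} {g′} g∈ g≢b g′∈ g′≢b g≢g′ eq = needed (g , g∈ , ⊴-without vx x⊴y
      (λ g≤ _ ub → ≤-trans (subst (g ≤_) eq (x≤x∨y _ _))
         (∨-least (ub g′-∈ (≤-trans (x≤x∨y _ _) (subst (_≤ z₁) eq (∨-least g≤ b≤z₁))))
                  (ub (b-∈ g≢b) b≤z₁)))
      (λ _ → g′ , g′-∈ , ∨-through b≤z₁ (sym eq)))
      where
      g′-∈ : g′ ∈ H₂ ∖ g
      g′-∈ = x∈p∧x≢y⇒x∈p-y g′∈ (g≢g′ ∘ sym)
    spans-b : Spans H₂ z₂ b
    spans-b = proj₁ (vy b∈) , λ _ ub → ub b∈ ≤-refl
    x⊴w : x ⊴ (b , contractTo H₂ b)
    x⊴w = (b≤z₁ , λ {u} b≤u ub → least (≤-trans (proj₁ (vy b∈)) b≤u) (λ h∈ h≤ → low b≤u ub h∈ h≤)) ,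
          λ h∈ → let (g , g∈ , eq) = f h∈ in
            g ∨ b , ∈-contract⁺ {H₂} g∈ (λ g≤b → proj₂ (vx h∈)
                      (trans eq (antisym (∨-least (≤-trans g≤b b≤z₁) ≤-refl) (y≤x∨y _ _)))) ,
            trans eq (sym (∨-assoc-absorb b≤z₁))
      where
      low : ∀ {u h} → b ≤ u → (∀ {h} → h ∈ contractTo H₂ b → h ≤ z₁ → h ≤ u) →
            h ∈ H₂ → h ≤ z₁ → h ≤ u
      low {u} {h} b≤u ub h∈ h≤ with h ≤? b
      ... | yes h≤b = ≤-trans h≤b b≤u
      ... | no h≰b  = ≤-trans (x≤x∨y _ _) (ub (∈-contract⁺ {H₂} h∈ h≰b) (∨-least h≤ b≤z₁))

  -- Descend from `y` through facets until `x` itself is the facet; each of them costs one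
  -- generator.
  rank-< : ∀ {x y} → Valid x → Valid y → x ⊴ y → x ≢ y → rank x ℕ.< rank y
  rank-< {x} {y} vx vy x⊴y x≢y = go (rank y) refl vy x⊴y x≢y
    where
    go : ∀ k {y} → rank y ≡ k → Valid y → x ⊴ y → x ≢ y → rank x ℕ.< rank y
    go ℕ.zero {y} eq vy x⊴y x≢y with facet vx vy x⊴y x≢y
    ... | _ , _ , _ , _ , r with () ← trans (sym eq) r
    go (ℕ.suc k) {y} eq vy x⊴y x≢y with facet vx vy x⊴y x≢y
    ... | w , vw , x⊴w , w⊴y , r with x ≟ᶜ w
    ... | yes refl = ℕ.≤-reflexive (sym r)
    ... | no x≢w  = ℕ.≤-trans (go k (ℕ.suc-injective (trans (sym r) eq)) vw x⊴w x≢w)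
                      (ℕ.≤-trans (ℕ.n≤1+n _) (ℕ.≤-reflexive (sym r)))

  rank-≤ : ∀ {x y} → Valid x → Valid y → x ⊴ y → rank x ℕ.≤ rank y
  rank-≤ {x} {y} vx vy x⊴y with x ≟ᶜ y
  ... | yes refl = ℕ.≤-refl
  ... | no x≢y   = ℕ.<⇒≤ (rank-< vx vy x⊴y x≢y)

-- Toggling an element in an alternating sum.

module AlternatingSums where

  module ℤGroup = GroupProperties (CommutativeRing.+-group ℤ.+-*-commutativeRing)

  open FiniteSums ℤ.+-*-commutativeRing

  insert : ∀ {n} → Fin n → Subset n → Subset n
  insert e p = p [ e ]≔ inside

  ⊆-insert : ∀ {n} (e : Fin n) p {x} → x ∈ p → x ∈ insert e p
  ⊆-insert Fin.zero    (_ ∷ p) here       = here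
  ⊆-insert Fin.zero    (_ ∷ p) (there x∈) = there x∈
  ⊆-insert (Fin.suc e) (_ ∷ p) here       = here
  ⊆-insert (Fin.suc e) (_ ∷ p) (there x∈) = there (⊆-insert e p x∈)

  ∈-insert⁻ : ∀ {n} (e : Fin n) p {x} → x ∈ insert e p → x ≢ e → x ∈ p
  ∈-insert⁻ Fin.zero    (_ ∷ p) here       ≢ = ⊥-elim (≢ refl)
  ∈-insert⁻ Fin.zero    (_ ∷ p) (there x∈) ≢ = there x∈
  ∈-insert⁻ (Fin.suc e) (_ ∷ p) here       ≢ = here
  ∈-insert⁻ (Fin.suc e) (_ ∷ p) (there x∈) ≢ = there (∈-insert⁻ e p x∈ (≢ ∘ cong Fin.suc))

  ∣insert∣ : ∀ {n} (e : Fin n) p → e ∉ p → ∣ insert e p ∣ ≡ ℕ.suc ∣ p ∣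
  ∣insert∣ Fin.zero    (inside  ∷ p) e∉ = ⊥-elim (e∉ here)
  ∣insert∣ Fin.zero    (outside ∷ p) e∉ = refl
  ∣insert∣ (Fin.suc e) (inside  ∷ p) e∉ = cong ℕ.suc (∣insert∣ e p (e∉ ∘ there))
  ∣insert∣ (Fin.suc e) (outside ∷ p) e∉ = ∣insert∣ e p (e∉ ∘ there)

  -- Each set without `e` cancels against its union with `e`. The list of subsets branches on the
  -- first element: if `e` comes first, the two halves cancel, and otherwise each pair lies within
  -- one half.
  ∑-toggle : ∀ {n} (e : Fin n) (f : Subset n → ℤ) →
             (∀ p → e ∉ p → f p ℤ.+ f (insert e p) ≡ 0ℤ) → ∑ (allSubsets n) f ≡ 0ℤ
  ∑-toggle {ℕ.suc n} Fin.zero f eq = begin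
    ∑ (allSubsets (ℕ.suc n)) f
      ≡⟨ ∑-++ (map (outside ∷_) (allSubsets n)) _ ⟩
    ∑ (map (outside ∷_) (allSubsets n)) f ℤ.+ ∑ (map (inside ∷_) (allSubsets n)) f
      ≡⟨ cong₂ ℤ._+_ (∑-map (outside ∷_) (allSubsets n)) (∑-map (inside ∷_) (allSubsets n)) ⟩
    ∑ (allSubsets n) (f ∘ (outside ∷_)) ℤ.+ ∑ (allSubsets n) (f ∘ (inside ∷_))
      ≡⟨ sym (∑-+ (allSubsets n) _ _) ⟩
    ∑ (allSubsets n) (λ p → f (outside ∷ p) ℤ.+ f (inside ∷ p))
      ≡⟨ ∑-zero (allSubsets n) (λ {p} _ → eq (outside ∷ p) (λ ())) ⟩
    0ℤ ∎
    where open ≡-Reasoning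
  ∑-toggle {ℕ.suc n} (Fin.suc e) f eq = begin
    ∑ (allSubsets (ℕ.suc n)) f
      ≡⟨ ∑-++ (map (outside ∷_) (allSubsets n)) _ ⟩
    ∑ (map (outside ∷_) (allSubsets n)) f ℤ.+ ∑ (map (inside ∷_) (allSubsets n)) f
      ≡⟨ cong₂ ℤ._+_ (∑-map (outside ∷_) (allSubsets n)) (∑-map (inside ∷_) (allSubsets n)) ⟩
    ∑ (allSubsets n) (f ∘ (outside ∷_)) ℤ.+ ∑ (allSubsets n) (f ∘ (inside ∷_))
      ≡⟨ cong₂ ℤ._+_ (∑-toggle e _ (λ p e∉ → eq (outside ∷ p) (λ { (there x) → e∉ x })))
                     (∑-toggle e _ (λ p e∉ → eq (inside ∷ p) (λ { (there x) → e∉ x }))) ⟩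
    0ℤ ∎
    where open ≡-Reasoning

  sign : ℕ → ℤ
  sign k = -1ℤ ℤ.^ k

  sign-cancel : ∀ k → sign k ℤ.+ sign (ℕ.suc k) ≡ 0ℤ
  sign-cancel k = trans (cong (λ i → sign k ℤ.+ i) (ℤ.-1*i≡-i (sign k))) (ℤ.+-inverseʳ (sign k))

-- Euler characteristics of intervals.

module EulerCharacteristic (LG : GeneratorEnrichedLattice) where

  open FiniteSums ℤ.+-*-commutativeRing
  open AlternatingSums

  open GeneratorEnrichedLattice LG
  open Minors LG
  open Cells LG
  open Facets LG

  -- The exponent is the number of generators, one less than the rank in `M`; so these sums are the
  -- negatives of those over the nonempty minors in the poset.
  signed : ∀ {P : Cell → Set} → (∀ c → Dec (P c)) → ℤ
  signed P? = ∑ allCells (λ c → term (P? c) (sign (rank c)))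

  signed-single : ∀ {P : Cell → Set} (P? : ∀ c → Dec (P c)) {c} →
                  P c → (∀ {d} → P d → d ≡ c) → signed P? ≡ sign (rank c)
  signed-single P? {c} p only = ∑-single-term P? allCells-unique (∈-allCells c) p only

  signed-toggle : ∀ {P : Cell → Set} (P? : ∀ c → Dec (P c)) →
    (∀ z → (∃ λ e → ∀ H → e ∉ H → (P (z , H) → P (z , insert e H)) × (P (z , insert e H) → P (z , H)))
           → ∑ (allSubsets size) (λ H → term (P? (z , H)) (sign ∣ H ∣)) ≡ 0ℤ)
  signed-toggle P? z (e , free) = ∑-toggle e _ λ H e∉ → let (i , j) = free H e∉ in
    trans (cong (λ i → term (P? (z , H)) (sign ∣ H ∣) ℤ.+ i)
             (term-cong (P? (z , insert e H)) (P? (z , H)) j i (cong sign (∣insert∣ e H e∉))))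
          (cancel {H} (P? (z , H)))
    where
    cancel : ∀ {H} {Q : Set} (d : Dec Q) → term d (sign ∣ H ∣) ℤ.+ term d (sign (ℕ.suc ∣ H ∣)) ≡ 0ℤ
    cancel {H} (yes _) = sign-cancel ∣ H ∣
    cancel     (no _)  = refl

  signed-fibres : ∀ {P : Cell → Set} (P? : ∀ c → Dec (P c)) →
    signed P? ≡ ∑ (allFin size) (λ z → ∑ (allSubsets size) (λ H → term (P? (z , H)) (sign ∣ H ∣)))
  signed-fibres P? = ∑-× (allFin size) (allSubsets size) _

  empty-fibre : ∀ {P : Cell → Set} (P? : ∀ c → Dec (P c)) z → (∀ H → ¬ P (z , H)) →
    ∑ (allSubsets size) (λ H → term (P? (z , H)) (sign ∣ H ∣)) ≡ 0ℤ
  empty-fibre P? z none = ∑-zero (allSubsets size) (λ {H} _ → term-no (P? (z , H)) (none H))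

  Interval : Cell → Cell → Cell → Set
  Interval x y c = Valid c × x ⊴ c × c ⊴ y

  abstract
    interval? : ∀ x y c → Dec (Interval x y c)
    interval? x y c = valid? c ×-dec (x ⊴? c) ×-dec (c ⊴? y)

  χ : Cell → Cell → ℤ
  χ x y = signed (interval? x y)

  insert-⊴ : ∀ {z e H y} → (∃ λ g → g ∈ proj₂ y × e ≡ g ∨ z) → (z , H) ⊴ y → (z , insert e H) ⊴ y
  insert-⊴ {z} {e} {H} {y} ex (sp , f) = sp , λ {h} h∈ → go h∈ (h ≟ e)
    where
    go : ∀ {h} → h ∈ insert e H → Dec (h ≡ e) → ∃ λ g → g ∈ proj₂ y × h ≡ g ∨ z
    go h∈ (yes refl) = ex
    go h∈ (no h≢e)   = f (∈-insert⁻ e H h∈ h≢e)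

  insert-valid : ∀ {z e H} → z ≤ e → e ≢ z → Valid (z , H) → Valid (z , insert e H)
  insert-valid {z} {e} {H} z≤e e≢z v {h} h∈ with h ≟ e
  ... | yes refl = z≤e , e≢z
  ... | no h≢e   = v (∈-insert⁻ e H h∈ h≢e)

  ⊴-⊆ : ∀ {z} {A B : Subset size} {y} → A ⊆ B → (z , B) ⊴ y → (z , A) ⊴ y
  ⊴-⊆ A⊆B (sp , f) = sp , λ h∈ → f (A⊆B h∈)

  spans-⊆ : ∀ {A B z z′} → A ⊆ B → Spans A z z′ → Spans B z z′
  spans-⊆ A⊆B (le , least) = le , λ z≤u ub → least z≤u (λ h∈ → ub (A⊆B h∈))

  ⊴-grow : ∀ {x z} {A B : Subset size} → A ⊆ B → x ⊴ (z , A) → x ⊴ (z , B)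
  ⊴-grow A⊆B (sp , f) = spans-⊆ A⊆B sp , λ h∈ → let (g , g∈ , eq) = f h∈ in g , A⊆B g∈ , eq

  e≢z : ∀ {g z} → ¬ g ≤ z → g ∨ z ≢ z
  e≢z g≰z eq = g≰z (subst (_ ≤_) eq (x≤x∨y _ _))

  -- Over each `z ≤ z₁` the element `g ∨ z` can be toggled: it is not below `z₁`, so it does not
  -- help to span `z₁`, and its translate over `z₁` is not in `H₁`, so no generator of the lower end
  -- stems from it.
  χ-free : ∀ {z₁ H₁ y} → (∃ λ g → g ∈ proj₂ y × ¬ g ≤ z₁ × g ∨ z₁ ∉ H₁) → χ (z₁ , H₁) y ≡ 0ℤ
  χ-free {z₁} {H₁} {y} (g , g∈ , g≰ , g∉) =
    trans (signed-fibres (interval? x y)) (∑-zero (allFin size) λ {z} _ → fibre z)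
    where
    x = z₁ , H₁
    fibre : ∀ z → ∑ (allSubsets size) (λ H → term (interval? x y (z , H)) (sign ∣ H ∣)) ≡ 0ℤ
    fibre z with z ≤? z₁
    ... | no z≰ = empty-fibre (interval? x y) z (λ H (_ , ((z≤ , _) , _) , _) → z≰ z≤)
    ... | yes z≤ = signed-toggle (interval? x y) z (g ∨ z , λ H e∉ →
          (λ (v , lo , hi) → insert-valid (y≤x∨y _ _) (e≢z g≰z) v , ⊴-grow (⊆-insert _ H) lo ,
                             insert-⊴ (g , g∈ , refl) hi) ,
          (λ (v , lo , hi) → valid-⊆ (⊆-insert _ H) v , shrink H lo , ⊴-⊆ (⊆-insert _ H) hi))
      where
      g≰z : ¬ g ≤ z
      g≰z g≤z = g≰ (≤-trans g≤z z≤)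
      shrink : ∀ H → x ⊴ (z , insert (g ∨ z) H) → x ⊴ (z , H)
      shrink H ((_ , least) , f) =
        (z≤ , λ z≤u ub → least z≤u (λ {h} h∈ h≤ →
           ub (∈-insert⁻ _ H h∈ (λ { refl → g≰ (≤-trans (x≤x∨y _ _) h≤) })) h≤)) ,
        λ h∈ → let (k , k∈ , eq) = f h∈ in
          k , ∈-insert⁻ _ H k∈ (λ e → g∉ (subst (_∈ H₁) (trans eq (trans (cong (_∨ z₁) e) (∨-assoc-absorb z≤))) h∈)) , eq

  χ-refl : ∀ {x} → Valid x → χ x x ≡ sign (rank x)
  χ-refl {x} v = signed-single (interval? x x) (v , ⊴-refl v , ⊴-refl v)
    (λ (v′ , lo , hi) → ⊴-antisym v′ v hi lo)

  Lower : Cell → Cell → Set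
  Lower y c = Valid c × c ⊴ y

  abstract
    lower? : ∀ y c → Dec (Lower y c)
    lower? y c = valid? c ×-dec (c ⊴? y)

  ∅ : Subset size
  ∅ = Subset.⊥

  empty : ∀ {p : Subset size} → (∀ {x} → x ∉ p) → p ≡ ∅
  empty none = subset-ext (⊥-elim ∘ none) (⊥-elim ∘ ∉⊥)

  vertex-⊴ : ∀ {t z H} → Spans H z t → (t , ∅) ⊴ (z , H)
  vertex-⊴ sp = sp , λ h∈ → ⊥-elim (∉⊥ h∈)

  -- Over `z ≢ t` some generator is not below `z`, and its translate can be toggled. Over `t` every
  -- translate is trivial, and only `(t , ∅)` remains.
  lower-sum : ∀ {z₂ H₂ t} → Spans H₂ z₂ t → (∀ {h} → h ∈ H₂ → h ≤ t) → signed (lower? (z₂ , H₂)) ≡ 1ℤ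
  lower-sum {z₂} {H₂} {t} sp ub =
    trans (signed-fibres P?) (trans (∑-single (Unique.allFin⁺ size) (∈-allFin t) other) at-t)
    where
    y = z₂ , H₂
    P? = lower? y
    other : ∀ {z} → z ≢ t → ∑ (allSubsets size) (λ H → term (P? (z , H)) (sign ∣ H ∣)) ≡ 0ℤ
    other {z} z≢t with spans? H₂ z₂ z
    ... | no ¬sp = empty-fibre P? z (λ H (_ , (sp , _)) → ¬sp sp)
    ... | yes spz with any? (λ h → (h ∈? H₂) ×-dec ¬? (h ≤? z))
    ... | no none = ⊥-elim (z≢t (antisym (proj₂ spz (proj₁ sp) (λ h∈ _ → ub h∈))
            (proj₂ sp (proj₁ spz) (λ {h} h∈ _ → decidable-stable (h ≤? z) (λ h≰ → none (h , h∈ , h≰))))))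
    ... | yes (g , g∈ , g≰) = signed-toggle P? z (g ∨ z , λ H e∉ →
          (λ (v , hi) → insert-valid (y≤x∨y _ _) (e≢z g≰) v , insert-⊴ (g , g∈ , refl) hi) ,
          (λ (v , hi) → valid-⊆ (⊆-insert _ H) v , ⊴-⊆ (⊆-insert _ H) hi))
    at-t : ∑ (allSubsets size) (λ H → term (P? (t , H)) (sign ∣ H ∣)) ≡ 1ℤ
    at-t = trans (∑-single-term (λ H → P? (t , H)) (allSubsets-unique size) (∈-allSubsets ∅)
                   ((λ h∈ → ⊥-elim (∉⊥ h∈)) , vertex-⊴ sp)
                   (λ (v , (_ , f)) → empty (λ h∈ → let (g , g∈ , eq) = f h∈ in
                      proj₂ (v h∈) (trans eq (antisym (∨-least (ub g∈) ≤-refl) (y≤x∨y _ _))))))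
                 (cong sign (∣⊥∣≡0 size))

  -- Sort the minors `(z , H)` below `y` by their top `u = z ∨ ⋁ H`. Those with top `u` form the
  -- interval from `(u , ∅)` to `yᵘ u`, which keeps only the generators below `u`. The total is 1 by
  -- `lower-sum`, and the class of `z₂` already contributes 1. The classes other than those of `z₂`
  -- and `t` are empty or vanish by induction on the number of generators, so that of `t` vanishes
  -- as well.
  χ-vertex : ∀ k {z₂ H₂ t} → ∣ H₂ ∣ ℕ.< k → Valid (z₂ , H₂) → Spans H₂ z₂ t →
             (∀ {h} → h ∈ H₂ → h ≤ t) → Subset.Nonempty H₂ → χ (t , ∅) (z₂ , H₂) ≡ 0ℤ
  χ-vertex (ℕ.suc k) {z₂} {H₂} {t} (s≤s lt) v sp ub (h₀ , h₀∈) =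
    ℤGroup.∙-cancelˡ 1ℤ _ _ (trans (sym total) (lower-sum sp ub))
    where
    y = z₂ , H₂
    yᵘ : Fin size → Cell
    yᵘ u = z₂ , below H₂ u
    t≢z₂ : t ≢ z₂
    t≢z₂ refl = proj₂ (v h₀∈) (antisym (ub h₀∈) (proj₁ (v h₀∈)))
    by-top : ∀ c → term (lower? y c) (sign (rank c)) ≡
                   ∑ (allFin size) (λ u → term (interval? (u , ∅) (yᵘ u) c) (sign (rank c)))
    by-top c@(z , H) with lower? y c
    ... | no ¬l = sym (∑-zero (allFin size) (λ {u} _ → term-no (interval? (u , ∅) (yᵘ u) c)
            (λ (vc , _ , hi) → ¬l (vc , ⊴-grow (proj₁ ∘ ∈-below⁻ {H₂}) hi))))
    ... | yes (vc , (spz , f)) = sym (∑-single-term (λ u → interval? (u , ∅) (yᵘ u) c)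
            (Unique.allFin⁺ size) (∈-allFin (z ∨ ⋁ H))
            (vc , vertex-⊴ (⋁-spans (λ h → h)) ,
              ((proj₁ spz , λ z₂≤u bd → proj₂ spz z₂≤u
                 (λ h∈ h≤z → bd (∈-below⁺ h∈ (≤-trans h≤z (x≤x∨y _ _))) h≤z)) ,
               λ h∈ → let (g , g∈ , eq) = f h∈ in
                 g , ∈-below⁺ g∈ (≤-trans (subst (g ≤_) (sym eq) (x≤x∨y _ _))
                                   (≤-trans (⋁-upper h∈) (y≤x∨y _ _))) , eq))
            (λ (_ , (spu , _) , (_ , f′)) → antisym
              (proj₂ spu (x≤x∨y _ _) (λ h∈ _ → ≤-trans (⋁-upper h∈) (y≤x∨y _ _)))
              (∨-least (proj₁ spu) (⋁-least (λ h∈ → let (g , g∈ , eq) = f′ h∈ in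
                subst (_≤ _) (sym eq) (∨-least (proj₂ (∈-below⁻ {H₂} g∈)) (proj₁ spu)))))))
    below-t : below H₂ t ≡ H₂
    below-t = subset-ext (proj₁ ∘ ∈-below⁻ {H₂}) (λ h∈ → ∈-below⁺ h∈ (ub h∈))
    χᵘ : Fin size → ℤ
    χᵘ u = term (u ≟ z₂) 1ℤ ℤ.+ term (u ≟ t) (χ (t , ∅) y)
    evaluate : ∀ u → χ (u , ∅) (yᵘ u) ≡ χᵘ u
    evaluate u with u ≟ z₂ | u ≟ t
    ... | yes refl | yes refl = ⊥-elim (t≢z₂ refl)
    ... | yes refl | no _ = trans (cong (λ H → χ (z₂ , ∅) (z₂ , H))
              (empty (λ h∈ → let (h∈H , h≤) = ∈-below⁻ {H₂} h∈ in
                proj₂ (v h∈H) (antisym h≤ (proj₁ (v h∈H))))))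
            (trans (χ-refl (⊥-elim ∘ ∉⊥)) (cong sign (∣⊥∣≡0 size)))
    ... | no _ | yes refl = trans (cong (λ H → χ (t , ∅) (z₂ , H)) below-t) (sym (ℤ.+-identityˡ _))
    ... | no u≢z₂ | no u≢t with spans? H₂ z₂ u
    ... | no ¬sp = ∑-zero allCells (λ {c} _ → term-no (interval? (u , ∅) (yᵘ u) c)
            (λ (_ , lo , hi) → ¬sp (spans-⊆ (proj₁ ∘ ∈-below⁻ {H₂}) (proj₁ (⊴-trans lo hi)))))
    -- As `u` differs from `t`, some generator is not below `u`, and the restricted set is strictly
    -- smaller.
    ... | yes spu = χ-vertex k
            (ℕ.<-≤-trans (p⊂q⇒∣p∣<∣q∣ (proj₁ ∘ ∈-below⁻ {H₂} , strict)) lt)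
            (valid-⊆ (proj₁ ∘ ∈-below⁻ {H₂}) v)
            (proj₁ spu , λ z₂≤w bd → proj₂ spu z₂≤w (λ h∈ h≤ → bd (∈-below⁺ h∈ h≤) h≤))
            (proj₂ ∘ ∈-below⁻ {H₂}) nonempty
      where
      strict : ∃ λ h → h ∈ H₂ × h ∉ below H₂ u
      strict with any? (λ h → (h ∈? H₂) ×-dec ¬? (h ≤? u))
      ... | yes (h , h∈ , h≰) = h , h∈ , λ h∈′ → h≰ (proj₂ (∈-below⁻ {H₂} h∈′))
      ... | no none = ⊥-elim (u≢t (antisym (proj₂ spu (proj₁ sp) (λ h∈ _ → ub h∈))
              (proj₂ sp (proj₁ spu) (λ {h} h∈ _ → decidable-stable (h ≤? u) (λ h≰ → none (h , h∈ , h≰))))))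
      nonempty : Subset.Nonempty (below H₂ u)
      nonempty with nonempty? (below H₂ u)
      ... | yes ne = ne
      ... | no ¬ne = ⊥-elim (u≢z₂ (antisym
              (proj₂ spu ≤-refl (λ h∈ h≤ → ⊥-elim (¬ne (_ , ∈-below⁺ h∈ h≤)))) (proj₁ spu)))
    total : signed (lower? y) ≡ 1ℤ ℤ.+ χ (t , ∅) y
    total = begin
      signed (lower? y)
        ≡⟨ ∑-cong allCells by-top ⟩
      ∑ allCells (λ c → ∑ (allFin size) (λ u → term (interval? (u , ∅) (yᵘ u) c) (sign (rank c))))
        ≡⟨ ∑-swap allCells (allFin size) _ ⟩
      ∑ (allFin size) (λ u → χ (u , ∅) (yᵘ u))
        ≡⟨ ∑-cong (allFin size) evaluate ⟩
      ∑ (allFin size) χᵘ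
        ≡⟨ ∑-+ (allFin size) _ _ ⟩
      ∑ (allFin size) (λ u → term (u ≟ z₂) 1ℤ) ℤ.+ ∑ (allFin size) (λ u → term (u ≟ t) (χ (t , ∅) y))
        ≡⟨ cong₂ ℤ._+_
             (∑-single-term (_≟ z₂) (Unique.allFin⁺ size) (∈-allFin z₂) refl (λ e → e))
             (∑-single-term (_≟ t) (Unique.allFin⁺ size) (∈-allFin t) refl (λ e → e)) ⟩
      1ℤ ℤ.+ χ (t , ∅) y ∎
      where open ≡-Reasoning

  -- At rank 0 this is `χ-free` or `χ-vertex`. Otherwise remove `h₁` from `x` to get `x′`, and from
  -- `y` all generators with translate `h₁` over `z₁` to get `y′`. The interval from `x′` to `y` is
  -- the disjoint union of those from `x` to `y` and from `x′` to `y′`. The first sum vanishes by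
  -- `χ-free` and the last by induction, hence also the one sought.
  χ-< : ∀ k {x y} → rank x ≡ k → Valid x → Valid y → x ⊴ y → x ≢ y → χ x y ≡ 0ℤ
  χ-< ℕ.zero {z₁ , H₁} {z₂ , H₂} r vx vy (sp , f) x≢y
    with any? (λ h → (h ∈? H₂) ×-dec ¬? (h ≤? z₁)) | nonempty? H₂
  ... | yes (g , g∈ , g≰) | _ = χ-free (g , g∈ , g≰ , λ h∈ → card0 h∈)
    where
    card0 : ∀ {h} → h ∉ H₁
    card0 h∈ with () ← trans (sym (∣p-x∣ h∈)) r
  ... | no none | yes ne = trans (cong (λ H → χ (z₁ , H) (z₂ , H₂)) (empty card0))
          (χ-vertex _ ℕ.≤-refl vy sp (λ {h} h∈ → decidable-stable (h ≤? z₁) (λ h≰ → none (h , h∈ , h≰))) ne)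
    where
    card0 : ∀ {h} → h ∉ H₁
    card0 h∈ with () ← trans (sym (∣p-x∣ h∈)) r
  ... | no none | no ¬ne = ⊥-elim (x≢y (cong₂ _,_
          (antisym (proj₂ sp ≤-refl (λ h∈ _ → ⊥-elim (¬ne (_ , h∈)))) (proj₁ sp))
          (subset-ext (λ h∈ → ⊥-elim (card0 h∈)) (λ h∈ → ⊥-elim (¬ne (_ , h∈))))))
    where
    card0 : ∀ {h} → h ∉ H₁
    card0 h∈ with () ← trans (sym (∣p-x∣ h∈)) r
  χ-< (ℕ.suc k) {x@(z₁ , H₁)} {y@(z₂ , H₂)} r vx vy (sp , f) x≢y
    with h₁ , h₁∈ ← ∣p∣≡suc⇒nonempty {p = H₁} r = begin
      χ x y                 ≡⟨ sym (ℤ.+-identityʳ _) ⟩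
      χ x y ℤ.+ 0ℤ          ≡⟨ cong (λ i → χ x y ℤ.+ i) (sym ih) ⟩
      χ x y ℤ.+ χ x′ y′     ≡⟨ sym split ⟩
      χ x′ y                ≡⟨ free ⟩
      0ℤ                    ∎
    where
    open ≡-Reasoning
    over? : ∀ h → Dec (h ∈ H₂ × h ∨ z₁ ≢ h₁)
    over? h = (h ∈? H₂) ×-dec ¬? (h ∨ z₁ ≟ h₁)
    x′ y′ : Cell
    x′ = z₁ , H₁ ∖ h₁
    y′ = z₂ , ⟪ over? ⟫
    y′⊆ : ⟪ over? ⟫ ⊆ H₂
    y′⊆ = proj₁ ∘ ∈⟪⟫⁻ over?
    free : χ x′ y ≡ 0ℤ
    free = let (g , g∈ , eq) = f h₁∈ in χ-free
      (g , g∈ , (λ g≤ → proj₂ (vx h₁∈) (trans eq (antisym (∨-least g≤ ≤-refl) (y≤x∨y _ _)))) ,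
       subst (_∉ H₁ ∖ h₁) eq (x∉p-x {p = H₁} h₁))
    ⊴-x′ : ∀ {c} → x ⊴ c → x′ ⊴ c
    ⊴-x′ = ⊴-⊆ (p─q⊆p H₁ _)
    y′⊴ : ∀ {c} → c ⊴ y′ → c ⊴ y
    y′⊴ = ⊴-grow y′⊆
    x′⊴y′ : x′ ⊴ y′
    x′⊴y′ = (proj₁ sp , λ z₂≤u ub → proj₂ sp z₂≤u (λ h∈ h≤ → ub (∈⟪⟫⁺ over? (h∈ ,
              λ e → proj₂ (vx h₁∈) (trans (sym e) (antisym (∨-least h≤ ≤-refl) (y≤x∨y _ _))))) h≤)) ,
            λ h∈ → let (h∈H , h≢) = ∈-minus H₁ h∈ ; (g , g∈ , eq) = f h∈H in
              g , ∈⟪⟫⁺ over? (g∈ , λ e → h≢ (trans eq e)) , eq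
    -- If they agreed, then `z₁ ≡ z₂`, and every generator removed from `y` would be `h₁` itself,
    -- which makes `x` and `y` equal.
    x′≢y′ : x′ ≢ y′
    x′≢y′ eq = x≢y (⊴-antisym vx vy (sp , f) (y⊴x (cong proj₁ eq)))
      where
      y⊴x : z₁ ≡ z₂ → y ⊴ x
      y⊴x refl = spans-refl , λ {h} h∈ → go h∈ (h ∨ z₁ ≟ h₁)
        where
        go : ∀ {h} → h ∈ H₂ → Dec (h ∨ z₁ ≡ h₁) → ∃ λ g → g ∈ H₁ × h ≡ g ∨ z₁
        go h∈ (yes refl) = _ , h₁∈ , sym (trans (∨-assoc-absorb ≤-refl) (∨-absorb (proj₁ (vy h∈))))
        go {h} h∈ (no h≢) = h , proj₁ (∈-minus H₁ (subst (h ∈_) (sym (cong proj₂ eq)) (∈⟪⟫⁺ over? (h∈ , h≢)))) ,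
                        sym (∨-absorb (proj₁ (vy h∈)))
    ih : χ x′ y′ ≡ 0ℤ
    ih = χ-< k (ℕ.suc-injective (trans (sym (∣p-x∣ h₁∈)) r)) (valid-⊆ (p─q⊆p H₁ _) vx)
           (valid-⊆ y′⊆ vy) x′⊴y′ x′≢y′
    -- A cell between `x′` and `y` is above `x` exactly when one of its generators translates to
    -- `h₁` over `z₁`, and below `y′` exactly when none does.
    disjoint : ∀ {c} → x ⊴ c → ¬ c ⊴ y′
    disjoint {z , H} ((z≤ , _) , lo) (_ , hi) with lo h₁∈
    ... | k , k∈ , refl with hi k∈
    ... | g , g∈ , refl = proj₂ (∈⟪⟫⁻ over? g∈) (sym (∨-assoc-absorb z≤))
    cover : ∀ {c} → x′ ⊴ c → ¬ x ⊴ c → c ⊴ y → c ⊴ y′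
    cover {z , H} (spz@(z≤ , _) , lo) ¬x⊴ (spc , hi) =
      (proj₁ spc , λ z₂≤u ub → proj₂ spc z₂≤u (λ h∈ h≤ → ub (∈⟪⟫⁺ over? (h∈ ,
         λ e → proj₂ (vx h₁∈) (trans (sym e)
           (antisym (∨-least (≤-trans h≤ z≤) ≤-refl) (y≤x∨y _ _))))) h≤)) ,
      λ k∈ → let (g , g∈ , eq) = hi k∈ in g , ∈⟪⟫⁺ over? (g∈ , λ e → ¬x⊴ (spz , λ {h} h∈ →
         produce k∈ (trans (sym e) (trans (sym (∨-assoc-absorb z≤)) (cong (_∨ z₁) (sym eq)))) h∈ (h ≟ h₁))) , eq
      where
      produce : ∀ {k h} → k ∈ H → h₁ ≡ k ∨ z₁ → h ∈ H₁ → Dec (h ≡ h₁) → ∃ λ g → g ∈ H × h ≡ g ∨ z₁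
      produce k∈ eq h∈ (yes refl) = _ , k∈ , eq
      produce k∈ eq h∈ (no h≢)    = lo (x∈p∧x≢y⇒x∈p-y h∈ h≢)
    split : χ x′ y ≡ χ x y ℤ.+ χ x′ y′
    split = trans (∑-cong allCells pointwise) (∑-+ allCells _ _)
      where
      pointwise : ∀ c → term (interval? x′ y c) (sign (rank c)) ≡
                  term (interval? x y c) (sign (rank c)) ℤ.+ term (interval? x′ y′ c) (sign (rank c))
      pointwise c with x ⊴? c
      ... | yes x⊴c = trans (sym (ℤ.+-identityʳ _)) (cong₂ ℤ._+_
              (term-cong (interval? x′ y c) (interval? x y c)
                (λ (v , _ , hi) → v , x⊴c , hi) (λ (v , _ , hi) → v , ⊴-x′ x⊴c , hi) refl)
              (sym (term-no (interval? x′ y′ c) (λ (_ , _ , hi) → disjoint x⊴c hi))))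
      ... | no ¬x⊴c = trans (sym (ℤ.+-identityˡ _)) (cong₂ ℤ._+_
              (sym (term-no (interval? x y c) (λ (_ , lo , _) → ¬x⊴c lo)))
              (term-cong (interval? x′ y c) (interval? x′ y′ c)
                (λ (v , lo , hi) → v , lo , cover lo ¬x⊴c hi) (λ (v , lo , hi) → v , lo , y′⊴ hi) refl))

-- The minor poset is Eulerian.

module MinorPoset (LG : GeneratorEnrichedLattice) where

  open FiniteSums ℤ.+-*-commutativeRing
  open AlternatingSums using (sign)

  open GeneratorEnrichedLattice LG using (size)
  open Minors LG
  open Cells LG
  open Facets LG
  open EulerCharacteristic LG

  module M = Poset M

  -- Keys replace the setoid equality of `M` by propositional equality, under which duplicate-free
  -- lists can be compared as bags.
  key : M.Carrier → Maybe Cell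
  key ⊥₋    = nothing
  key [ m ] = just (cellOf m)

  just-inj : ∀ {c d : Cell} → just c ≡ just d → c ≡ d
  just-inj refl = refl

  key-injective : ∀ {x y} → key x ≡ key y → x M.≈ y
  key-injective {⊥₋}    {⊥₋}     _  = InfEq.⊥₋≈⊥₋
  key-injective {[ m ]} {[ m′ ]} eq = InfEq.[ cellOf-injective m m′ (just-inj eq) ]

  key-cong : ∀ {x y} → x M.≈ y → key x ≡ key y
  key-cong InfEq.⊥₋≈⊥₋                 = refl
  key-cong (InfEq.[_] {m} {m′} eq) = cong just (cellOf-cong m m′ eq)

  -- Pairs that are no minors go to `⊥₋`. The list `elements` may repeat its members, so this
  -- default does no harm there.
  toM : Cell → M.Carrier
  toM c with valid? c | c ⊴? top
  ... | yes v | yes c⊴ = [ minorOf c v c⊴ ]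
  ... | yes _ | no _   = ⊥₋
  ... | no _  | _      = ⊥₋

  key-toM : ∀ {c} → Valid c → c ⊴ top → key (toM c) ≡ just c
  key-toM {c} v c⊴ with valid? c | c ⊴? top
  ... | yes v′ | yes c⊴′ = cong just (cellOf-minorOf c v′ c⊴′)
  ... | yes _  | no ¬c⊴  = ⊥-elim (¬c⊴ c⊴)
  ... | no ¬v  | _       = ⊥-elim (¬v v)

  toM-cellOf : ∀ m → [ m ] M.≈ toM (cellOf m)
  toM-cellOf m = key-injective (sym (key-toM (cellOf-valid m) (cellOf-⊴ m)))

  elements : List M.Carrier
  elements = ⊥₋ ∷ map toM allCells

  enumerates : IsEnumeration M.Eq.setoid elements
  enumerates ⊥₋    = here M.Eq.refl
  enumerates [ m ] = there (Any.map⁺ (Any.map (λ { refl → toM-cellOf m }) (∈-allCells (cellOf m))))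

  rk : M.Carrier → ℕ
  rk ⊥₋    = 0
  rk [ m ] = ℕ.suc (rank (cellOf m))

  rk-key : Maybe Cell → ℕ
  rk-key nothing  = 0
  rk-key (just c) = ℕ.suc (rank c)

  rk≡ : ∀ x → rk x ≡ rk-key (key x)
  rk≡ ⊥₋    = refl
  rk≡ [ m ] = refl

  [≤] : ∀ {x c} → Valid c → c ⊴ top → (∀ m → cellOf m ≡ c → x M.≤ [ m ]) → x M.≤ toM c
  [≤] {x} {c} v c⊴ f with valid? c | c ⊴? top
  ... | yes v′ | yes c⊴′ = f _ (cellOf-minorOf c v′ c⊴′)
  ... | yes _  | no ¬c⊴  = ⊥-elim (¬c⊴ c⊴)
  ... | no ¬v  | _       = ⊥-elim (¬v v)

  ⊴⇒[≤] : ∀ m {c} → Valid c → c ⊴ top → cellOf m ⊴ c → [ m ] M.≤ toM c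
  ⊴⇒[≤] m v c⊴ le = [≤] v c⊴ (λ m′ eq → [ ⊴⇒≤ᴹ m m′ (subst (cellOf m ⊴_) (sym eq) le) ])

  toM≤ : ∀ {c} m → c ⊴ cellOf m → toM c M.≤ [ m ]
  toM≤ {c} m le with valid? c | c ⊴? top
  ... | yes v′ | yes c⊴′ = [ ⊴⇒≤ᴹ (minorOf c v′ c⊴′) m (subst (_⊴ cellOf m) (sym (cellOf-minorOf c v′ c⊴′)) le) ]
  ... | yes _  | no _    = ⊥₋≤ _
  ... | no _   | _       = ⊥₋≤ _

  rk-cover : ∀ {x y} → Covers M x y → rk y ≡ ℕ.suc (rk x)
  rk-cover {⊥₋} {⊥₋} ((_ , x≉y) , _) = ⊥-elim (x≉y M.Eq.refl)
  rk-cover {[ _ ]} {⊥₋} ((() , _) , _)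
  rk-cover {⊥₋} {[ m ]} (_ , none) with ∣p∣-cases
    where
    ∣p∣-cases : Dec (cellOf m ≡ (proj₁ (cellOf m) , ∅))
    ∣p∣-cases = cellOf m ≟ᶜ _
  ... | yes eq = cong ℕ.suc (trans (cong rank eq) (∣⊥∣≡0 size))
  -- Otherwise the vertex with the same minimum lies strictly between the empty minor and `m`.
  ... | no neq = ⊥-elim (none (toM v) ((⊥₋≤ _ , λ e → absurd (trans (key-cong e) key-v)) ,
          (toM≤ m v⊴m , λ e → neq (just-inj (trans (sym (key-cong e)) key-v)))))
    where
    v = proj₁ (cellOf m) , ∅
    v⊴m : v ⊴ cellOf m
    v⊴m = vertex-⊴ spans-refl
    key-v : key (toM v) ≡ just v
    key-v = key-toM (⊥-elim ∘ ∉⊥) (⊴-trans v⊴m (cellOf-⊴ m))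
    absurd : ∀ {c : Cell} → ¬ nothing ≡ just c
    absurd ()
  rk-cover {[ m ]} {[ m′ ]} (([ m≤m′ ] , x≉y) , none)
    with facet (cellOf-valid m) (cellOf-valid m′) (≤ᴹ⇒⊴ m m′ m≤m′) (λ eq → x≉y InfEq.[ cellOf-injective m m′ eq ])
  ... | w , vw , m⊴w , w⊴m′ , r with cellOf m ≟ᶜ w
  ... | yes refl = cong ℕ.suc r
  ... | no m≢w = ⊥-elim (none (toM w) (
          (⊴⇒[≤] m vw w⊴ m⊴w , λ e → m≢w (just-inj (trans (key-cong e) key-w))) ,
          (toM≤ m′ w⊴m′ , λ e → ℕ.1+n≢n (trans (sym r) (cong rank (just-inj (trans (sym (key-cong e)) key-w)))))))
    where
    w⊴ = ⊴-trans w⊴m′ (cellOf-⊴ m′)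
    key-w : key (toM w) ≡ just w
    key-w = key-toM vw w⊴

  candidates : List (Maybe Cell)
  candidates = nothing ∷ map just allCells

  candidates-unique : Unique candidates
  candidates-unique = All.tabulate (λ k∈ → apart (∈-map⁻ just k∈)) AllPairs.∷
                      Unique.map⁺ just-inj allCells-unique
    where
    apart : ∀ {k : Maybe Cell} {P : Cell → Set} → (∃ λ c → P c × k ≡ just c) → nothing ≢ k
    apart (_ , _ , refl) ()

  -- The given list is arbitrary. Its keys form a duplicate-free list with the same members as the
  -- filtered list of all candidates, so the sum can be evaluated over the latter.
  sum-listing : ∀ {x y} {P : Maybe Cell → Set} (P? : ∀ k → Dec (P k)) →
    (∀ z → x M.≤ z × z M.≤ y → P (key z)) →
    (∀ k → P k → ∃ λ z → key z ≡ k × x M.≤ z × z M.≤ y) →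
    ∀ zs → SetoidUnique.Unique M.Eq.setoid zs →
    (∀ z → SetoidMembership._∈_ M.Eq.setoid z zs ⇔ (x M.≤ z × z M.≤ y)) →
    foldr ℤ._+_ 0ℤ (map (λ z → sign (rk z)) zs) ≡
    term (P? nothing) 1ℤ ℤ.+ ∑ allCells (λ c → term (P? (just c)) (sign (ℕ.suc (rank c))))
  sum-listing {x} {y} {P} P? sound complete zs unique listing = begin
    ∑ zs (λ z → sign (rk z))            ≡⟨ ∑-cong zs (λ z → cong sign (rk≡ z)) ⟩
    ∑ zs (sgn ∘ key)                    ≡⟨ sym (∑-map key zs) ⟩
    ∑ (map key zs) sgn                  ≡⟨ ∑-unique sgn keys-unique (Unique.filter⁺ P? candidates-unique) to from ⟩
    ∑ (filter P? candidates) sgn        ≡⟨ ∑-filter P? candidates sgn ⟩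
    ∑ candidates (λ k → term (P? k) (sgn k)) ≡⟨ cong (λ i → term (P? nothing) 1ℤ ℤ.+ i) (∑-map just allCells) ⟩
    _ ∎
    where
    open ≡-Reasoning
    sgn = sign ∘ rk-key
    keys-unique : Unique (map key zs)
    keys-unique = SetoidUniqueₚ.map⁺ M.Eq.setoid (≡.setoid _) key-injective unique
    ∈-candidates : ∀ k → k List.∈ candidates
    ∈-candidates nothing  = here refl
    ∈-candidates (just c) = there (∈-map⁺ just (∈-allCells c))
    to : ∀ {k} → k List.∈ map key zs → k List.∈ filter P? candidates
    to k∈ with z , z∈ , refl ← ∈-map⁻ key k∈ = ∈-filter⁺ P? (∈-candidates _)
      (sound z (Equivalence.to (listing z) (Any.map (λ { refl → M.Eq.refl }) z∈)))
    from : ∀ {k} → k List.∈ filter P? candidates → k List.∈ map key zs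
    from {k} k∈ with z , eq , le ← complete k (proj₂ (∈-filter⁻ P? {xs = candidates} k∈)) =
      Any.map⁺ (Any.map (λ z≈w → trans (sym eq) (key-cong z≈w)) (Equivalence.from (listing z) le))

  neg-signed : ∀ {P : Cell → Set} (P? : ∀ c → Dec (P c)) →
    ∑ allCells (λ c → term (P? c) (sign (ℕ.suc (rank c)))) ≡ -1ℤ ℤ.* signed P?
  neg-signed P? = trans (∑-cong allCells (λ c → pull (P? c))) (∑-*ˡ -1ℤ allCells _)
    where
    pull : ∀ {Q : Set} (d : Dec Q) {i} → term d (-1ℤ ℤ.* i) ≡ -1ℤ ℤ.* term d i
    pull (yes _) = refl
    pull (no _)  = refl

  alternating : ∀ {x y} → (x M.≤ y × ¬ x M.≈ y) →
    ∀ zs → SetoidUnique.Unique M.Eq.setoid zs →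
    (∀ z → SetoidMembership._∈_ M.Eq.setoid z zs ⇔ (x M.≤ z × z M.≤ y)) →
    foldr ℤ._+_ 0ℤ (map (λ z → sign (rk z)) zs) ≡ 0ℤ
  alternating {⊥₋} {⊥₋} (_ , x≉y) = ⊥-elim (x≉y M.Eq.refl)
  alternating {[ _ ]} {⊥₋} (() , _)
  -- The empty minor contributes 1, and the other minors up to `m` contribute -1 in total by
  -- `lower-sum`.
  alternating {⊥₋} {[ m ]} _ zs u l = trans (sum-listing P? sound complete zs u l)
    (cong (λ i → 1ℤ ℤ.+ i) (trans (neg-signed (lower? y)) (cong (λ i → -1ℤ ℤ.* i)
      (lower-sum (⋁-spans (λ h → h)) (λ h∈ → ≤-trans (⋁-upper h∈) (y≤x∨y _ _))))))
    where
    y = cellOf m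
    P : Maybe Cell → Set
    -- The empty minor belongs to this interval, so the condition on it is a true proposition.
    P nothing  = ⊥ → ⊥
    P (just c) = Lower y c
    P? : ∀ k → Dec (P k)
    P? nothing  = yes (λ z → z)
    P? (just c) = lower? y c
    sound : ∀ z → ⊥₋ M.≤ z × z M.≤ [ m ] → P (key z)
    sound ⊥₋ _ = λ z → z
    sound [ k ] (_ , [ k≤m ]) = cellOf-valid k , ≤ᴹ⇒⊴ k m k≤m
    complete : ∀ k → P k → ∃ λ z → key z ≡ k × ⊥₋ M.≤ z × z M.≤ [ m ]
    complete nothing _ = ⊥₋ , refl , ⊥₋≤ _ , ⊥₋≤ _
    complete (just c) (v , c⊴) = toM c , key-toM v (⊴-trans c⊴ (cellOf-⊴ m)) , ⊥₋≤ _ , toM≤ m c⊴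
  alternating {[ n ]} {[ m ]} ([ n≤m ] , n≉m) zs u l = trans (sum-listing P? sound complete zs u l)
    (trans (ℤ.+-identityˡ _) (trans (neg-signed (interval? x y)) (cong (λ i → -1ℤ ℤ.* i)
      (χ-< _ refl (cellOf-valid n) (cellOf-valid m) (≤ᴹ⇒⊴ n m n≤m) (λ e → n≉m InfEq.[ cellOf-injective n m e ])))))
    where
    x = cellOf n
    y = cellOf m
    P : Maybe Cell → Set
    P nothing  = ⊥
    P (just c) = Interval x y c
    P? : ∀ k → Dec (P k)
    P? nothing  = no (λ z → z)
    P? (just c) = interval? x y c
    sound : ∀ z → [ n ] M.≤ z × z M.≤ [ m ] → P (key z)
    sound [ k ] ([ n≤k ] , [ k≤m ]) = cellOf-valid k , ≤ᴹ⇒⊴ n k n≤k , ≤ᴹ⇒⊴ k m k≤m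
    complete : ∀ k → P k → ∃ λ z → key z ≡ k × [ n ] M.≤ z × z M.≤ [ m ]
    complete (just c) (v , lo , hi) = toM c , key-toM v c⊴ , ⊴⇒[≤] n v c⊴ lo , toM≤ m hi
      where c⊴ = ⊴-trans hi (cellOf-⊴ m)

  eulerian : Eulerian M
  eulerian = record
    { finite      = elements , enumerates
    ; 0̂           = ⊥₋
    ; 1̂           = wholeᴹ
    ; minimum     = ⊥₋≤_
    ; maximum     = λ { ⊥₋ → ⊥₋≤ _ ; [ m ] → [ proj₂ m ] }
    ; rk          = rk
    ; rk-cong     = λ {x} {y} x≈y → trans (rk≡ x) (trans (cong rk-key (key-cong x≈y)) (sym (rk≡ y)))
    ; rk-0̂        = refl
    ; rk-cover    = rk-cover
    ; alternating = alternating
    }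

-- Polynomial identities with integer coefficients.

module IntegerSolver {c ℓ} (R : CommutativeRing c ℓ) where

  open CommutativeRing R renaming (refl to ≈-refl; sym to ≈-sym; trans to ≈-trans; reflexive to ≈-reflexive)
  open RingProperties ring using (-‿involutive; -‿distribˡ-*; -‿distribʳ-*; -‿+-comm; -0#≈0#)
  open SemiringMult semiring using (1+×; ×-homo-+; ×1-homo-*) renaming (_×_ to _·_)
  open import Relation.Binary.Reasoning.Setoid setoid

  -- The ring homomorphism from the integers. Coefficients with decidable equality let the solver
  -- normalise, although equality in the ring is not given as decidable.
  ⟦_⟧ : ℤ → Carrier
  ⟦ + n ⟧      = n · 1#
  ⟦ -[1+ n ] ⟧ = - (ℕ.suc n · 1#)

  ⊖-homo : ∀ m n → ⟦ m ℤ.⊖ n ⟧ ≈ m · 1# - n · 1#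
  ⊖-homo m          ℕ.zero    = ≈-trans (≈-reflexive (cong ⟦_⟧ (ℤ.⊖-≥ {m} {0} ℕ.z≤n)))
                                  (≈-sym (≈-trans (+-congˡ -0#≈0#) (+-identityʳ _)))
  ⊖-homo ℕ.zero    (ℕ.suc n)  = ≈-sym (+-identityˡ _)
  ⊖-homo (ℕ.suc m) (ℕ.suc n) = begin
    ⟦ ℕ.suc m ℤ.⊖ ℕ.suc n ⟧         ≡⟨ cong ⟦_⟧ (ℤ.[1+m]⊖[1+n]≡m⊖n m n) ⟩
    ⟦ m ℤ.⊖ n ⟧                     ≈⟨ ⊖-homo m n ⟩
    a - b                           ≈⟨ +-congʳ (≈-sym (+-identityʳ a)) ⟩
    (a + 0#) - b                    ≈⟨ +-congʳ (+-congˡ (≈-sym (-‿inverseʳ 1#))) ⟩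
    (a + (1# - 1#)) - b             ≈⟨ +-congʳ (≈-sym (+-assoc _ _ _)) ⟩
    ((a + 1#) - 1#) - b             ≈⟨ +-assoc _ _ _ ⟩
    (a + 1#) + (- 1# - b)           ≈⟨ +-cong (+-comm a 1#) (-‿+-comm 1# b) ⟩
    (1# + a) - (1# + b)             ≈⟨ ≈-sym (+-cong (1+× m 1#) (-‿cong (1+× n 1#))) ⟩
    ℕ.suc m · 1# - ℕ.suc n · 1#     ∎
    where
    a = m · 1#
    b = n · 1#

  -‿homo : ∀ i → ⟦ ℤ.- i ⟧ ≈ - ⟦ i ⟧
  -‿homo (+ ℕ.zero)    = ≈-sym -0#≈0#
  -‿homo (+ ℕ.suc n)   = ≈-refl
  -‿homo -[1+ n ]      = ≈-sym (-‿involutive _)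

  +-homo : ∀ i j → ⟦ i ℤ.+ j ⟧ ≈ ⟦ i ⟧ + ⟦ j ⟧
  +-homo (+ m)    (+ n)    = ×-homo-+ 1# m n
  +-homo (+ m)    -[1+ n ] = ⊖-homo m (ℕ.suc n)
  +-homo -[1+ m ] (+ n)    = ≈-trans (⊖-homo n (ℕ.suc m)) (+-comm _ _)
  +-homo -[1+ m ] -[1+ n ] = begin
    - (ℕ.suc (ℕ.suc (m ℕ.+ n)) · 1#)     ≡⟨ cong (λ k → - (k · 1#)) (sym (ℕ.+-suc (ℕ.suc m) n)) ⟩
    - ((ℕ.suc m ℕ.+ ℕ.suc n) · 1#)       ≈⟨ -‿cong (×-homo-+ 1# (ℕ.suc m) (ℕ.suc n)) ⟩
    - (ℕ.suc m · 1# + ℕ.suc n · 1#)      ≈⟨ ≈-sym (-‿+-comm _ _) ⟩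
    - (ℕ.suc m · 1#) - ℕ.suc n · 1#      ∎

  *-homo⁺ : ∀ m j → ⟦ + m ℤ.* j ⟧ ≈ ⟦ + m ⟧ * ⟦ j ⟧
  *-homo⁺ m (+ n)    = ≈-trans (≈-reflexive (cong ⟦_⟧ (sym (ℤ.pos-* m n)))) (×1-homo-* m n)
  *-homo⁺ m -[1+ n ] = begin
    ⟦ + m ℤ.* -[1+ n ] ⟧            ≡⟨ cong ⟦_⟧ (sym (ℤ.neg-distribʳ-* (+ m) (+ ℕ.suc n))) ⟩
    ⟦ ℤ.- (+ m ℤ.* + ℕ.suc n) ⟧     ≈⟨ -‿homo (+ m ℤ.* + ℕ.suc n) ⟩
    - ⟦ + m ℤ.* + ℕ.suc n ⟧         ≈⟨ -‿cong (*-homo⁺ m (+ ℕ.suc n)) ⟩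
    - (⟦ + m ⟧ * ⟦ + ℕ.suc n ⟧)     ≈⟨ -‿distribʳ-* _ _ ⟩
    ⟦ + m ⟧ * - ⟦ + ℕ.suc n ⟧       ∎

  *-homo : ∀ i j → ⟦ i ℤ.* j ⟧ ≈ ⟦ i ⟧ * ⟦ j ⟧
  *-homo (+ m)    j = *-homo⁺ m j
  *-homo -[1+ m ] j = begin
    ⟦ -[1+ m ] ℤ.* j ⟧              ≡⟨ cong ⟦_⟧ (sym (ℤ.neg-distribˡ-* (+ ℕ.suc m) j)) ⟩
    ⟦ ℤ.- (+ ℕ.suc m ℤ.* j) ⟧       ≈⟨ -‿homo (+ ℕ.suc m ℤ.* j) ⟩
    - ⟦ + ℕ.suc m ℤ.* j ⟧           ≈⟨ -‿cong (*-homo⁺ (ℕ.suc m) j) ⟩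
    - (⟦ + ℕ.suc m ⟧ * ⟦ j ⟧)       ≈⟨ -‿distribˡ-* _ _ ⟩
    - ⟦ + ℕ.suc m ⟧ * ⟦ j ⟧         ∎

  decide : ∀ {i j} → Dec (i ≡ j) → Maybe (⟦ i ⟧ ≈ ⟦ j ⟧)
  decide (yes eq) = just (≈-reflexive (cong ⟦_⟧ eq))
  decide (no _)   = nothing

  decide-coefficients : ∀ i j → Maybe (⟦ i ⟧ ≈ ⟦ j ⟧)
  decide-coefficients i j = decide (i ℤ.≟ j)

  coefficients : RawRing _ _
  coefficients = CommutativeRing.rawRing ℤ.+-*-commutativeRing

  morphism : coefficients ACR.-Raw-AlmostCommutative⟶ ACR.fromCommutativeRing R
  morphism = record
    { ⟦_⟧ = ⟦_⟧ ; +-homo = +-homo ; *-homo = *-homo ; -‿homo = -‿homo ; 0-homo = ≈-refl ; 1-homo = ≈-refl }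

  open RingSolver coefficients (ACR.fromCommutativeRing R) morphism decide-coefficients public
    using (solve; _:=_; _:+_; _:*_; _:-_; :-_; con)

-- Order and arithmetic of the reals.

module RealLemmas (em : ExcludedMiddle (suc 0ℓ)) (real : CompleteOrderedField) where

  open CompleteOrderedField real public
  open CommutativeRing commutativeRing public using (_-_)
  private module R = CommutativeRing commutativeRing
  open FiniteSums commutativeRing public
  open IntegerSolver commutativeRing public using (solve; _:=_; _:+_; _:*_; _:-_; :-_; con)

  em₀ : (P : Set) → Dec P
  em₀ P = map′ lower lift em

  module ≤ = IsTotalOrder isTotalOrder
  module < = NonStrictToStrict _≈_ _≤_

  ≈-refl : ∀ {x} → x ≈ x
  ≈-refl = R.refl

  ≈-sym : ∀ {x y} → x ≈ y → y ≈ x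
  ≈-sym = R.sym

  ≈-trans : ∀ {x y z} → x ≈ y → y ≈ z → x ≈ z
  ≈-trans = R.trans

  _≈?_ : ∀ x y → Dec (x ≈ y)
  x ≈? y = em₀ (x ≈ y)

  abstract

    ≤-refl : ∀ {x} → x ≤ x
    ≤-refl = ≤.refl

    ≤-trans : ∀ {x y z} → x ≤ y → y ≤ z → x ≤ z
    ≤-trans = ≤.trans

    ≈⇒≤ : ∀ {x y} → x ≈ y → x ≤ y
    ≈⇒≤ = ≤.reflexive

    ≤-antisym : ∀ {x y} → x ≤ y → y ≤ x → x ≈ y
    ≤-antisym = ≤.antisym

    ≤-resp : ∀ {x y x′ y′} → x ≈ x′ → y ≈ y′ → x ≤ y → x′ ≤ y′
    ≤-resp p q le = ≤-trans (≈⇒≤ (≈-sym p)) (≤-trans le (≈⇒≤ q))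

    <-resp : ∀ {x y x′ y′} → x ≈ x′ → y ≈ y′ → x < y → x′ < y′
    <-resp p q (le , ne) = ≤-resp p q le , λ eq → ne (≈-trans p (≈-trans eq (≈-sym q)))

    <⇒≤ : ∀ {x y} → x < y → x ≤ y
    <⇒≤ = proj₁

    <-≤-trans : ∀ {x y z} → x < y → y ≤ z → x < z
    <-≤-trans = <.<-≤-trans R.sym ≤.trans ≤.antisym ≤.≤-respʳ-≈

    ≤-<-trans : ∀ {x y z} → x ≤ y → y < z → x < z
    ≤-<-trans = <.≤-<-trans ≤.trans ≤.antisym ≤.≤-respˡ-≈

    <-trans : ∀ {x y z} → x < y → y < z → x < z
    <-trans x<y y<z = <-≤-trans x<y (<⇒≤ y<z)

    <⇒≱ : ∀ {x y} → x < y → ¬ y ≤ x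
    <⇒≱ = <.<⇒≱ ≤.antisym

    ≤⊎> : ∀ x y → x ≤ y ⊎ y < x
    ≤⊎> x y with ≤.total x y | x ≈? y
    ... | inj₁ x≤y | _       = inj₁ x≤y
    ... | inj₂ _   | yes x≈y = inj₁ (≈⇒≤ x≈y)
    ... | inj₂ y≤x | no x≉y  = inj₂ (y≤x , x≉y ∘ ≈-sym)

    ≰⇒> : ∀ {x y} → ¬ x ≤ y → y < x
    ≰⇒> {x} {y} x≰y with ≤⊎> x y
    ... | inj₁ x≤y = ⊥-elim (x≰y x≤y)
    ... | inj₂ y<x = y<x

    ≮⇒≥ : ∀ {x y} → ¬ x < y → y ≤ x
    ≮⇒≥ {x} {y} x≮y with ≤⊎> y x
    ... | inj₁ y≤x = y≤x
    ... | inj₂ x<y = ⊥-elim (x≮y x<y)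

    +-mono-≤ : ∀ {a b c d} → a ≤ b → c ≤ d → a + c ≤ b + d
    +-mono-≤ {a} {b} {c} {d} a≤b c≤d = ≤-trans (+-monoˡ-≤ c a≤b)
      (≤-resp (R.+-comm c b) (R.+-comm d b) (+-monoˡ-≤ b c≤d))

    ≤⇒0≤ : ∀ {x y} → x ≤ y → 0# ≤ y - x
    ≤⇒0≤ {x} {y} x≤y = ≤-resp (R.-‿inverseʳ x) ≈-refl (+-monoˡ-≤ (- x) x≤y)

    0≤⇒≤ : ∀ {x y} → 0# ≤ y - x → x ≤ y
    0≤⇒≤ {x} {y} le = ≤-resp (R.+-identityˡ x)
      (solve 2 (λ x y → (y :- x) :+ x := y) ≈-refl x y) (+-monoˡ-≤ x le)

    x-y≈0⇒x≈y : ∀ {x y} → x - y ≈ 0# → x ≈ y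
    x-y≈0⇒x≈y {x} {y} eq = ≈-trans (solve 2 (λ x y → x := (x :- y) :+ y) ≈-refl x y)
                             (≈-trans (R.+-congʳ eq) (R.+-identityˡ y))

    x≈y⇒x-y≈0 : ∀ {x y} → x ≈ y → x - y ≈ 0#
    x≈y⇒x-y≈0 {x} {y} eq = ≈-trans (R.+-congʳ eq) (R.-‿inverseʳ y)

    <⇒0< : ∀ {x y} → x < y → 0# < y - x
    <⇒0< (le , ne) = ≤⇒0≤ le , λ eq → ne (≈-sym (x-y≈0⇒x≈y (≈-sym eq)))

    0<⇒< : ∀ {x y} → 0# < y - x → x < y
    0<⇒< (le , ne) = 0≤⇒≤ le , λ eq → ne (≈-sym (x≈y⇒x-y≈0 (≈-sym eq)))

    0≤-+ : ∀ {x y} → 0# ≤ x → 0# ≤ y → 0# ≤ x + y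
    0≤-+ p q = ≤-resp (R.+-identityˡ 0#) ≈-refl (+-mono-≤ p q)

    0<-+ˡ : ∀ {x y} → 0# < x → 0# ≤ y → 0# < x + y
    0<-+ˡ {x} {y} p q = <-≤-trans p (≤-resp (R.+-identityʳ x) ≈-refl (+-mono-≤ ≤-refl q))

    0<-+ʳ : ∀ {x y} → 0# ≤ x → 0# < y → 0# < x + y
    0<-+ʳ p q = <-resp ≈-refl (R.+-comm _ _) (0<-+ˡ q p)

    0≤-neg : ∀ {x} → x ≤ 0# → 0# ≤ - x
    0≤-neg le = ≤-resp ≈-refl (R.+-identityˡ _) (≤⇒0≤ le)

    neg-≤0 : ∀ {x} → 0# ≤ x → - x ≤ 0#
    neg-≤0 {x} le = 0≤⇒≤ (≤-resp ≈-refl (solve 1 (λ x → x := con (+ 0) :- (:- x)) ≈-refl x) le)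

    0<-neg : ∀ {x} → x < 0# → 0# < - x
    0<-neg lt = <-resp ≈-refl (R.+-identityˡ _) (<⇒0< lt)

    0≤x² : ∀ x → 0# ≤ x * x
    0≤x² x with ≤.total 0# x
    ... | inj₁ p = *-nonneg p p
    ... | inj₂ p = ≤-resp ≈-refl (solve 1 (λ x → (:- x) :* (:- x) := x :* x) ≈-refl x)
                     (*-nonneg (0≤-neg p) (0≤-neg p))

    0<1 : 0# < 1#
    0<1 = ≤-resp ≈-refl (R.*-identityˡ 1#) (0≤x² 1#) , 0≉1

    0<⇒≉0 : ∀ {x} → 0# < x → ¬ x ≈ 0#
    0<⇒≉0 p eq = proj₂ p (≈-sym eq)

    0<-* : ∀ {x y} → 0# < x → 0# < y → 0# < x * y
    0<-* {x} {y} p q with inverse x (0<⇒≉0 p)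
    ... | x⁻¹ , xx⁻¹≈1 = *-nonneg (<⇒≤ p) (<⇒≤ q) , λ eq → 0<⇒≉0 q
          (≈-trans (≈-sym (R.*-identityˡ y)) (≈-trans (R.*-congʳ (≈-sym xx⁻¹≈1))
            (≈-trans (solve 3 (λ x i y → (x :* i) :* y := i :* (x :* y)) ≈-refl x x⁻¹ y)
              (≈-trans (R.*-congˡ (≈-sym eq)) (R.zeroʳ _)))))

    *-cancel-0 : ∀ {x y} → 0# < x → x * y ≈ 0# → y ≈ 0#
    *-cancel-0 {x} {y} p eq with inverse x (0<⇒≉0 p)
    ... | i , xi≈1 = ≈-trans (≈-sym (R.*-identityˡ y)) (≈-trans (R.*-congʳ (≈-sym xi≈1))
            (≈-trans (solve 3 (λ x i y → (x :* i) :* y := i :* (x :* y)) ≈-refl x i y)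
              (≈-trans (R.*-congˡ eq) (R.zeroʳ _))))

    -- A nonpositive inverse would make the product 1 nonpositive.
    inv⁺ : ∀ {x} → 0# < x → ∃ λ y → 0# < y × x * y ≈ 1#
    inv⁺ {x} p with inverse x (0<⇒≉0 p)
    ... | y , xy≈1 with ≤⊎> y 0#
    ... | inj₂ q = y , q , xy≈1
    ... | inj₁ q = ⊥-elim (<⇒≱ 0<1 (≤-resp
            (≈-trans (solve 2 (λ x y → :- (x :* (:- y)) := x :* y) ≈-refl x y) xy≈1) ≈-refl
            (neg-≤0 (*-nonneg (<⇒≤ p) (0≤-neg q)))))

    *-monoˡ-≤ : ∀ {c x y} → 0# ≤ c → x ≤ y → c * x ≤ c * y
    *-monoˡ-≤ {c} {x} {y} p q = 0≤⇒≤ (≤-resp ≈-refl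
      (solve 3 (λ c x y → c :* (y :- x) := c :* y :- c :* x) ≈-refl c x y) (*-nonneg p (≤⇒0≤ q)))

    *-monoˡ-< : ∀ {c x y} → 0# < c → x < y → c * x < c * y
    *-monoˡ-< {c} {x} {y} p q = 0<⇒< (<-resp ≈-refl
      (solve 3 (λ c x y → c :* (y :- x) := c :* y :- c :* x) ≈-refl c x y) (0<-* p (<⇒0< q)))

    *-cancelˡ-≈ : ∀ {c x y} → 0# < c → c * x ≈ c * y → x ≈ y
    *-cancelˡ-≈ {c} {x} {y} p eq = x-y≈0⇒x≈y (*-cancel-0 p
      (≈-trans (solve 3 (λ c x y → c :* (x :- y) := c :* x :- c :* y) ≈-refl c x y) (x≈y⇒x-y≈0 eq)))

    x≤x+y : ∀ {x y} → 0# ≤ y → x ≤ x + y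
    x≤x+y {x} {y} p = ≤-resp (R.+-identityʳ x) ≈-refl (+-mono-≤ ≤-refl p)

    half : ∃ λ h → 0# < h × h + h ≈ 1#
    half with inv⁺ (0<-+ˡ 0<1 (<⇒≤ 0<1))
    ... | h , p , eq = h , p , ≈-trans (solve 1 (λ h → h :+ h := (con (+ 1) :+ con (+ 1)) :* h) ≈-refl h)
            eq

  module _ {a} {A : Set a} where

    abstract

      ∑-mono : ∀ xs {f g : A → ℝ} → (∀ {x} → x List.∈ xs → f x ≤ g x) → ∑ xs f ≤ ∑ xs g
      ∑-mono []       le = ≤-refl
      ∑-mono (x ∷ xs) le = +-mono-≤ (le (here refl)) (∑-mono xs (le ∘ there))

      ∑-nonneg : ∀ xs {f : A → ℝ} → (∀ {x} → x List.∈ xs → 0# ≤ f x) → 0# ≤ ∑ xs f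
      ∑-nonneg []       p = ≤-refl
      ∑-nonneg (x ∷ xs) p = 0≤-+ (p (here refl)) (∑-nonneg xs (p ∘ there))

      ∑-≥-member : ∀ {xs} {f : A → ℝ} → (∀ {x} → x List.∈ xs → 0# ≤ f x) → ∀ {x} → x List.∈ xs → f x ≤ ∑ xs f
      ∑-≥-member {_ ∷ xs} p (here refl) = x≤x+y (∑-nonneg xs (p ∘ there))
      ∑-≥-member {y ∷ xs} p (there x∈)    = ≤-trans (∑-≥-member (p ∘ there) x∈)
        (≤-resp ≈-refl (R.+-comm _ _) (x≤x+y (p (here refl))))

      ∑-pos : ∀ {xs} {f : A → ℝ} → (∀ {x} → x List.∈ xs → 0# ≤ f x) →
              ∀ {x} → x List.∈ xs → 0# < f x → 0# < ∑ xs f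
      ∑-pos p x∈ lt = <-≤-trans lt (∑-≥-member p x∈)

      ∑-zero-member : ∀ {xs} {f : A → ℝ} → (∀ {x} → x List.∈ xs → 0# ≤ f x) → ∑ xs f ≈ 0# →
                      ∀ {x} → x List.∈ xs → f x ≈ 0#
      ∑-zero-member p eq x∈ = ≤-antisym (≤-trans (∑-≥-member p x∈) (≈⇒≤ eq)) (p x∈)

      ∑-pos-member : ∀ xs {f : A → ℝ} → (∀ {x} → x List.∈ xs → 0# ≤ f x) → 0# < ∑ xs f →
                     ∃ λ x → x List.∈ xs × 0# < f x
      ∑-pos-member []       p lt = ⊥-elim (proj₂ lt ≈-refl)
      ∑-pos-member (x ∷ xs) {f} p lt with ≤⊎> (f x) 0#
      ... | inj₂ q = x , here refl , q
      ... | inj₁ q with ∑-pos-member xs (p ∘ there)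
            (<-≤-trans lt (≤-resp ≈-refl (R.+-identityˡ _) (+-mono-≤ q ≤-refl)))
      ... | y , y∈ , r = y , there y∈ , r

  module _ {A : Set} where

    abstract

      argmin : ∀ (xs : List A) (P : A → Set) (f : A → ℝ) {x} → x List.∈ xs → P x →
               ∃ λ y → P y × (∀ {z} → z List.∈ xs → P z → f y ≤ f z)
      argmin xs P f x∈ px with em₀ (∃ λ y → y List.∈ xs × P y)
      ... | no none = ⊥-elim (none (_ , x∈ , px))
      ... | yes ex  = go xs ex
        where
        go : ∀ xs → (∃ λ y → y List.∈ xs × P y) → ∃ λ y → P y × (∀ {z} → z List.∈ xs → P z → f y ≤ f z)
        go (x ∷ xs) (y , y∈ , py) with em₀ (∃ λ y → y List.∈ xs × P y) | em₀ (P x)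
        go (x ∷ xs) _ | yes ex′ | no ¬px = let (m , pm , le) = go xs ex′ in
          m , pm , λ { (here refl) pz → ⊥-elim (¬px pz) ; (there z∈) pz → le z∈ pz }
        go (x ∷ xs) _ | yes ex′ | yes px with go xs ex′
        ... | m , pm , le with ≤.total (f x) (f m)
        ... | inj₁ fx≤ = x , px , λ { (here refl) _ → ≤-refl ; (there z∈) pz → ≤-trans fx≤ (le z∈ pz) }
        ... | inj₂ fm≤ = m , pm , λ { (here refl) _ → fm≤ ; (there z∈) pz → le z∈ pz }
        go (x ∷ xs) _ | no none | yes px =
          x , px , λ { (here refl) _ → ≤-refl ; (there z∈) pz → ⊥-elim (none (_ , z∈ , pz)) }
        go (x ∷ xs) (y , here refl , py) | no none | no ¬px = ⊥-elim (¬px py)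
        go (x ∷ xs) (y , there y∈ , py) | no none | no ¬px = ⊥-elim (none (y , y∈ , py))

-- Decomposing vectors along chains.

module Peeling (em : ExcludedMiddle (suc 0ℓ)) (real : CompleteOrderedField) where

  open RealLemmas em real

  infix 4 _≋_
  _≋_ : ∀ {A : Set} → (A → ℝ) → (A → ℝ) → Set
  f ≋ g = ∀ x → f x ≈ g x

  at : ∀ {T : Set} → T → ℝ → T → ℝ
  at t₀ k t = term (em₀ (t ≡ t₀)) k

  at-self : ∀ {T : Set} {t₀ : T} {k} → at t₀ k t₀ ≈ k
  at-self {t₀ = t₀} = term-yes (em₀ (t₀ ≡ t₀)) refl

  at-other : ∀ {T : Set} {t₀ t : T} {k} → t ≢ t₀ → at t₀ k t ≈ 0#
  at-other {t₀ = t₀} {t} t≢ = term-no (em₀ (t ≡ t₀)) t≢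

  module _ {T : Set} (_⊑_ : T → T → Set) (A : T → Set) where

    -- A point of the order complex of the allowed elements up to normalisation. Leaving the total
    -- weight free lets weights be subtracted and rescaled.
    record Chain (c : T → ℝ) : Set where
      field
        nonneg  : ∀ t → 0# ≤ c t
        allowed : ∀ {t} → 0# < c t → A t
        linked  : ∀ {t u} → 0# < c t → 0# < c u → t ⊑ u ⊎ u ⊑ t

    open Chain

    chain-cong : ∀ {c d} → c ≋ d → Chain c → Chain d
    chain-cong eq ch = record
      { nonneg  = λ t → ≤-resp ≈-refl (eq t) (nonneg ch t)
      ; allowed = λ p → allowed ch (<-resp ≈-refl (≈-sym (eq _)) p)
      ; linked  = λ p q → linked ch (<-resp ≈-refl (≈-sym (eq _)) p) (<-resp ≈-refl (≈-sym (eq _)) q)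
      }

    empty-chain : Chain (λ _ → 0#)
    empty-chain = record
      { nonneg  = λ _ → ≤-refl
      ; allowed = λ p → ⊥-elim (proj₂ p ≈-refl)
      ; linked  = λ p → ⊥-elim (proj₂ p ≈-refl)
      }

    -- A finite chain has a least member. `P` singles out part of the support, as when the successor
    -- of a member is sought; `t ≡ t` is passed where no restriction is meant.
    least : (∀ {t} → A t → t ⊑ t) → (∀ {t u v} → t ⊑ u → u ⊑ v → t ⊑ v) →
            ∀ {c} → Chain c → (P : T → Set) (xs : List T) → (∃ λ t → t List.∈ xs × 0# < c t × P t) →
            ∃ λ t → 0# < c t × P t × (∀ {u} → u List.∈ xs → 0# < c u → P u → t ⊑ u)
    least ⊑-refl ⊑-trans {c} ch P = go
      where
      go : ∀ xs → (∃ λ t → t List.∈ xs × 0# < c t × P t) →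
           ∃ λ t → 0# < c t × P t × (∀ {u} → u List.∈ xs → 0# < c u → P u → t ⊑ u)
      go [] (_ , () , _)
      go (x ∷ xs) (t , t∈ , lt , pt)
        with em₀ (∃ λ t → t List.∈ xs × 0# < c t × P t) | em₀ (0# < c x × P x)
      ... | no none | no ¬px = ⊥-elim (absurd t∈)
        where
        absurd : ¬ t List.∈ (x ∷ xs)
        absurd (Any.here refl) = ¬px (lt , pt)
        absurd (Any.there t∈)    = none (t , t∈ , lt , pt)
      ... | no none | yes (lx , px) = x , lx , px , λ where
              (Any.here refl) _ _ → ⊑-refl (allowed ch lx)
              (Any.there u∈) lu pu  → ⊥-elim (none (_ , u∈ , lu , pu))
      ... | yes ex | no ¬px = let (m , lm , pm , le) = go xs ex in
              m , lm , pm , λ where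
              (Any.here refl) lu pu → ⊥-elim (¬px (lu , pu))
              (Any.there u∈)          → le u∈
      ... | yes ex | yes (lx , px) with go xs ex
      ... | m , lm , pm , le with linked ch lx lm
      ... | inj₁ x⊑m = x , lx , px , λ where
              (Any.here refl) _ _ → ⊑-refl (allowed ch lx)
              (Any.there u∈) lu pu  → ⊑-trans x⊑m (le u∈ lu pu)
      ... | inj₂ m⊑x = m , lm , pm , λ where
              (Any.here refl) _ _ → m⊑x
              (Any.there u∈)        → le u∈

  module Combinations {T W : Set} (ts : List T) (s : T → W → ℝ) where

    comb : (T → ℝ) → W → ℝ
    comb c w = ∑ ts (λ t → c t * s t w)

    comb-cong : ∀ {c d} → c ≋ d → comb c ≋ comb d
    comb-cong eq w = ∑-cong ts (λ t → *-congʳ (eq t))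

    comb-zero : ∀ {c} → (∀ t → c t ≈ 0#) → ∀ w → comb c w ≈ 0#
    comb-zero z w = ∑-zero ts (λ {t} _ → ≈-trans (*-congʳ (z t)) (zeroˡ _))

    comb-scale : ∀ k c w → comb (λ t → k * c t) w ≈ k * comb c w
    comb-scale k c w = ≈-trans (∑-cong ts (λ t → *-assoc k (c t) (s t w))) (∑-*ˡ k ts _)

    comb-+ : ∀ c d w → comb (λ t → c t + d t) w ≈ comb c w + comb d w
    comb-+ c d w = ≈-trans (∑-cong ts (λ t → distribʳ (s t w) (c t) (d t))) (∑-+ ts _ _)

    module _ (unique : Unique ts) (complete : ∀ t → t List.∈ ts) where

      comb-at : ∀ t₀ k w → comb (at t₀ k) w ≈ k * s t₀ w
      comb-at t₀ k w = ≈-trans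
        (∑-single unique (complete t₀) (λ {t} t≢ → ≈-trans (*-congʳ (at-other t≢)) (zeroˡ _)))
        (*-congʳ at-self)

      comb-minus : ∀ c t₀ k w → comb (λ t → c t - at t₀ k t) w ≈ comb c w - k * s t₀ w
      comb-minus c t₀ k w = x-y≈0⇒x≈y (≈-trans
        (solve 3 (λ a b e → a :- (b :- e) := (a :+ e) :- b) ≈-refl _ _ _)
        (x≈y⇒x-y≈0 (≈-trans (+-congˡ (≈-sym (comb-at t₀ k w)))
          (≈-trans (≈-sym (comb-+ _ (at t₀ k) w))
            (comb-cong (λ t → solve 2 (λ a b → (a :- b) :+ b := a) ≈-refl _ _) w)))))

  -- Serves two families of vectors: the sign vectors of minors, ordered by `_⊴_`, and chosen
  -- solutions of a linear system, ordered by reverse inclusion of supports. The essential datum is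
  -- `β`, which reads the least member of a chain off a combination.
  module Decomposition {T W : Set} (ts : List T) (unique : Unique ts) (complete : ∀ t → t List.∈ ts)
    (_⊑_ : T → T → Set) (A : T → Set)
    (⊑-refl : ∀ {t} → A t → t ⊑ t) (⊑-trans : ∀ {t u v} → t ⊑ u → u ⊑ v → t ⊑ v)
    (⊑-antisym : ∀ {t u} → A t → A u → t ⊑ u → u ⊑ t → t ≡ u)
    (s : T → W → ℝ) (β : (W → ℝ) → T)
    (β-cong : ∀ {x y} → x ≋ y → β x ≡ β y)
    (β-zero : ∀ {x} → (∀ w → x w ≈ 0#) → ¬ A (β x)) where

    open Combinations ts s public
    open Chain

    Ch : (T → ℝ) → Set
    Ch = Chain _⊑_ A

    module Uniqueness
      (β-least : ∀ {c} → Ch c → ∀ {t} → 0# < c t → (∀ {u} → 0# < c u → t ⊑ u) → β (comb c) ≡ t) where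

      β-positive : ∀ {c} → Ch c → (∃ λ t → 0# < c t) → 0# < c (β (comb c))
      β-positive {c} ch (t , lt) with least _⊑_ A ⊑-refl ⊑-trans ch (λ _ → t ≡ t) ts (t , complete t , lt , refl)
      ... | m , lm , _ , le = subst (λ u → 0# < c u) (sym (β-least ch lm (λ lu → le (complete _) lu refl))) lm

      β-⊑ : ∀ {c} → Ch c → ∀ {t} → 0# < c t → β (comb c) ⊑ t
      β-⊑ {c} ch {t} lt with least _⊑_ A ⊑-refl ⊑-trans ch (λ _ → t ≡ t) ts (t , complete t , lt , refl)
      ... | m , lm , _ , le = subst (_⊑ t) (sym (β-least ch lm (λ lu → le (complete _) lu refl))) (le (complete t) lt refl)

      subtract-supp : ∀ {c t₀ k} → Ch c → 0# ≤ k → ∀ {t} → 0# < c t - at t₀ k t → 0# < c t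
      subtract-supp {c} {t₀} {k} ch 0≤k {t} lt = <-≤-trans lt (0≤⇒≤ (≤-resp ≈-refl
        (solve 2 (λ a b → b := a :- (a :- b)) ≈-refl (c t) (at t₀ k t)) (pos (em₀ (t ≡ t₀)))))
        where
        pos : (d : Dec (t ≡ t₀)) → 0# ≤ term d k
        pos (yes _) = 0≤k
        pos (no _)  = ≤-refl

      subtract : ∀ {c t₀ k} → Ch c → 0# ≤ k → k ≤ c t₀ → Ch (λ t → c t - at t₀ k t)
      subtract {c} {t₀} {k} ch 0≤k k≤ = record
        { nonneg  = λ t → nn t (em₀ (t ≡ t₀))
        ; allowed = λ p → allowed ch (subtract-supp ch 0≤k p)
        ; linked  = λ p q → linked ch (subtract-supp ch 0≤k p) (subtract-supp ch 0≤k q)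
        }
        where
        nn : ∀ t (d : Dec (t ≡ t₀)) → 0# ≤ c t - term d k
        nn t (yes refl) = ≤⇒0≤ k≤
        nn t (no _) = ≤⇒0≤ (nonneg ch t)

      -- Subtract `c t₀` at `t₀` from both. The combinations still agree and that of `d` still has
      -- least member `t₀`, but `c` has no weight left there. If `c` has other weights, `β` names
      -- one of them; if not, the combination is zero and `β` names no allowed element. Neither fits
      -- `t₀`.
      not-less : ∀ {c d} → Ch c → Ch d → comb c ≋ comb d → ∀ {t₀} → t₀ ≡ β (comb d) → 0# < d t₀ →
                 ¬ c t₀ < d t₀
      not-less {c} {d} chc chd eq {t₀} t₀≡ d>0 lt = contradict (em₀ (∃ λ t → 0# < c′ t))
        where
        c′ d′ : T → ℝ
        c′ t = c t - at t₀ (c t₀) t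
        d′ t = d t - at t₀ (c t₀) t
        chc′ : Ch c′
        chc′ = subtract chc (nonneg chc t₀) ≤-refl
        chd′ : Ch d′
        chd′ = subtract chd (nonneg chc t₀) (<⇒≤ lt)
        eq′ : comb c′ ≋ comb d′
        eq′ w = ≈-trans (comb-minus unique complete c t₀ (c t₀) w) (≈-trans (+-congʳ (eq w))
                  (≈-sym (comb-minus unique complete d t₀ (c t₀) w)))
        βd′≡ : β (comb d′) ≡ t₀
        βd′≡ = β-least chd′
          (<-resp ≈-refl (+-congˡ (-‿cong (≈-sym at-self))) (<⇒0< lt))
          (λ lu → subst (_⊑ _) (sym t₀≡) (β-⊑ chd (subtract-supp chd (nonneg chc t₀) lu)))
        contradict : Dec (∃ λ t → 0# < c′ t) → ⊥
        contradict (yes ex) = 0<⇒≉0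
          (subst (λ t → 0# < c′ t) (trans (β-cong eq′) βd′≡) (β-positive chc′ ex)) (x≈y⇒x-y≈0 (≈-sym at-self))
        contradict (no none) = β-zero
          (λ w → ≈-trans (≈-sym (eq′ w)) (comb-zero (λ t → ≤-antisym (≮⇒≥ (λ p → none (t , p))) (nonneg chc′ t)) w))
          (subst A (sym βd′≡) (allowed chd d>0))

      abstract

        -- The least members agree, since `β` computes them from the common combination, and so do
        -- their weights by `not-less`. Removing this member from both chains shortens a list that
        -- contains both supports.
        comb-injective : ∀ {c d} → Ch c → Ch d → comb c ≋ comb d → c ≋ d
        comb-injective {c} {d} chc chd = go (length ts) ts ℕ.≤-refl chc chd (λ _ → complete _) (λ _ → complete _)
          where
          go : ∀ n xs → length xs ℕ.≤ n → ∀ {c d} → Ch c → Ch d →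
               (∀ {t} → 0# < c t → t List.∈ xs) → (∀ {t} → 0# < d t → t List.∈ xs) →
               comb c ≋ comb d → c ≋ d
          step : ∀ n xs → length xs ℕ.≤ n → ∀ {c d} → Ch c → Ch d →
               (∀ {t} → 0# < c t → t List.∈ xs) → (∀ {t} → 0# < d t → t List.∈ xs) →
               comb c ≋ comb d → ∀ {t₀} → t₀ ≡ β (comb c) → 0# < c t₀ → c ≋ d
          step n [] le chc chd sc sd eq t₀≡ lt with () ← sc lt
          step (ℕ.suc n) xs@(_ ∷ _) le {c} {d} chc chd sc sd eq {t₀} t₀≡ lt t =
            x-y≈0⇒x≈y (≈-trans (solve 3 (λ a b e → a :- b := (a :- e) :- (b :- e)) ≈-refl (c t) (d t) (at t₀ k t))
              (x≈y⇒x-y≈0 (sub≋ t)))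
            where
            k : ℝ
            k = c t₀
            d₀≈ : d t₀ ≈ k
            d₀≈ with em₀ (0# < d t₀)
            ... | yes d>0 = ≤-antisym (≮⇒≥ (not-less chc chd eq (trans t₀≡ (β-cong eq)) d>0))
                              (≮⇒≥ (not-less chd chc (λ w → ≈-sym (eq w)) t₀≡ lt))
            ... | no d≯0  = ⊥-elim (not-less chd chc (λ w → ≈-sym (eq w)) t₀≡ lt (≤-<-trans (≮⇒≥ d≯0) lt))
            off : ∀ {e : T → ℝ} {t} → e t₀ ≈ k → 0# < e t - at t₀ k t → t ≢ t₀
            off {e} e≈ p refl = proj₂ p (≈-sym (x≈y⇒x-y≈0 {e t₀} {at t₀ k t₀} (≈-trans e≈ (≈-sym at-self))))
            P? : ∀ t → Dec (t ≢ t₀)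
            P? t = ¬? (em₀ (t ≡ t₀))
            sub≋ : (λ t → c t - at t₀ k t) ≋ (λ t → d t - at t₀ k t)
            sub≋ = go n (filter P? xs)
              (ℕ.≤-pred (ℕ.<-≤-trans (List.filter-notAll P? xs (Any.map (λ e t≢ → t≢ (sym e)) (sc lt))) le))
              (subtract chc (<⇒≤ lt) ≤-refl) (subtract chd (<⇒≤ lt) (≈⇒≤ (≈-sym d₀≈)))
              (λ p → ∈-filter⁺ P? (sc (subtract-supp chc (<⇒≤ lt) p)) (off {c} ≈-refl p))
              (λ p → ∈-filter⁺ P? (sd (subtract-supp chd (<⇒≤ lt) p)) (off {d} d₀≈ p))
              (λ w → ≈-trans (comb-minus unique complete c t₀ k w) (≈-trans (+-congʳ (eq w))
                       (≈-sym (comb-minus unique complete d t₀ k w))))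
          go n xs le {c} {d} chc chd sc sd eq with em₀ (∃ λ t → 0# < c t) | em₀ (∃ λ t → 0# < d t)
          ... | yes ex | _ = step n xs le chc chd sc sd eq refl (β-positive chc ex)
          ... | no _ | yes ex = λ t → ≈-sym (step n xs le chd chc sd sc (λ w → ≈-sym (eq w)) refl (β-positive chd ex) t)
          ... | no nc | no nd = λ t → ≈-trans (≤-antisym (≮⇒≥ (λ p → nc (t , p))) (nonneg chc t))
                                  (≈-sym (≤-antisym (≮⇒≥ (λ p → nd (t , p))) (nonneg chd t)))

    module Existence (P : (W → ℝ) → Set) (μ : (W → ℝ) → ℕ)
      (peel : ∀ {x} → P x → ¬ (∀ w → x w ≈ 0#) →
              A (β x) × ∃ λ k → 0# < k × P (λ w → x w - k * s (β x) w) ×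
              β x ⊑ β (λ w → x w - k * s (β x) w) × μ (λ w → x w - k * s (β x) w) ℕ.< μ x) where

      abstract

        -- The induction also records that `β x` lies below every member used, which is what lets it
        -- join the chain of the remainder. It may be a member of that chain already, hence the sum
        -- of weights.
        decompose : ∀ {x} → P x → ∃ λ c → Ch c × comb c ≋ x
        decompose {x} px = let (c , ch , eq , _) = go (ℕ.suc (μ x)) ℕ.≤-refl px in c , ch , eq
          where
          go : ∀ n {x} → μ x ℕ.< n → P x → ∃ λ c → Ch c × comb c ≋ x × (∀ {t} → 0# < c t → β x ⊑ t)
          go (ℕ.suc n) {x} (s≤s le) px with em₀ (∀ w → x w ≈ 0#)
          ... | yes z = (λ _ → 0#) ,
                empty-chain _⊑_ A ,
                (λ w → ≈-trans (comb-zero (λ _ → ≈-refl) w) (≈-sym (z w))) , λ p → ⊥-elim (proj₂ p ≈-refl)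
          ... | no nz with peel px nz
          ... | a , k , k>0 , px′ , ⊑′ , lt with go n (ℕ.<-≤-trans lt le) px′
          ... | c′ , ch′ , eq′ , bound = c , ch , eq , below
            where
            t₀ : T
            t₀ = β x
            c : T → ℝ
            c t = c′ t + at t₀ k t
            split : ∀ {t} → 0# < c t → t ≡ t₀ ⊎ 0# < c′ t
            split {t} lt with em₀ (t ≡ t₀)
            ... | yes eq = inj₁ eq
            ... | no _   = inj₂ (<-resp ≈-refl (+-identityʳ _) lt)
            below : ∀ {t} → 0# < c t → t₀ ⊑ t
            below lt with split lt
            ... | inj₁ refl = ⊑-refl a
            ... | inj₂ p      = ⊑-trans ⊑′ (bound p)
            ch : Ch c
            ch = record
              { nonneg  = λ t → 0≤-+ (nonneg ch′ t) (pos t)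
              ; allowed = λ p → Sum.[ (λ { refl → a }) , allowed ch′ ] (split p)
              ; linked  = λ p q → link p q (split p) (split q)
              }
              where
              pos : ∀ t → 0# ≤ at t₀ k t
              pos t with em₀ (t ≡ t₀)
              ... | yes _ = <⇒≤ k>0
              ... | no _  = ≤-refl
              link : ∀ {t u} → 0# < c t → 0# < c u → t ≡ t₀ ⊎ 0# < c′ t → u ≡ t₀ ⊎ 0# < c′ u → t ⊑ u ⊎ u ⊑ t
              link p q (inj₁ refl) _ = inj₁ (below q)
              link p q _ (inj₁ refl) = inj₂ (below p)
              link p q (inj₂ p′) (inj₂ q′) = linked ch′ p′ q′
            eq : comb c ≋ x
            eq w = ≈-trans (comb-+ c′ (at t₀ k) w) (≈-trans (+-cong (eq′ w) (comb-at unique complete t₀ k w))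
                     (solve 2 (λ a b → (a :- b) :+ b := a) ≈-refl (x w) (k * s t₀ w)))

-- The simplicial fan of a minor.

module Fan (em : ExcludedMiddle (suc 0ℓ)) (real : CompleteOrderedField) (LG : GeneratorEnrichedLattice) where

  open RealLemmas em real
  open Peeling em real
  open GeneratorEnrichedLattice LG using (size; ⋁) renaming (_≤_ to _≤ᴸ_; _∨_ to _∨ᴸ_)
  open Minors LG hiding (∅ᴹ)
  module C = Cells LG
  open C using (Cell; Valid; _⊴_; Spans; allCells; allCells-unique; ∈-allCells; ⊴-trans; ⊴-antisym; ∨-assoc-absorb)
  open Facets LG using (rank; rank-<; rank-≤)

  infix 4 _≤ᴸ?_
  _≤ᴸ?_ : ∀ x y → Dec (x ≤ᴸ y)
  _≤ᴸ?_ = C._≤?_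

  -1≤0 : - 1# ≤ 0#
  -1≤0 = neg-≤0 (<⇒≤ 0<1)

  abstract

    sign-of : ∀ {P Q : Set} → Dec P → Dec Q → ℝ
    sign-of (yes _) _       = 1#
    sign-of (no _)  (yes _) = 0#
    sign-of (no _)  (no _)  = - 1#

    -- The sign vector of a minor: 1 on the generators it contracts, 0 on those
    -- it keeps (up to identification) and −1 on those it deletes.
    sgn : Cell → Fin size → ℝ
    sgn (z , H) g = sign-of (g ≤ᴸ? z) (g ∨ᴸ z ∈? H)

    sgn-below : ∀ {z H g} → g ≤ᴸ z → sgn (z , H) g ≈ 1#
    sgn-below {z} {H} {g} g≤ with g ≤ᴸ? z
    ... | yes _ = ≈-refl
    ... | no g≰ = ⊥-elim (g≰ g≤)

    sgn-kept : ∀ {z H g} → ¬ g ≤ᴸ z → g ∨ᴸ z ∈ H → sgn (z , H) g ≈ 0#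
    sgn-kept {z} {H} {g} g≰ g∈ with g ≤ᴸ? z | g ∨ᴸ z ∈? H
    ... | yes g≤ | _     = ⊥-elim (g≰ g≤)
    ... | no _   | yes _ = ≈-refl
    ... | no _   | no g∉ = ⊥-elim (g∉ g∈)

    sgn-deleted : ∀ {z H g} → ¬ g ≤ᴸ z → g ∨ᴸ z ∉ H → sgn (z , H) g ≈ - 1#
    sgn-deleted {z} {H} {g} g≰ g∉ with g ≤ᴸ? z | g ∨ᴸ z ∈? H
    ... | yes g≤ | _      = ⊥-elim (g≰ g≤)
    ... | no _   | yes g∈ = ⊥-elim (g∉ g∈)
    ... | no _   | no _   = ≈-refl

    sgn-≤0 : ∀ {z H g} → ¬ g ≤ᴸ z → sgn (z , H) g ≤ 0#
    sgn-≤0 {z} {H} {g} g≰ with g ≤ᴸ? z | g ∨ᴸ z ∈? H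
    ... | yes g≤ | _     = ⊥-elim (g≰ g≤)
    ... | no _   | yes _ = ≤-refl
    ... | no _   | no _  = -1≤0

    sgn-≥0 : ∀ {z H g} → g ≤ᴸ z ⊎ g ∨ᴸ z ∈ H → 0# ≤ sgn (z , H) g
    sgn-≥0 {z} {H} {g} p with g ≤ᴸ? z | g ∨ᴸ z ∈? H
    ... | yes _  | _     = <⇒≤ 0<1
    ... | no _   | yes _ = ≤-refl
    ... | no g≰  | no g∉ = ⊥-elim (Sum.[ g≰ , g∉ ] p)

    sgn-0⇒kept : ∀ {z H g} → sgn (z , H) g ≈ 0# → g ∨ᴸ z ∈ H
    sgn-0⇒kept {z} {H} {g} eq with g ≤ᴸ? z | g ∨ᴸ z ∈? H
    ... | yes _  | _      = ⊥-elim (0<⇒≉0 0<1 eq)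
    ... | no _   | yes g∈ = g∈
    ... | no _   | no _   = ⊥-elim (0<⇒≉0 0<1 (≈-trans
          (solve 1 (λ x → x := :- (:- x)) ≈-refl 1#) (≈-trans (-‿cong eq) (solve 0 (:- con (+ 0) := con (+ 0)) ≈-refl))))

  module FanAt (y₀ : Cell) (v₀ : Valid y₀) {d : ℕ} (γ : Fin d → Fin size)
    (γ-∈ : ∀ j → γ j ∈ proj₂ y₀) (γ-onto : ∀ {g} → g ∈ proj₂ y₀ → ∃ λ j → γ j ≡ g)
    (γ-injective : ∀ {i j} → γ i ≡ γ j → i ≡ j) where

    z₀ : Fin size
    z₀ = proj₁ y₀

    H₀ : Subset size
    H₀ = proj₂ y₀

    A : Cell → Set
    A m = Valid m × m ⊴ y₀ × m ≢ y₀

    s : Cell → Fin d → ℝ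
    s m j = sgn m (γ j)

    γ≰z₀ : ∀ j → ¬ γ j ≤ᴸ z₀
    γ≰z₀ j le = proj₂ (v₀ (γ-∈ j)) (C.antisym le (proj₁ (v₀ (γ-∈ j))))

    abstract

      positive? : ∀ (x : Fin d → ℝ) (g : Fin size) → Dec (∃ λ j → γ j ≡ g × 0# < x j)
      positive? x g = em₀ (∃ λ j → γ j ≡ g × 0# < x j)

      zero? : ∀ (x : Fin d → ℝ) (z k : Fin size) → Dec (∃ λ j → x j ≈ 0# × k ≡ γ j ∨ᴸ z × ¬ γ j ≤ᴸ z)
      zero? x z k = em₀ (∃ λ j → x j ≈ 0# × k ≡ γ j ∨ᴸ z × ¬ γ j ≤ᴸ z)

      zᵇ : (Fin d → ℝ) → Fin size
      zᵇ x = z₀ ∨ᴸ ⋁ ⟪ positive? x ⟫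

      Hᵇ : (Fin d → ℝ) → Fin size → Subset size
      Hᵇ x z = ⟪ zero? x z ⟫

      z₀≤zᵇ : ∀ x → z₀ ≤ᴸ zᵇ x
      z₀≤zᵇ x = C.x≤x∨y _ _

      γ≤zᵇ : ∀ x {j} → 0# < x j → γ j ≤ᴸ zᵇ x
      γ≤zᵇ x {j} lt = C.≤-trans (⋁-upper (∈⟪⟫⁺ (positive? x) (j , refl , lt))) (C.y≤x∨y _ _)

      zᵇ-least : ∀ x {u} → z₀ ≤ᴸ u → (∀ {j} → 0# < x j → γ j ≤ᴸ u) → zᵇ x ≤ᴸ u
      zᵇ-least x z₀≤ ub = C.∨-least z₀≤ (⋁-least (λ g∈ → let (j , eq , lt) = ∈⟪⟫⁻ (positive? x) g∈ in
        subst (_≤ᴸ _) eq (ub lt)))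

      zᵇ-spans : ∀ x → Spans H₀ z₀ (zᵇ x)
      zᵇ-spans x = C.⋁-spans (λ g∈ → let (j , e , _) = ∈⟪⟫⁻ (positive? x) g∈ in subst (_∈ H₀) e (γ-∈ j))

      ∈Hᵇ⁺ : ∀ x z j → x j ≈ 0# → ¬ γ j ≤ᴸ z → γ j ∨ᴸ z ∈ Hᵇ x z
      ∈Hᵇ⁺ x z j eq g≰ = ∈⟪⟫⁺ (zero? x z) (j , eq , refl , g≰)

      ∈Hᵇ⁻ : ∀ x z {k} → k ∈ Hᵇ x z → ∃ λ j → x j ≈ 0# × k ≡ γ j ∨ᴸ z × ¬ γ j ≤ᴸ z
      ∈Hᵇ⁻ x z = ∈⟪⟫⁻ (zero? x z)

    bottom : (Fin d → ℝ) → Cell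
    bottom x = zᵇ x , Hᵇ x (zᵇ x)

    bottom-cong : ∀ {x y} → x ≋ y → bottom x ≡ bottom y
    bottom-cong {x} {y} eq = cong₂ _,_ z≡ (trans (cong (λ z → Hᵇ x z) z≡)
        (subset-ext (transfer eq) (transfer (λ j → ≈-sym (eq j)))))
      where
      transfer : ∀ {x y z} → x ≋ y → ∀ {k} → k ∈ Hᵇ x z → k ∈ Hᵇ y z
      transfer {x} {y} {z} eq k∈ with j , x≈0 , refl , g≰ ← ∈Hᵇ⁻ x z k∈ =
        ∈Hᵇ⁺ y z j (≈-trans (≈-sym (eq j)) x≈0) g≰
      bound : ∀ {x y} → x ≋ y → zᵇ x ≤ᴸ zᵇ y
      bound {x} {y} eq = zᵇ-least x (z₀≤zᵇ y) (λ lt → γ≤zᵇ y (<-resp ≈-refl (eq _) lt))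
      z≡ : zᵇ x ≡ zᵇ y
      z≡ = C.antisym (bound eq) (bound (λ j → ≈-sym (eq j)))

    -- The zero vector is the sign vector of `y₀`, all of whose generators are kept. For this reason
    -- `A` leaves `y₀` out: weight on it would be invisible in a combination.
    bottom-zero : ∀ {x} → (∀ j → x j ≈ 0#) → bottom x ≡ y₀
    bottom-zero {x} z = cong₂ _,_ z≡ (trans (cong (λ z → Hᵇ x z) z≡) (subset-ext to from))
      where
      z≡ : zᵇ x ≡ z₀
      z≡ = C.antisym (zᵇ-least x C.≤-refl (λ lt → ⊥-elim (0<⇒≉0 lt (z _)))) (z₀≤zᵇ x)
      absorb : ∀ j → γ j ∨ᴸ z₀ ≡ γ j
      absorb j = ∨-absorb (proj₁ (v₀ (γ-∈ j)))
      to : ∀ {k} → k ∈ Hᵇ x z₀ → k ∈ H₀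
      to k∈ with j , _ , refl , _ ← ∈Hᵇ⁻ x z₀ k∈ = subst (_∈ H₀) (sym (absorb j)) (γ-∈ j)
      from : ∀ {k} → k ∈ H₀ → k ∈ Hᵇ x z₀
      from k∈ with j , refl ← γ-onto k∈ = subst (_∈ Hᵇ x z₀) (absorb j) (∈Hᵇ⁺ x z₀ j (z j) (γ≰z₀ j))

    ⊴-reflexive : ∀ {m} → A m → m ⊴ m
    ⊴-reflexive (v , _) = C.⊴-refl v

    ⊴-antisymmetric : ∀ {m m′} → A m → A m′ → m ⊴ m′ → m′ ⊴ m → m ≡ m′
    ⊴-antisymmetric (v , _) (v′ , _) = ⊴-antisym v v′

    bottom-improper : ∀ {x} → (∀ j → x j ≈ 0#) → ¬ A (bottom x)
    bottom-improper z (_ , _ , ≢y₀) = ≢y₀ (bottom-zero z)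

    open Decomposition {W = Fin d} allCells allCells-unique ∈-allCells _⊴_ A ⊴-reflexive ⊴-trans
           ⊴-antisymmetric s bottom bottom-cong bottom-improper public
    open Chain

    Alive : Cell → Fin d → Set
    Alive (z , H) j = γ j ≤ᴸ z ⊎ γ j ∨ᴸ z ∈ H

    module _ {c : Cell → ℝ} (ch : Ch c) where

      Lasting : Cell → Fin d → Set
      Lasting m j = ∀ {m′} → 0# < c m′ → m ⊴ m′ → Alive m′ j

      Traced : Cell → Set
      Traced m = (∀ {h} → h ∈ proj₂ m → ∃ λ j → h ≡ γ j ∨ᴸ proj₁ m × Lasting m j) ×
        (∀ {u} → z₀ ≤ᴸ u → (∀ {j} → Lasting m j → γ j ≤ᴸ proj₁ m → γ j ≤ᴸ u) → proj₁ m ≤ᴸ u)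

      -- Going up along the chain, every generator of a member comes from a
      -- generator of y₀ that has not been deleted anywhere in between.
      trace : ∀ k {m} → 0# < c m → rank y₀ ℕ.< rank m ℕ.+ k → Traced m
      trace k {m} lt bound with em₀ (∃ λ m′ → m′ List.∈ allCells × 0# < c m′ × (m ⊴ m′ × m′ ≢ m))
      ... | no none = from-top (proj₁ (proj₂ (allowed ch lt)))
        where
        lasting : ∀ {j} → Alive m j → Lasting m j
        lasting a {m′} lt′ m⊴m′ with m′ C.≟ᶜ m
        ... | yes refl = a
        ... | no m′≢m = ⊥-elim (none (m′ , ∈-allCells m′ , lt′ , m⊴m′ , m′≢m))
        from-top : m ⊴ y₀ → Traced m
        from-top (sp , f) =
          (λ h∈ → let (g , g∈ , eq) = f h∈ ; (j , e) = γ-onto g∈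
                      eq′ = trans eq (cong (_∨ᴸ proj₁ m) (sym e)) in
            j , eq′ , lasting (inj₂ (subst (_∈ proj₂ m) eq′ h∈))) ,
          (λ z₀≤u ub → proj₂ sp z₀≤u (λ h∈ h≤ → let (j , e) = γ-onto h∈ in
            subst (_≤ᴸ _) e (ub (lasting (inj₁ (subst (_≤ᴸ _) (sym e) h≤))) (subst (_≤ᴸ _) (sym e) h≤))))
      ... | yes ex with least _⊴_ A ⊴-reflexive ⊴-trans ch (λ m′ → m ⊴ m′ × m′ ≢ m) allCells ex
      ... | m⁺ , lt⁺ , (m⊴m⁺ , m⁺≢m) , le = from-next k bound m⊴m⁺
        where
        v = proj₁ (allowed ch lt)
        v⁺ = proj₁ (allowed ch lt⁺)
        lasting : ∀ {j} → Alive m j → Lasting m⁺ j → Lasting m j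
        lasting a l {m′} lt′ m⊴m′ with m′ C.≟ᶜ m
        ... | yes refl = a
        ... | no m′≢m = l lt′ (le (∈-allCells m′) lt′ (m⊴m′ , m′≢m))
        from-next : ∀ k → rank y₀ ℕ.< rank m ℕ.+ k → m ⊴ m⁺ → Traced m
        -- `k` bounds the steps left: ranks rise strictly along the chain and never exceed
        -- `rank y₀`.
        from-next ℕ.zero bound _ = ⊥-elim (ℕ.<⇒≱ (subst (rank y₀ ℕ.<_) (ℕ.+-identityʳ _) bound)
          (rank-≤ v v₀ (proj₁ (proj₂ (allowed ch lt)))))
        from-next (ℕ.suc k) bound ((z⁺≤z , sp) , f) with trace k lt⁺ (ℕ.<-≤-trans bound
            (ℕ.≤-trans (ℕ.≤-reflexive (ℕ.+-suc (rank m) k)) (ℕ.+-monoˡ-≤ k (rank-< v v⁺ m⊴m⁺ (m⁺≢m ∘ sym)))))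
        ... | gens , spans =
          (λ h∈ → let (g , g∈ , eq) = f h∈ ; (j , e , l) = gens g∈
                      eq′ = trans eq (trans (cong (_∨ᴸ proj₁ m) e) (∨-assoc-absorb z⁺≤z)) in
            j , eq′ , lasting (inj₂ (subst (_∈ proj₂ m) eq′ h∈)) l) ,
          (λ {u} z₀≤u ub →
            let z⁺≤u : proj₁ m⁺ ≤ᴸ u
                z⁺≤u = spans z₀≤u (λ l g≤ → ub (lasting (inj₁ (C.≤-trans g≤ z⁺≤z)) l) (C.≤-trans g≤ z⁺≤z))
            in sp z⁺≤u (λ h∈ h≤ → through {u} ub z⁺≤u h≤ (gens h∈)))
          where
          through : ∀ {u h} → (∀ {j} → Lasting m j → γ j ≤ᴸ proj₁ m → γ j ≤ᴸ u) → proj₁ m⁺ ≤ᴸ u → h ≤ᴸ proj₁ m →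
                    (∃ λ j → h ≡ γ j ∨ᴸ proj₁ m⁺ × Lasting m⁺ j) → h ≤ᴸ u
          through ub z⁺≤u h≤ (j , refl , l) = C.∨-least (ub (lasting (inj₁ g≤) l) g≤) z⁺≤u
            where g≤ = C.≤-trans (C.x≤x∨y _ _) h≤

      -- Signs survive summation. A coordinate not below `z` is nonpositive in every member, and one
      -- that is never deleted is nonnegative in every member, with the weight of `m` itself added
      -- if it is below `z`. By `trace`, the undeleted coordinates suffice to span `z` and to
      -- produce `H`.
      bottom-least : ∀ {m} → 0# < c m → (∀ {m′} → 0# < c m′ → m ⊴ m′) → bottom (comb c) ≡ m
      bottom-least {m@(z , H)} lt lowest = cong₂ _,_ z≡
          (trans (cong (λ z → Hᵇ x z) z≡) (subset-ext to from))
        where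
        x = comb c
        v = proj₁ (allowed ch lt)
        gens-spans = trace (ℕ.suc (rank y₀)) lt (ℕ.m≤n+m (ℕ.suc (rank y₀)) (rank m))
        summand-sign : ∀ {m′ j} (P : ℝ → Set) → (P (c m′ * 0#)) → (0# < c m′ → P (c m′ * s m′ j)) →
                       (∀ {a b} → a ≈ b → P a → P b) → P (c m′ * s m′ j)
        summand-sign {m′} {j} P base f resp with ≤⊎> (c m′) 0#
        ... | inj₂ p = f p
        ... | inj₁ q = resp (≈-trans (zeroʳ _) (≈-sym (≈-trans (*-congʳ (≤-antisym q (nonneg ch m′))) (zeroˡ _)))) base
        -- x j is a sum of nonpositive terms when γ j ≰ z …
        nonpos : ∀ {j} → ¬ γ j ≤ᴸ z → ∀ m′ → c m′ * s m′ j ≤ 0#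
        nonpos {j} g≰ m′ = summand-sign {m′} {j} (_≤ 0#) (≈⇒≤ (zeroʳ _))
          (λ p → ≤-resp ≈-refl (zeroʳ (c m′)) (*-monoˡ-≤ (nonneg ch m′)
             (sgn-≤0 (λ g≤ → g≰ (C.≤-trans g≤ (proj₁ (proj₁ (lowest p))))))))
          (λ e → ≤-resp e ≈-refl)
        -- … and of nonnegative terms when γ j is never deleted.
        nonneg′ : ∀ {j} → Lasting m j → ∀ m′ → 0# ≤ c m′ * s m′ j
        nonneg′ {j} l m′ = summand-sign {m′} {j} (0# ≤_) (≈⇒≤ (≈-sym (zeroʳ _)))
          (λ p → *-nonneg (nonneg ch m′) (sgn-≥0 (l p (lowest p))))
          (λ e → ≤-resp ≈-refl e)
        x≤0 : ∀ {j} → ¬ γ j ≤ᴸ z → x j ≤ 0#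
        x≤0 g≰ = ≤-trans (∑-mono allCells (λ {m′} _ → nonpos g≰ m′)) (≈⇒≤ (∑-zero allCells {λ _ → 0#} (λ _ → ≈-refl)))
        z≡ : zᵇ x ≡ z
        z≡ = C.antisym
          (zᵇ-least x (C.≤-trans (proj₁ (proj₁ (proj₁ (proj₂ (allowed ch lt))))) C.≤-refl) below)
          (proj₂ gens-spans (z₀≤zᵇ x) (λ {j} l g≤ → γ≤zᵇ x (∑-pos (λ _ → nonneg′ l _) (∈-allCells m)
             (0<-* lt (<-resp ≈-refl (≈-sym (sgn-below g≤)) 0<1)))))
          where
          below : ∀ {j} → 0# < x j → γ j ≤ᴸ z
          below {j} p with γ j ≤ᴸ? z
          ... | yes g≤ = g≤
          ... | no g≰  = ⊥-elim (<⇒≱ p (x≤0 g≰))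
        to : ∀ {k} → k ∈ Hᵇ x z → k ∈ H
        -- A vanishing sum of nonpositive terms has only vanishing terms, among them that of `m`.
        to k∈ with j , x≈0 , refl , g≰ ← ∈Hᵇ⁻ x z k∈ = sgn-0⇒kept (*-cancel-0 lt
          (≈-trans (solve 1 (λ a → a := :- (:- a)) ≈-refl _) (≈-trans (-‿cong
            (∑-zero-member {f = λ m′ → - (c m′ * s m′ j)} (λ {m′} _ → 0≤-neg (nonpos g≰ m′)) neg-sum (∈-allCells m)))
            (solve 0 (:- con (+ 0) := con (+ 0)) ≈-refl))))
          where
          neg-sum : ∑ allCells (λ m′ → - (c m′ * s m′ j)) ≈ 0#
          neg-sum = ≈-trans (∑-cong allCells (λ m′ → solve 1 (λ a → :- a := (:- con (+ 1)) :* a) ≈-refl (c m′ * s m′ j)))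
            (≈-trans (∑-*ˡ (- 1#) allCells _) (≈-trans (*-congˡ x≈0) (zeroʳ _)))
        from : ∀ {k} → k ∈ H → k ∈ Hᵇ x z
        from k∈ with j , refl , l ← proj₁ gens-spans k∈ =
          ∈Hᵇ⁺ x z j (≤-antisym (x≤0 g≰) (∑-nonneg allCells (λ {m′} _ → nonneg′ l m′))) g≰
          where
          g≰ : ¬ γ j ≤ᴸ z
          g≰ g≤ = proj₂ (v k∈) (C.antisym (C.∨-least g≤ C.≤-refl) (C.y≤x∨y _ _))

    open Uniqueness bottom-least public using () renaming (comb-injective to fan-injective)

    posᵇ : (Fin d → ℝ) → Subset d
    posᵇ x = ⟪ (λ j → em₀ (0# < x j)) ⟫

    -- Each peeling step either brings a positive coordinate to 0, or turns a deleted generator into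
    -- a kept one, which moves the bottom strictly up; in neither case does the other summand grow.
    μ : (Fin d → ℝ) → ℕ
    μ x = ∣ posᵇ x ∣ ℕ.+ (rank y₀ ℕ.∸ rank (bottom x))

    valid-bottom : ∀ x → Valid (bottom x)
    valid-bottom x k∈ with j , _ , refl , g≰ ← ∈Hᵇ⁻ x (zᵇ x) k∈ =
      C.y≤x∨y _ _ , λ e → g≰ (subst (_ ≤ᴸ_) e (C.x≤x∨y _ _))

    bottom-⊴ : ∀ x → bottom x ⊴ y₀
    bottom-⊴ x = zᵇ-spans x , λ k∈ → let (j , _ , e , _) = ∈Hᵇ⁻ x (zᵇ x) k∈ in γ j , γ-∈ j , e

    bottom≡y₀⇒zero : ∀ {x} → bottom x ≡ y₀ → ∀ j → x j ≈ 0#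
    bottom≡y₀⇒zero {x} eq j with ∈Hᵇ⁻ x (zᵇ x) (subst (γ j ∈_) (sym (cong proj₂ eq)) (γ-∈ j))
    ... | i , x≈0 , e , _ = subst (λ j → x j ≈ 0#) (sym (γ-injective (trans e
          (trans (cong (γ i ∨ᴸ_) (cong proj₁ eq)) (∨-absorb (proj₁ (v₀ (γ-∈ i)))))))) x≈0

    module Peel {x : Fin d → ℝ} (nonzero : ¬ (∀ j → x j ≈ 0#)) where

      m = bottom x
      z = proj₁ m
      H = proj₂ m

      -- The coordinates that move towards 0 when a multiple of s m is subtracted.
      Moving : Fin d → Set
      Moving j = 0# < x j ⊎ (x j < 0# × ¬ γ j ≤ᴸ z × γ j ∨ᴸ z ∉ H)

      size-of : Fin d → ℝ
      size-of j with em₀ (0# < x j)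
      ... | yes _ = x j
      ... | no _  = - x j

      some-moving : ∃ Moving
      some-moving with em₀ (∃ λ j → 0# < x j)
      ... | yes (j , p) = j , inj₁ p
      -- Without positive coordinates `z` is `z₀` and translation is trivial, so a negative
      -- coordinate belongs to a deleted generator.
      ... | no none = negative (em₀ (∃ λ j → x j < 0#))
        where
        z≡ : z ≡ z₀
        z≡ = C.antisym (zᵇ-least x C.≤-refl (λ p → ⊥-elim (none (_ , p)))) (z₀≤zᵇ x)
        negative : Dec (∃ λ j → x j < 0#) → ∃ Moving
        negative (no ¬neg) = ⊥-elim (nonzero (λ j → ≤-antisym (≮⇒≥ (λ p → none (j , p))) (≮⇒≥ (λ p → ¬neg (j , p)))))
        negative (yes (j , p)) = j , inj₂ (p , (λ g≤ → γ≰z₀ j (subst (γ j ≤ᴸ_) z≡ g≤)) , λ k∈ →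
          let (i , x≈0 , e , _) = ∈Hᵇ⁻ x z k∈ in
          proj₂ p (subst (λ j → x j ≈ 0#) (sym (γ-injective (begin-eq i e))) x≈0))
          where
          begin-eq : ∀ i → γ j ∨ᴸ z ≡ γ i ∨ᴸ z → γ j ≡ γ i
          begin-eq i e = trans (sym (absorb j)) (trans e (absorb i))
            where
            absorb : ∀ j → γ j ∨ᴸ z ≡ γ j
            absorb j = ∨-absorb (subst (_≤ᴸ γ j) (sym z≡) (proj₁ (v₀ (γ-∈ j))))

      -- The smallest absolute value is the largest multiple that can be subtracted before some
      -- moving coordinate changes sign.
      smallest = argmin (allFin d) Moving size-of (∈-allFin (proj₁ some-moving)) (proj₂ some-moving)

      j₀ = proj₁ smallest
      k = size-of j₀

      size-pos : ∀ {j} → Moving j → 0# < size-of j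
      size-pos {j} mv with em₀ (0# < x j)
      ... | yes p = p
      ... | no ¬p = Sum.[ ⊥-elim ∘ ¬p , (λ (q , _) → 0<-neg q) ] mv

      k>0 : 0# < k
      k>0 = size-pos (proj₁ (proj₂ smallest))

      k≤ : ∀ {j} → Moving j → k ≤ size-of j
      k≤ mv = proj₂ (proj₂ smallest) (∈-allFin _) mv

      x′ : Fin d → ℝ
      x′ j = x j - k * s m j

      k≤x : ∀ {j} → 0# < x j → k ≤ x j
      k≤x {j} p with em₀ (0# < x j) | k≤ {j} (inj₁ p)
      ... | yes _ | le = le
      ... | no ¬p | _  = ⊥-elim (¬p p)

      k≤-x : ∀ {j} → x j < 0# → ¬ γ j ≤ᴸ z → γ j ∨ᴸ z ∉ H → k ≤ - x j
      k≤-x {j} p g≰ g∉ with em₀ (0# < x j) | k≤ {j} (inj₂ (p , g≰ , g∉))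
      ... | yes q | _  = ⊥-elim (<⇒≱ q (<⇒≤ p))
      ... | no _  | le = le

      x′-below : ∀ {j} → γ j ≤ᴸ z → x′ j ≈ x j - k
      x′-below g≤ = +-congˡ (-‿cong (≈-trans (*-congˡ (sgn-below g≤)) (*-identityʳ k)))

      x′-kept : ∀ {j} → ¬ γ j ≤ᴸ z → γ j ∨ᴸ z ∈ H → x′ j ≈ x j
      x′-kept g≰ g∈ = ≈-trans (+-congˡ (-‿cong (≈-trans (*-congˡ (sgn-kept g≰ g∈)) (zeroʳ k))))
        (solve 1 (λ a → a :- con (+ 0) := a) ≈-refl _)

      x′-deleted : ∀ {j} → ¬ γ j ≤ᴸ z → γ j ∨ᴸ z ∉ H → x′ j ≈ x j + k
      x′-deleted {j} g≰ g∉ = ≈-trans (+-congˡ (-‿cong (*-congˡ (sgn-deleted g≰ g∉))))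
        (solve 2 (λ a k → a :- k :* (:- con (+ 1)) := a :+ k) ≈-refl (x j) k)

      x≤0 : ∀ {j} → ¬ γ j ≤ᴸ z → x j ≤ 0#
      x≤0 g≰ = ≮⇒≥ (λ p → g≰ (γ≤zᵇ x p))

      deleted-neg : ∀ {j} → ¬ γ j ≤ᴸ z → γ j ∨ᴸ z ∉ H → x j < 0#
      deleted-neg {j} g≰ g∉ = x≤0 g≰ , λ x≈0 → g∉ (∈Hᵇ⁺ x z j x≈0 g≰)

      pos-shrinks : ∀ {j} → 0# < x′ j → 0# < x j
      pos-shrinks {j} p with γ j ≤ᴸ? z | γ j ∨ᴸ z ∈? H
      ... | yes g≤ | _ = <-trans k>0 (0<⇒< (<-resp ≈-refl (x′-below g≤) p))
      ... | no g≰ | yes g∈ = <-resp ≈-refl (x′-kept g≰ g∈) p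
      ... | no g≰ | no g∉ = ⊥-elim (<⇒≱ p (≤-resp (≈-sym (x′-deleted g≰ g∉)) ≈-refl
            (0≤⇒≤ (≤-resp ≈-refl (solve 2 (λ a k → (:- a) :- k := con (+ 0) :- (a :+ k)) ≈-refl (x j) k)
              (≤⇒0≤ (k≤-x (deleted-neg g≰ g∉) g≰ g∉))))))

      x′≥0 : ∀ {j} → 0# < x j → 0# ≤ x′ j
      x′≥0 {j} p = ≤-resp ≈-refl (≈-sym (x′-below (γ≤zᵇ x p))) (≤⇒0≤ (k≤x p))

      z′≤z : zᵇ x′ ≤ᴸ z
      z′≤z = zᵇ-least x′ (z₀≤zᵇ x) (γ≤zᵇ x ∘ pos-shrinks)

      -- A positive coordinate that has dropped to 0 is below the new minimum or belongs to a
      -- generator kept there, so the old minimum is still spanned. Coordinates of generators in `H`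
      -- do not change and stay kept.
      m⊴m′ : m ⊴ bottom x′
      m⊴m′ = (z′≤z , λ z′≤u ub → zᵇ-least x (C.≤-trans (z₀≤zᵇ x′) z′≤u) (λ {j} p → bounded z′≤u ub p)) ,
        λ h∈ → kept h∈
        where
        bounded : ∀ {u j} → zᵇ x′ ≤ᴸ u → (∀ {h} → h ∈ proj₂ (bottom x′) → h ≤ᴸ z → h ≤ᴸ u) → 0# < x j → γ j ≤ᴸ u
        bounded {u} {j} z′≤u ub p with γ j ≤ᴸ? zᵇ x′
        ... | yes g≤ = C.≤-trans g≤ z′≤u
        ... | no g≰  = C.≤-trans (C.x≤x∨y _ _) (ub (∈Hᵇ⁺ x′ (zᵇ x′) j x′≈0 g≰) (C.∨-least (γ≤zᵇ x p) z′≤z))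
          where
          x′≈0 : x′ j ≈ 0#
          x′≈0 = ≤-antisym (≮⇒≥ (λ q → g≰ (γ≤zᵇ x′ q))) (x′≥0 p)
        kept : ∀ {h} → h ∈ H → ∃ λ g → g ∈ proj₂ (bottom x′) × h ≡ g ∨ᴸ z
        kept {h} h∈ with ∈Hᵇ⁻ x z h∈
        ... | j , x≈0 , h≡ , g≰ = γ j ∨ᴸ zᵇ x′ ,
              ∈Hᵇ⁺ x′ (zᵇ x′) j (≈-trans (x′-kept g≰ (subst (_∈ H) h≡ h∈)) x≈0) (λ g≤ → g≰ (C.≤-trans g≤ z′≤z)) ,
              trans h≡ (sym (∨-assoc-absorb z′≤z))

      A-m : A m
      A-m = valid-bottom x , bottom-⊴ x , nonzero ∘ bottom≡y₀⇒zero

      rank-m≤ : rank m ℕ.≤ rank (bottom x′)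
      rank-m≤ = rank-≤ (valid-bottom x) (valid-bottom x′) m⊴m′

      pos⊆ : posᵇ x′ ⊆ posᵇ x
      pos⊆ j∈ = ∈⟪⟫⁺ (λ j → em₀ (0# < x j)) (pos-shrinks (∈⟪⟫⁻ (λ j → em₀ (0# < x′ j)) j∈))

      size-attained : ∀ {j} → 0# < x j → size-of j ≈ x j
      size-attained {j} p with em₀ (0# < x j)
      ... | yes _ = ≈-refl
      ... | no ¬p = ⊥-elim (¬p p)

      size-attained⁻ : ∀ {j} → x j < 0# → size-of j ≈ - x j
      size-attained⁻ {j} q with em₀ (0# < x j)
      ... | yes p = ⊥-elim (<⇒≱ p (<⇒≤ q))
      ... | no _  = ≈-refl

      μ-decreases : μ x′ ℕ.< μ x
      μ-decreases with proj₁ (proj₂ smallest)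
      ... | inj₁ p = ℕ.+-mono-<-≤
              (p⊂q⇒∣p∣<∣q∣ (pos⊆ , j₀ , ∈⟪⟫⁺ (λ j → em₀ (0# < x j)) p ,
                λ j∈ → proj₂ (∈⟪⟫⁻ (λ j → em₀ (0# < x′ j)) j∈) (≈-sym x′≈0)))
              (ℕ.∸-monoʳ-≤ (rank y₀) rank-m≤)
        where
        x′≈0 : x′ j₀ ≈ 0#
        x′≈0 = ≈-trans (x′-below (γ≤zᵇ x p)) (x≈y⇒x-y≈0 (≈-sym (size-attained p)))
      ... | inj₂ (q , g≰ , g∉) = ℕ.+-mono-≤-< (p⊆q⇒∣p∣≤∣q∣ pos⊆)
              (ℕ.∸-monoʳ-< (rank-< (valid-bottom x) (valid-bottom x′) m⊴m′ m≢m′)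
                (rank-≤ (valid-bottom x′) v₀ (bottom-⊴ x′)))
        where
        x′≈0 : x′ j₀ ≈ 0#
        x′≈0 = ≈-trans (x′-deleted g≰ g∉) (≈-trans (+-congˡ (size-attained⁻ q)) (-‿inverseʳ _))
        m≢m′ : m ≢ bottom x′
        m≢m′ eq = g∉ (subst₂ (λ z H → γ j₀ ∨ᴸ z ∈ H) (sym (cong proj₁ eq)) (sym (cong proj₂ eq))
          (∈Hᵇ⁺ x′ (zᵇ x′) j₀ x′≈0 (λ g≤ → g≰ (C.≤-trans g≤ z′≤z))))

    -- Every vector can be peeled, so the invariant of the induction is the trivial `z₀ ≡ z₀`; this
    -- makes the fan complete.
    peel : ∀ {x} → z₀ ≡ z₀ → ¬ (∀ j → x j ≈ 0#) →
      A (bottom x) × ∃ λ k → 0# < k × z₀ ≡ z₀ × bottom x ⊴ bottom (λ j → x j - k * s (bottom x) j) ×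
      μ (λ j → x j - k * s (bottom x) j) ℕ.< μ x
    peel _ nz = A-m , k , k>0 , refl , m⊴m′ , μ-decreases
      where open Peel nz

    open Existence (λ _ → z₀ ≡ z₀) μ peel

    fan-surjective : ∀ x → ∃ λ c → Ch c × comb c ≋ x
    fan-surjective x = decompose refl

-- Compactness and the closed graph theorem.

module Compactness (em : ExcludedMiddle (suc 0ℓ)) (real : CompleteOrderedField) where

  open RealLemmas em real
  open Peeling em real using (_≋_)
  open Topology real using (Near; euclidean)

  Close : ℝ → ℝ → ℝ → Set
  Close ε x y = x - y < ε × y - x < ε

  abstract

    close-sym : ∀ {ε x y} → Close ε x y → Close ε y x
    close-sym (p , q) = q , p

    close-resp : ∀ {ε x y x′ y′} → x ≈ x′ → y ≈ y′ → Close ε x y → Close ε x′ y′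
    close-resp p q (l , r) = <-resp (+-cong p (-‿cong q)) ≈-refl l , <-resp (+-cong q (-‿cong p)) ≈-refl r

    close-≈ : ∀ {ε x y} → 0# < ε → x ≈ y → Close ε x y
    close-≈ p eq = <-resp (≈-sym (x≈y⇒x-y≈0 eq)) ≈-refl p , <-resp (≈-sym (x≈y⇒x-y≈0 (≈-sym eq))) ≈-refl p

    close-≤ : ∀ {ε ε′ x y} → ε ≤ ε′ → Close ε x y → Close ε′ x y
    close-≤ le (p , q) = <-≤-trans p le , <-≤-trans q le

    half-of : ∀ {ε} → 0# < ε → ∃ λ h → 0# < h × h + h ≈ ε
    half-of {ε} p with half
    ... | h , q , eq = h * ε , 0<-* q p , ≈-trans (≈-sym (distribʳ ε h h)) (≈-trans (*-congʳ eq) (*-identityˡ ε))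

    <-+ : ∀ {a b c d} → a < b → c < d → a + c < b + d
    <-+ {a} {b} {c} {d} p q = 0<⇒< (<-resp ≈-refl
      (solve 4 (λ a b c d → (b :- a) :+ (d :- c) := (b :+ d) :- (a :+ c)) ≈-refl a b c d)
      (0<-+ˡ (<⇒0< p) (<⇒≤ (<⇒0< q))))

    close-trans : ∀ {ε h x y z} → h + h ≈ ε → Close h x y → Close h y z → Close ε x z
    close-trans {x = x} {y} {z} eq (p , q) (p′ , q′) =
      <-resp (solve 3 (λ x y z → (x :- y) :+ (y :- z) := x :- z) ≈-refl x y z) eq (<-+ p p′) ,
      <-resp (solve 3 (λ x y z → (y :- x) :+ (z :- y) := z :- x) ≈-refl x y z) eq (<-+ q q′)

    close-+ : ∀ {ε h x y x′ y′} → h + h ≈ ε → Close h x y → Close h x′ y′ → Close ε (x + x′) (y + y′)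
    close-+ {x = x} {y} {x′} {y′} eq (p , q) (p′ , q′) =
      <-resp (solve 4 (λ x y x′ y′ → (x :- y) :+ (x′ :- y′) := (x :+ x′) :- (y :+ y′)) ≈-refl x y x′ y′) eq (<-+ p p′) ,
      <-resp (solve 4 (λ x y x′ y′ → (y :- x) :+ (y′ :- x′) := (y :+ y′) :- (x :+ x′)) ≈-refl x y x′ y′) eq (<-+ q q′)

    smaller : ∀ {δ δ′} → 0# < δ → 0# < δ′ → ∃ λ ε → 0# < ε × ε ≤ δ × ε ≤ δ′
    smaller {δ} {δ′} p q with ≤.total δ δ′
    ... | inj₁ le = δ , p , ≤-refl , le
    ... | inj₂ le = δ′ , q , le , ≤-refl

    bound : ∀ x → ∃ λ M → 0# < M × Close M x 0#
    bound x with ≤⊎> 0# x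
    ... | inj₁ p = x + 1# , 0<-+ʳ p 0<1 ,
          0<⇒< (<-resp ≈-refl (solve 1 (λ x → con (+ 1) := (x :+ con (+ 1)) :- (x :- con (+ 0))) ≈-refl x) 0<1) ,
          0<⇒< (<-resp ≈-refl (solve 1 (λ x → (x :+ x) :+ con (+ 1) := (x :+ con (+ 1)) :- (con (+ 0) :- x)) ≈-refl x)
            (0<-+ʳ (0≤-+ p p) 0<1))
    ... | inj₂ p = - x + 1# , 0<-+ˡ (0<-neg p) (<⇒≤ 0<1) ,
          0<⇒< (<-resp ≈-refl (solve 1 (λ x → ((:- x) :+ (:- x)) :+ con (+ 1) := ((:- x) :+ con (+ 1)) :- (x :- con (+ 0))) ≈-refl x)
            (0<-+ʳ (0≤-+ (0≤-neg (<⇒≤ p)) (0≤-neg (<⇒≤ p))) 0<1)) ,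
          0<⇒< (<-resp ≈-refl (solve 1 (λ x → con (+ 1) := ((:- x) :+ con (+ 1)) :- (con (+ 0) :- x)) ≈-refl x) 0<1)

    close-0⇒ : ∀ {M x} → Close M x 0# → 0# < M - x × 0# < M + x
    close-0⇒ {M} {x} (p , q) =
      <-resp ≈-refl (solve 2 (λ M x → M :- (x :- con (+ 0)) := M :- x) ≈-refl M x) (<⇒0< p) ,
      <-resp ≈-refl (solve 2 (λ M x → M :- (con (+ 0) :- x) := M :+ x) ≈-refl M x) (<⇒0< q)

    -- 2(Mη − uv) = (M − u)(η + v) + (M + u)(η − v)
    product-bound : ∀ {M η u v} → Close M u 0# → Close η v 0# → Close (M * η) (u * v) 0#
    product-bound {M} {η} {u} {v} p q =
      0<⇒< (<-resp ≈-refl (solve 3 (λ M η w → M :* η :- w := M :* η :- (w :- con (+ 0))) ≈-refl M η (u * v))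
        (halve (<-resp ≈-refl (solve 4 (λ M η u v → (M :- u) :* (η :+ v) :+ (M :+ u) :* (η :- v) :=
          (M :* η :- u :* v) :+ (M :* η :- u :* v)) ≈-refl M η u v)
          (0<-+ˡ (0<-* M-u η+v) (<⇒≤ (0<-* M+u η-v)))))) ,
      0<⇒< (<-resp ≈-refl (solve 3 (λ M η w → M :* η :+ w := M :* η :- (con (+ 0) :- w)) ≈-refl M η (u * v))
        (halve (<-resp ≈-refl (solve 4 (λ M η u v → (M :- u) :* (η :- v) :+ (M :+ u) :* (η :+ v) :=
          (M :* η :+ u :* v) :+ (M :* η :+ u :* v)) ≈-refl M η u v)
          (0<-+ˡ (0<-* M-u η-v) (<⇒≤ (0<-* M+u η+v))))))
      where
      M-u : 0# < M - u
      M-u = proj₁ (close-0⇒ p)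
      M+u : 0# < M + u
      M+u = proj₂ (close-0⇒ p)
      η-v : 0# < η - v
      η-v = proj₁ (close-0⇒ q)
      η+v : 0# < η + v
      η+v = proj₂ (close-0⇒ q)
      halve : ∀ {x} → 0# < x + x → 0# < x
      halve {x} p = ≰⇒> (λ le → <⇒≱ p (≤-resp ≈-refl (+-identityˡ 0#) (+-mono-≤ le le)))

    close-diff : ∀ {ε x y} → Close ε x y → Close ε (x - y) 0#
    close-diff {ε} {x} {y} (p , q) =
      <-resp (solve 2 (λ x y → x :- y := (x :- y) :- con (+ 0)) ≈-refl x y) ≈-refl p ,
      <-resp (solve 2 (λ x y → y :- x := con (+ 0) :- (x :- y)) ≈-refl x y) ≈-refl q

    undiff : ∀ {ε x y} → Close ε (x - y) 0# → Close ε x y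
    undiff {ε} {x} {y} (p , q) =
      <-resp (solve 2 (λ x y → (x :- y) :- con (+ 0) := x :- y) ≈-refl x y) ≈-refl p ,
      <-resp (solve 2 (λ x y → con (+ 0) :- (x :- y) := y :- x) ≈-refl x y) ≈-refl q

    close-widen : ∀ {M x y} → Close M x 0# → Close 1# x y → Close (M + 1#) y 0#
    close-widen {M} {x} {y} (p , q) (p′ , q′) =
      <-resp (solve 2 (λ x y → (x :- con (+ 0)) :+ (y :- x) := y :- con (+ 0)) ≈-refl x y) ≈-refl (<-+ p q′) ,
      <-resp (solve 2 (λ x y → (con (+ 0) :- x) :+ (x :- y) := con (+ 0) :- y) ≈-refl x y) ≈-refl (<-+ q p′)

    near-≤ : ∀ {I : Set} {δ δ′} {p q : I → ℝ} → δ ≤ δ′ → Near δ p q → Near δ′ p q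
    near-≤ le n i = close-≤ le (n i)

  module _ {I : Set} where

    Contℝ : ((I → ℝ) → ℝ) → Set
    Contℝ F = ∀ p {ε} → 0# < ε → ∃ λ δ → 0# < δ × (∀ {q} → Near δ p q → Close ε (F p) (F q))

    abstract

      cont-coord : ∀ i → Contℝ (λ p → p i)
      cont-coord i p {ε} ε>0 = ε , ε>0 , λ n → n i

      cont-const : ∀ k → Contℝ (λ _ → k)
      cont-const k p {ε} ε>0 = ε , ε>0 , λ _ → close-≈ ε>0 ≈-refl

      cont-cong : ∀ {F G} → (∀ p → F p ≈ G p) → Contℝ F → Contℝ G
      cont-cong eq cF p ε>0 = let (δ , δ>0 , near) = cF p ε>0 in
        δ , δ>0 , λ n → close-resp (eq _) (eq _) (near n)

      cont-+ : ∀ {F G} → Contℝ F → Contℝ G → Contℝ (λ p → F p + G p)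
      cont-+ cF cG p ε>0 with half-of ε>0
      ... | h , h>0 , h+h with cF p h>0 | cG p h>0
      ... | δ , δ>0 , near | δ′ , δ′>0 , near′ with smaller δ>0 δ′>0
      ... | η , η>0 , η≤δ , η≤δ′ = η , η>0 , λ n → close-+ h+h (near (near-≤ η≤δ n)) (near′ (near-≤ η≤δ′ n))

      cont-* : ∀ {F G} → Contℝ F → Contℝ G → Contℝ (λ p → F p * G p)
      cont-* {F} {G} cF cG p {ε} ε>0 with half-of ε>0
      ... | h , h>0 , h+h with bound (F p) | bound (G p)
      ... | M , M>0 , Fp<M | M′ , M′>0 , Gp<M′ with inv⁺ M>0 | inv⁺ (0<-+ˡ M′>0 (<⇒≤ 0<1))
      ... | i , i>0 , Mi≈1 | i′ , i′>0 , Mi′≈1 with cF p (0<-* i′>0 h>0) | cG p (0<-* i>0 h>0) | cG p 0<1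
      ... | δ₁ , p₁ , near₁ | δ₂ , p₂ , near₂ | δ₃ , p₃ , near₃ with smaller p₁ p₂
      ... | δ₄ , p₄ , le₁ , le₂ with smaller p₄ p₃
      ... | δ , δ>0 , le₄ , le₃ = δ , δ>0 , λ {q} n → undiff (close-resp
              (solve 4 (λ a b a′ b′ → a :* (b :- b′) :+ b′ :* (a :- a′) := a :* b :- a′ :* b′) ≈-refl (F p) (G p) (F q) (G q))
              (+-identityˡ 0#)
              (close-+ h+h
                (close-≤ (≈⇒≤ (cancel Mi≈1)) (product-bound Fp<M (close-diff (near₂ (near-≤ (≤-trans le₄ le₂) n)))))
                (close-≤ (≈⇒≤ (cancel Mi′≈1)) (product-bound (close-widen Gp<M′ (near₃ (near-≤ le₃ n)))
                  (close-diff (near₁ (near-≤ (≤-trans le₄ le₁) n)))))))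
        where
        cancel : ∀ {M i} → M * i ≈ 1# → M * (i * h) ≈ h
        cancel eq = ≈-trans (≈-sym (*-assoc _ _ _)) (≈-trans (*-congʳ eq) (*-identityˡ h))

      cont-neg : ∀ {F} → Contℝ F → Contℝ (λ p → - F p)
      cont-neg {F} cF = cont-cong (λ p → solve 1 (λ a → (:- con (+ 1)) :* a := :- a) ≈-refl (F p))
                          (cont-* (cont-const (- 1#)) cF)

      cont-- : ∀ {F G} → Contℝ F → Contℝ G → Contℝ (λ p → F p - G p)
      cont-- cF cG = cont-+ cF (cont-neg cG)

      cont-∑ : ∀ {A : Set} (xs : List A) {F : A → (I → ℝ) → ℝ} → (∀ x → Contℝ (F x)) →
               Contℝ (λ p → ∑ xs (λ x → F x p))
      cont-∑ []       cF = cont-const 0#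
      cont-∑ (x ∷ xs) cF = cont-+ (cF x) (cont-∑ xs cF)

    Limit : (I → ℝ) → ((I → ℝ) → Set) → Set
    Limit r S = ∀ {ε} → 0# < ε → ∃ λ p → S p × Near ε r p

    abstract

      limit-≥0 : ∀ {F r S} → Contℝ F → Limit r S → (∀ {p} → S p → 0# ≤ F p) → 0# ≤ F r
      limit-≥0 {F} {r} cF lim nn = ≮⇒≥ λ neg →
        let (δ , δ>0 , near) = cF r (0<-neg neg) ; (p , sp , n) = lim δ>0 in
        <⇒≱ (proj₂ (near n)) (≤-resp (+-identityˡ _) ≈-refl (+-mono-≤ (nn sp) ≤-refl))

      limit-≈0 : ∀ {F r S} → Contℝ F → Limit r S → (∀ {p} → S p → F p ≈ 0#) → F r ≈ 0#
      limit-≈0 {F} cF lim z = ≤-antisym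
        (0≤⇒≤ (≤-resp ≈-refl (solve 1 (λ a → :- a := con (+ 0) :- a) ≈-refl _)
          (limit-≥0 (cont-neg cF) lim (λ sp → 0≤-neg (≈⇒≤ (z sp))))))
        (limit-≥0 cF lim (λ sp → ≈⇒≤ (≈-sym (z sp))))

  -- A filter base indexed by the positive reals, in place of a sequence: cluster points are then
  -- found without choosing subsequences.
  record Family (X : Set) : Set₁ where
    field
      S        : ℝ → X → Set
      monotone : ∀ {ε ε′ x} → ε ≤ ε′ → S ε x → S ε′ x
      nonempty : ∀ {ε} → 0# < ε → ∃ (S ε)

  open Family

  abstract

    -- The limit inferior of f along the family is a cluster value.
    cluster-value : ∀ {X} (𝓢 : Family X) (f : X → ℝ) {lo hi} → (∀ x → lo ≤ f x) → (∀ x → f x ≤ hi) →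
                    ∃ λ r → ∀ {ε} → 0# < ε → ∃ λ x → S 𝓢 ε x × Close ε r (f x)
    cluster-value {X} 𝓢 f {lo} {hi} lo≤ ≤hi = r , cluster
      where
      Q : ℝ → Set
      Q q = ∃ λ ε → 0# < ε × (∀ {x} → S 𝓢 ε x → q ≤ f x)
      sup : ∃ λ s → UpperBound Q s × (∀ {u} → UpperBound Q u → s ≤ u)
      sup = supremum Q (lo , 1# , 0<1 , λ {x} _ → lo≤ x)
              (hi , λ { (ε , ε>0 , le) → let (x , sx) = nonempty 𝓢 ε>0 in ≤-trans (le sx) (≤hi x) })
      r : ℝ
      r = proj₁ sup
      cluster : ∀ {ε} → 0# < ε → ∃ λ x → S 𝓢 ε x × Close ε r (f x)
      cluster {ε} ε>0 with em₀ (∃ λ q → Q q × r - ε < q)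
      ... | no none = ⊥-elim (<⇒≱ (0<⇒< (<-resp ≈-refl (solve 2 (λ r e → e := r :- (r :- e)) ≈-refl r ε) ε>0))
                        (proj₂ (proj₂ sup) (λ {q} qq → ≮⇒≥ (λ lt → none (q , qq , lt)))))
      ... | yes (q , (ε′ , ε′>0 , le) , lt) with smaller ε>0 ε′>0
      ... | η , η>0 , η≤ε , η≤ε′ with em₀ (∃ λ x → S 𝓢 η x × f x < r + ε)
      ... | yes (x , sx , fx<) = x , monotone 𝓢 η≤ε sx ,
            0<⇒< (<-resp ≈-refl (solve 3 (λ r e y → y :- (r :- e) := e :- (r :- y)) ≈-refl r ε (f x))
              (<⇒0< (<-≤-trans lt (le (monotone 𝓢 η≤ε′ sx))))) ,
            0<⇒< (<-resp ≈-refl (solve 3 (λ r e y → (r :+ e) :- y := e :- (y :- r)) ≈-refl r ε (f x)) (<⇒0< fx<))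
      -- Otherwise `r + ε` would be an eventual lower bound of `f`, above the supremum of all of
      -- them.
      ... | no none = ⊥-elim (<⇒≱ (0<⇒< (<-resp ≈-refl (solve 2 (λ r e → e := (r :+ e) :- r) ≈-refl r ε) ε>0))
                        (proj₁ (proj₂ sup) (η , η>0 , λ {x} sx → ≮⇒≥ (λ fx< → none (x , sx , fx<)))))

    -- One coordinate at a time: closeness in the coordinates already treated is built into the
    -- family for the next one, as when subsequences are refined.
    cluster-vector : ∀ {X I : Set} (𝓢 : Family X) (c : X → I → ℝ) {lo hi} →
      (∀ x i → lo ≤ c x i) → (∀ x i → c x i ≤ hi) → ∀ (is : List I) →
      Σ (I → ℝ) λ r → ∀ {ε} → 0# < ε → ∃ λ x → S 𝓢 ε x × (∀ {i} → i List.∈ is → Close ε (r i) (c x i))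
    cluster-vector 𝓢 c lo≤ ≤hi [] = (λ _ → 0#) , λ ε>0 → let (x , sx) = nonempty 𝓢 ε>0 in x , sx , λ ()
    cluster-vector {X} {I} 𝓢 c lo≤ ≤hi (i ∷ is) with cluster-vector 𝓢 c lo≤ ≤hi is
    ... | r , near with cluster-value 𝓢′ (λ x → c x i) (λ x → lo≤ x i) (λ x → ≤hi x i)
      where
      𝓢′ : Family X
      𝓢′ = record
        { S        = λ ε x → S 𝓢 ε x × (∀ {i} → i List.∈ is → Close ε (r i) (c x i))
        ; monotone = λ le (sx , n) → monotone 𝓢 le sx , λ i∈ → close-≤ le (n i∈)
        ; nonempty = near
        }
    ... | rᵢ , nearᵢ = r′ , λ {ε} ε>0 → let (x , (sx , n) , nᵢ) = nearᵢ ε>0 in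
            x , sx , λ {k} k∈ → combine {ε} {x} {k} (em₀ (k ≡ i)) k∈ n nᵢ
      where
      pick : ∀ {k} → Dec (k ≡ i) → ℝ
      pick {_} (yes _) = rᵢ
      pick {k} (no _)  = r k
      r′ : I → ℝ
      r′ k = pick {k} (em₀ (k ≡ i))
      combine : ∀ {ε x k} (d : Dec (k ≡ i)) → k List.∈ (i ∷ is) → (∀ {i} → i List.∈ is → Close ε (r i) (c x i)) →
                Close ε rᵢ (c x i) → Close ε (pick {k} d) (c x k)
      combine (yes refl) _ _ nᵢ = nᵢ
      combine (no k≢i) (here eq) _ _ = ⊥-elim (k≢i eq)
      combine (no _) (there k∈) n _ = n k∈

  Compact : ∀ {X I : Set} → (X → I → ℝ) → Set₁
  Compact {X} c = ∀ (𝓢 : Family X) → ∃ λ x → ∀ {ε} → 0# < ε → ∃ λ y → S 𝓢 ε y × Near ε (c x) (c y)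

  abstract

    bounded∧closed⇒compact : ∀ {X I : Set} (c : X → I → ℝ) {lo hi} (is : List I) → (∀ i → i List.∈ is) →
      (∀ x i → lo ≤ c x i) → (∀ x i → c x i ≤ hi) →
      (∀ {r} → Limit r (λ p → ∃ λ x → p ≋ c x) → ∃ λ x → c x ≋ r) → Compact c
    bounded∧closed⇒compact c is complete lo≤ ≤hi closed 𝓢 with cluster-vector 𝓢 c lo≤ ≤hi is
    ... | r , near with closed {r} (λ ε>0 → let (x , _ , n) = near ε>0 in
                          c x , (x , λ _ → ≈-refl) , λ i → n (complete i))
    ... | x , eq = x , λ ε>0 → let (y , sy , n) = near ε>0 in
            y , sy , λ i → close-resp (≈-sym (eq i)) ≈-refl (n (complete i))

  module _ {X Y I J : Set} (cX : X → I → ℝ) (cY : Y → J → ℝ) where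

    ClosedGraph : (X → Y) → Set
    ClosedGraph f = ∀ {x y} → (∀ {ε} → 0# < ε → ∃ λ x′ → Near ε (cX x) (cX x′) × Near ε (cY y) (cY (f x′))) →
                    cY (f x) ≋ cY y

    ContMap : (X → Y) → Set
    ContMap f = ∀ x {ε} → 0# < ε → ∃ λ δ → 0# < δ × (∀ {x′} → Near δ (cX x) (cX x′) → Near ε (cY (f x)) (cY (f x′)))

    abstract

      contMap⇒continuous : ∀ {f} → ContMap f → Continuous (euclidean cX) (euclidean cY) f
      contMap⇒continuous {f} cf V open-V {x} Vfx =
        let (ε , ε>0 , inV) = open-V Vfx ; (δ , δ>0 , near) = cf x ε>0 in δ , δ>0 , inV ∘ near

      -- If continuity failed at `x`, the values that stay away from `f x` although taken near `x`
      -- would form a family. A cluster point of it lies over `x` in the closure of the graph, hence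
      -- equals `f x`, yet the values keep their distance.
      closedGraph⇒contMap : Compact cY → ∀ {f} → ClosedGraph f → ContMap f
      closedGraph⇒contMap compact {f} closed x {ε} ε>0
        with em₀ (∃ λ δ → 0# < δ × (∀ {x′} → Near δ (cX x) (cX x′) → Near ε (cY (f x)) (cY (f x′))))
      ... | yes ok = ok
      ... | no bad with compact 𝓢
        where
        𝓢 : Family Y
        𝓢 = record
          { S        = λ δ y → ∃ λ x′ → Near δ (cX x) (cX x′) × y ≡ f x′ × ¬ Near ε (cY (f x)) (cY y)
          ; monotone = λ { le (x′ , n , eq , far) → x′ , near-≤ le n , eq , far }
          ; nonempty = λ {δ} δ>0 → witness (em₀ (∃ λ y → ∃ λ x′ → Near δ (cX x) (cX x′) × y ≡ f x′ × ¬ Near ε (cY (f x)) (cY y))) δ>0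
          }
          where
          witness : ∀ {δ} → Dec (∃ λ y → ∃ λ x′ → Near δ (cX x) (cX x′) × y ≡ f x′ × ¬ Near ε (cY (f x)) (cY y)) →
                    0# < δ → ∃ λ y → ∃ λ x′ → Near δ (cX x) (cX x′) × y ≡ f x′ × ¬ Near ε (cY (f x)) (cY y)
          witness (yes w) _   = w
          witness {δ} (no w) δ>0 = ⊥-elim (bad (δ , δ>0 , λ {x′} n → stable (em₀ _) (λ far → w (f x′ , x′ , n , refl , far))))
            where
            stable : ∀ {P : Set} → Dec P → ¬ ¬ P → P
            stable (yes p) _ = p
            stable (no ¬p) ¬¬p = ⊥-elim (¬¬p ¬p)
      ... | y , cluster = ⊥-elim (escape (cluster ε>0))
        where
        fx≋y : cY (f x) ≋ cY y
        fx≋y = closed (λ δ>0 → let (y′ , (x′ , n , eq , _) , n′) = cluster δ>0 in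
          x′ , n , subst (λ z → Near _ (cY y) (cY z)) eq n′)
        escape : ¬ (∃ λ y′ → (∃ λ x′ → Near ε (cX x) (cX x′) × y′ ≡ f x′ × ¬ Near ε (cY (f x)) (cY y′)) × Near ε (cY y) (cY y′))
        escape (y′ , (_ , _ , _ , far) , n) = far (λ j → close-resp (≈-sym (fx≋y j)) ≈-refl (n j))

  abstract

    near-limit : ∀ {x y} → (∀ {ε} → 0# < ε → Close ε x y) → x ≈ y
    near-limit {x} {y} close = ≤-antisym (le close) (le (λ p → close-sym (close p)))
      where
      le : ∀ {x y} → (∀ {ε} → 0# < ε → Close ε x y) → x ≤ y
      le {x} {y} close = ≮⇒≥ (λ y<x → <⇒≱ (proj₁ (close (<⇒0< y<x))) ≤-refl)

  module _ {X Y I J : Set} (cX : X → I → ℝ) (cY : Y → J → ℝ) where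

    abstract

      -- The inverse on the image is the identity of `X`, with the coordinates pulled back along `f`
      -- on the source. Its graph is closed because `f` is continuous and injective, so the closed
      -- graph theorem applies.
      compact-injection : Compact cX → ∀ {f : X → Y} → ContMap cX cY f →
        (∀ {x x′} → cY (f x) ≋ cY (f x′) → cX x ≋ cX x′) →
        ∀ x {ε} → 0# < ε → ∃ λ δ → 0# < δ × (∀ {x′} → Near δ (cY (f x)) (cY (f x′)) → Near ε (cX x) (cX x′))
      compact-injection compact {f} cf injective x ε>0 =
        closedGraph⇒contMap (λ x → cY (f x)) cX compact {λ x → x} closed x ε>0
        where
        closed : ClosedGraph (λ x → cY (f x)) cX (λ x → x)
        closed {x} {y} lim = injective λ j → near-limit λ ε>0 →
          let (h , h>0 , h+h) = half-of ε>0 ; (δ , δ>0 , near) = cf y h>0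
              (η , η>0 , η≤δ , η≤h) = smaller δ>0 h>0 ; (x′ , n , n′) = lim η>0 in
          close-trans h+h (close-≤ η≤h (n j)) (close-sym (near (near-≤ η≤δ n′) j))

-- Square roots.

module SquareRoot (em : ExcludedMiddle (suc 0ℓ)) (real : CompleteOrderedField) where

  open RealLemmas em real
  open Compactness em real

  abstract

    close-square : ∀ b {ε} → 0# < ε → ∃ λ δ → 0# < δ × (∀ q → Close δ b q → Close ε (b * b) (q * q))
    close-square b ε>0 with cont-* {Unit.⊤} (cont-coord Unit.tt) (cont-coord Unit.tt) (λ _ → b) ε>0
    ... | δ , δ>0 , near = δ , δ>0 , λ q n → near {λ _ → q} (λ _ → n)

    x<x+y : ∀ x {y} → 0# < y → x < x + y
    x<x+y x {y} y>0 = 0<⇒< (<-resp ≈-refl (solve 2 (λ x y → y := (x :+ y) :- x) ≈-refl x y) y>0)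

    x-y<x : ∀ x {y} → 0# < y → x - y < x
    x-y<x x {y} y>0 = 0<⇒< (<-resp ≈-refl (solve 2 (λ x y → y := x :- (x :- y)) ≈-refl x y) y>0)

    -- Beyond `a + 1` squares exceed `(a + 1)²`, which is greater than `a`.
    square-bounded : ∀ {a q} → 0# ≤ a → 0# ≤ q → q * q ≤ a → q ≤ a + 1#
    square-bounded {a} {q} a≥0 q≥0 q²≤a = ≮⇒≥ λ lt → <⇒≱ (<-≤-trans (0<⇒< (<-resp ≈-refl
      (solve 1 (λ a → (a :* a :+ a) :+ con (+ 1) := (a :+ con (+ 1)) :* (a :+ con (+ 1)) :- a) ≈-refl a)
      (0<-+ʳ (0≤-+ (*-nonneg a≥0 a≥0) a≥0) 0<1)))
      (≤-trans (*-monoˡ-≤ (0≤-+ a≥0 (<⇒≤ 0<1)) (<⇒≤ lt))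
        (≤-resp (*-comm _ _) ≈-refl (*-monoˡ-≤ q≥0 (<⇒≤ lt))))) q²≤a

    square-not-small : ∀ {a b} → 0# ≤ b → (∀ {q} → 0# ≤ q → q * q ≤ a → q ≤ b) → ¬ b * b < a
    square-not-small {a} {b} b≥0 upper lt with close-square b (<⇒0< lt)
    ... | δ , δ>0 , near with half-of δ>0
    ... | h , h>0 , h+h = <⇒≱ (x<x+y b h>0) (upper (0≤-+ b≥0 (<⇒≤ h>0)) (0≤⇒≤ (≤-resp ≈-refl
            (solve 3 (λ a x y → (a :- x) :- (y :- x) := a :- y) ≈-refl a (b * b) ((b + h) * (b + h)))
            (≤⇒0≤ (<⇒≤ (proj₂ (near (b + h) close)))))))
      where
      close : Close δ b (b + h)
      close =
        <-resp (solve 2 (λ b h → :- h := b :- (b :+ h)) ≈-refl b h) ≈-refl (≤-<-trans (neg-≤0 (<⇒≤ h>0)) δ>0) ,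
        0<⇒< (<-resp ≈-refl (≈-trans (solve 2 (λ b h → h := (h :+ h) :- ((b :+ h) :- b)) ≈-refl b h) (+-congʳ h+h)) h>0)

    square-not-big : ∀ {a b} → (∀ {q} → 0# ≤ q → q * q ≤ a → q ≤ b) →
      (∀ {u} → (∀ {q} → 0# ≤ q → q * q ≤ a → q ≤ u) → b ≤ u) → ¬ a < b * b
    square-not-big {a} {b} upper least lt with close-square b (<⇒0< lt)
    ... | δ , δ>0 , near with half-of δ>0
    ... | h , h>0 , h+h = <⇒≱ (x-y<x b h>0) (least λ {q} q≥0 q²≤a → ≮⇒≥ λ q> →
            <⇒≱ (below-a q q> (upper q≥0 q²≤a)) q²≤a)
      where
      below-a : ∀ q → b - h < q → q ≤ b → a < q * q
      below-a q q> q≤b = 0<⇒< (<-resp ≈-refl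
        (solve 3 (λ a x y → (x :- a) :- (x :- y) := y :- a) ≈-refl a (b * b) (q * q))
        (<⇒0< (proj₁ (near q (
          0<⇒< (<-resp ≈-refl (≈-trans (solve 3 (λ b h q → (q :- (b :- h)) :+ h := (h :+ h) :- (b :- q)) ≈-refl b h q) (+-congʳ h+h))
            (0<-+ʳ (<⇒≤ (<⇒0< q>)) h>0)) ,
          ≤-<-trans (0≤⇒≤ (≤-resp ≈-refl (solve 2 (λ b q → b :- q := con (+ 0) :- (q :- b)) ≈-refl b q) (≤⇒0≤ q≤b))) δ>0)))))

    -- The supremum `b` of the nonnegative `q` with `q² ≤ a`. By continuity of squaring, `b² < a`
    -- would leave room above `b`, and `a < b²` would allow a smaller upper bound.
    sqrt : ∀ {a} → 0# ≤ a → ∃ λ b → 0# ≤ b × b * b ≈ a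
    sqrt {a} a≥0 with supremum (λ q → 0# ≤ q × q * q ≤ a)
      (0# , ≤-refl , ≤-resp (≈-sym (zeroˡ 0#)) ≈-refl a≥0)
      (a + 1# , λ (q≥0 , q²≤a) → square-bounded a≥0 q≥0 q²≤a)
    ... | b , upper , least = b , b≥0 , ≤-antisym
            (≮⇒≥ (square-not-big (λ q≥0 q²≤a → upper (q≥0 , q²≤a)) (λ ub → least (λ (q≥0 , q²≤a) → ub q≥0 q²≤a))))
            (≮⇒≥ (square-not-small b≥0 (λ q≥0 q²≤a → upper (q≥0 , q²≤a))))
      where
      b≥0 : 0# ≤ b
      b≥0 = upper (≤-refl , ≤-resp (≈-sym (zeroˡ 0#)) ≈-refl a≥0)

-- Geometric realisations in finitely many coordinates.

-- A coding of the vertices of K by elements of T, such that being a face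
-- depends only on the set of codes.
record Coding (K : SimplicialComplex) (T : Set) : Set₁ where
  open SimplicialComplex K using (Vertex; IsFace; _∈ᵛ_) renaming (_≈_ to _≈ᵛ_)
  field
    code           : Vertex → T
    code-cong      : ∀ {v w} → v ≈ᵛ w → code v ≡ code w
    code-injective : ∀ {v w} → code v ≡ code w → v ≈ᵛ w
    Good           : (T → Set) → Set
    good-⊆         : ∀ {P Q} → (∀ {t} → Q t → P t) → Good P → Good Q
    decode         : ∀ {P} → Good P → ∀ {t} → P t → ∃ λ v → code v ≡ t
    face⇒good      : ∀ {σ} → IsFace σ → Good (λ t → ∃ λ v → v ∈ᵛ σ × code v ≡ t)
    good⇒face      : ∀ {σ} → Good (λ t → ∃ λ v → v ∈ᵛ σ × code v ≡ t) → IsFace σ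

module Realisation (em : ExcludedMiddle (suc 0ℓ)) (real : CompleteOrderedField)
  (K : SimplicialComplex) {T : Set} (ts : List T) (ts-unique : Unique ts) (∈-ts : ∀ t → t List.∈ ts)
  (coding : Coding K T) where

  open SimplicialComplex K renaming (_≈_ to _≈ᵛ_)
  open Coding coding
  open RealLemmas em real hiding (_≈_) renaming (∑ to ∑′)
  open CompleteOrderedField real using (_≈_)
  open Peeling em real using (_≋_)
  open Topology real using (∑; RealisationPoint)
  open RealisationPoint
  module V = Setoid vertices

  record Point : Set where
    field
      weight  : T → ℝ
      weight≥0 : ∀ t → 0# ≤ weight t
      good    : Good (λ t → 0# < weight t)
      total≈1 : ∑ ts weight ≈ 1#

  open Point

  value : (Vertex → ℝ) → ∀ {t} → Dec (∃ λ v → code v ≡ t) → ℝ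
  value f (yes (v , _)) = f v
  value f (no _)        = 0#

  weights : RealisationPoint K → T → ℝ
  weights p t = value (coord p) (em₀ (∃ λ v → code v ≡ t))

  weights-code : ∀ (p : RealisationPoint K) v → weights p (code v) ≈ coord p v
  weights-code p v with em₀ (∃ λ w → code w ≡ code v)
  ... | yes (w , eq) = coord-cong p (code-injective eq)
  ... | no none      = ⊥-elim (none (v , ≡.refl))

  weights≥0 : ∀ (p : RealisationPoint K) t → 0# ≤ weights p t
  weights≥0 p t with em₀ (∃ λ v → code v ≡ t)
  ... | yes (v , _) = nonneg p v
  ... | no _        = ≤-refl

  positive⇒∈face : ∀ (p : RealisationPoint K) {v} → 0# < coord p v → v ∈ᵛ face p
  positive⇒∈face p {v} lt with em₀ (v ∈ᵛ face p)
  ... | yes v∈ = v∈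
  ... | no v∉  = ⊥-elim (0<⇒≉0 lt (support p v v∉))

  weights-positive : ∀ (p : RealisationPoint K) {t} → 0# < weights p t → ∃ λ v → v ∈ᵛ face p × code v ≡ t
  weights-positive p {t} lt with em₀ (∃ λ v → code v ≡ t)
  ... | yes (v , eq) = v , positive⇒∈face p lt , eq
  ... | no _         = ⊥-elim (proj₂ lt ≈-refl)

  codes-unique : ∀ {σ} → SetoidUnique.Unique vertices σ → Unique (map code σ)
  codes-unique = SetoidUniqueₚ.map⁺ vertices (≡.setoid T) code-injective

  ∈-codes : ∀ {σ v} → v ∈ᵛ σ → code v List.∈ map code σ
  ∈-codes v∈ = Any.map⁺ (Any.map code-cong v∈)

  sum-codes : ∀ {σ} {f : T → ℝ} → SetoidUnique.Unique vertices σ →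
              (∀ {t} → ¬ t List.∈ map code σ → f t ≈ 0#) → ∑ σ (f ∘ code) ≈ ∑ ts f
  sum-codes {σ} {f} u z = ≈-trans (≈-sym (∑-map code σ))
    (∑-⊆ (λ t → em₀ (t List.∈ map code σ)) (codes-unique u) ts-unique (λ _ → ∈-ts _) z)

  weights-outside : ∀ (p : RealisationPoint K) {t} → ¬ t List.∈ map code (face p) → weights p t ≈ 0#
  weights-outside p t∉ = ≤-antisym (≮⇒≥ (λ lt → let (v , v∈ , eq) = weights-positive p lt in
    t∉ (≡.subst (List._∈ map code (face p)) eq (∈-codes v∈)))) (weights≥0 p _)

  -- Linearity on simplices is stated with sums over the face that a point carries, and one point
  -- can be given with several faces. Over all codes the sum no longer depends on this choice.
  face-sum : ∀ (p : RealisationPoint K) (f : T → ℝ) → ∑ (face p) (λ v → coord p v * f (code v)) ≈ ∑ ts (λ t → weights p t * f t)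
  face-sum p f = ≈-trans (∑-cong (face p) (λ v → *-congʳ (≈-sym (weights-code p v))))
    (sum-codes (unique p) (λ t∉ → ≈-trans (*-congʳ (weights-outside p t∉)) (zeroˡ _)))

  toPoint : RealisationPoint K → Point
  toPoint p = record
    { weight   = weights p
    ; weight≥0 = weights≥0 p
    ; good     = good-⊆ (weights-positive p) (face⇒good (isFace p))
    ; total≈1  = ≈-trans (≈-sym (sum-codes (unique p) (weights-outside p)))
                   (≈-trans (∑-cong (face p) (weights-code p)) (total p))
    }

  listed : List T → List Vertex
  listed []       = []
  listed (t ∷ ts) with em₀ (∃ λ v → code v ≡ t)
  ... | yes (v , _) = v ∷ listed ts
  ... | no _        = listed ts

  listed-∈ : ∀ {ts t} → t List.∈ ts → ∀ {v} → code v ≡ t → v ∈ᵛ listed ts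
  listed-∈ {t ∷ ts} t∈ eq with em₀ (∃ λ v → code v ≡ t)
  listed-∈ {t ∷ ts} (here ≡.refl) eq | yes (w , eq′) = here (code-injective (≡.trans eq (≡.sym eq′)))
  listed-∈ {t ∷ ts} (there t∈)    eq | yes _ = there (listed-∈ t∈ eq)
  listed-∈ {t ∷ ts} (here ≡.refl) eq | no none = ⊥-elim (none (_ , eq))
  listed-∈ {t ∷ ts} (there t∈)    eq | no _ = listed-∈ t∈ eq

  listed-code : ∀ ts {v} → v ∈ᵛ listed ts → code v List.∈ ts
  listed-code (t ∷ ts) v∈ with em₀ (∃ λ v → code v ≡ t)
  listed-code (t ∷ ts) (here v≈w)  | yes (w , eq) = here (≡.trans (code-cong v≈w) eq)
  listed-code (t ∷ ts) (there v∈)  | yes _ = there (listed-code ts v∈)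
  listed-code (t ∷ ts) v∈          | no _  = there (listed-code ts v∈)

  listed-unique : ∀ {ts} → Unique ts → SetoidUnique.Unique vertices (listed ts)
  listed-unique {[]} _ = AllPairs.[]
  listed-unique {t ∷ ts} (t∉ AllPairs.∷ u) with em₀ (∃ λ v → code v ≡ t)
  ... | no _ = listed-unique u
  ... | yes (v , ≡.refl) = SetoidMembershipₚ.∉⇒All[≉] vertices
          (λ v∈ → All.lookup t∉ (listed-code ts v∈) ≡.refl) AllPairs.∷ listed-unique u

  allVertices : List Vertex
  allVertices = listed ts

  ∈-allVertices : ∀ v → v ∈ᵛ allVertices
  ∈-allVertices v = listed-∈ (∈-ts (code v)) ≡.refl

  select : (P : T → Set) → List Vertex
  select P = filter (λ v → em₀ (P (code v))) allVertices

  module _ (P : T → Set) where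

    ∈-select⁺ : ∀ {v} → P (code v) → v ∈ᵛ select P
    ∈-select⁺ {v} pv = SetoidMembershipₚ.∈-filter⁺ vertices (λ v → em₀ (P (code v)))
      (λ v≈w → ≡.subst P (code-cong v≈w)) (∈-allVertices v) pv

    ∈-select⁻ : ∀ {v} → v ∈ᵛ select P → P (code v)
    ∈-select⁻ v∈ = proj₂ (SetoidMembershipₚ.∈-filter⁻ vertices (λ v → em₀ (P (code v)))
      (λ v≈w → ≡.subst P (code-cong v≈w)) {xs = allVertices} v∈)

    select-unique : SetoidUnique.Unique vertices (select P)
    select-unique = SetoidUniqueₚ.filter⁺ vertices (λ v → em₀ (P (code v))) (listed-unique ts-unique)

    select-face : Good P → IsFace (select P)
    select-face g = good⇒face (good-⊆ (λ { (v , v∈ , ≡.refl) → ∈-select⁻ v∈ }) g)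

  fromPoint : Point → RealisationPoint K
  fromPoint x = record
    { coord      = weight x ∘ code
    ; coord-cong = λ {v} v≈w → ≡.subst (λ t → weight x (code v) ≈ weight x t) (code-cong v≈w) ≈-refl
    ; nonneg     = λ v → weight≥0 x (code v)
    ; face       = select positive
    ; isFace     = select-face positive (good x)
    ; unique     = (select-unique positive)
    ; support    = λ v v∉ → ≤-antisym (≮⇒≥ (λ lt → v∉ (∈-select⁺ positive lt))) (weight≥0 x (code v))
    ; total      = ≈-trans (sum-codes (select-unique positive) off-face) (total≈1 x)
    }
    where
    positive : T → Set
    positive t = 0# < weight x t
    off-face : ∀ {t} → ¬ t List.∈ map code (select positive) → weight x t ≈ 0#
    off-face t∉ = ≤-antisym (≮⇒≥ (λ lt → let (v , eq) = decode (good x) lt in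
      t∉ (≡.subst (List._∈ map code (select positive)) eq
        (∈-codes (∈-select⁺ positive (≡.subst positive (≡.sym eq) lt)))))) (weight≥0 x _)

  weights-fromPoint : ∀ (x : Point) t → weights (fromPoint x) t ≈ weight x t
  weights-fromPoint x t with em₀ (∃ λ v → code v ≡ t)
  ... | yes (v , ≡.refl) = ≈-refl
  ... | no none = ≤-antisym (weight≥0 x t) (≮⇒≥ (λ lt → none (decode (good x) lt)))

  coord⇒weights : ∀ (p q : RealisationPoint K) → coord p ≋ coord q → weights p ≋ weights q
  coord⇒weights p q eq t with em₀ (∃ λ v → code v ≡ t)
  ... | yes (v , _) = eq v
  ... | no _        = ≈-refl

-- Nonnegative solutions of linear systems.

module Linearity (em : ExcludedMiddle (suc 0ℓ)) (real : CompleteOrderedField) where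

  open RealLemmas em real
  open Peeling em real

  record Linear {W : Set} (f : (W → ℝ) → ℝ) : Set where
    field
      respects        : ∀ {x y} → x ≋ y → f x ≈ f y
      additive    : ∀ x y → f (λ w → x w + y w) ≈ f x + f y
      homogeneous : ∀ k x → f (λ w → k * x w) ≈ k * f x

  open Linear

  linear-zero : ∀ {W} {f : (W → ℝ) → ℝ} → Linear f → ∀ {x} → (∀ w → x w ≈ 0#) → f x ≈ 0#
  linear-zero lin {x} z = ≈-trans (respects lin (λ w → ≈-trans (z w) (≈-sym (zeroˡ (x w)))))
    (≈-trans (homogeneous lin 0# x) (zeroˡ _))

  linear-minus : ∀ {W} {f : (W → ℝ) → ℝ} → Linear f → ∀ x k y → f (λ w → x w - k * y w) ≈ f x - k * f y
  linear-minus {f = f} lin x k y = ≈-trans (respects lin (λ w → solve 3 (λ a k b → a :- k :* b := a :+ (:- k) :* b) ≈-refl (x w) k (y w)))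
    (≈-trans (additive lin x _) (≈-trans (+-congˡ (homogeneous lin (- k) y))
      (solve 3 (λ a k b → a :+ (:- k) :* b := a :- k :* b) ≈-refl (f x) k (f y))))

  linear-∑ : ∀ {T W : Set} {f : (W → ℝ) → ℝ} → Linear f → (ts : List T) (k : T → ℝ) (s : T → W → ℝ) →
             f (λ w → ∑ ts (λ t → k t * s t w)) ≈ ∑ ts (λ t → k t * f (s t))
  linear-∑ lin []       k s = linear-zero lin (λ _ → ≈-refl)
  linear-∑ lin (t ∷ ts) k s = ≈-trans (additive lin (λ w → k t * s t w) (λ w → ∑ ts (λ t → k t * s t w)))
    (+-cong (homogeneous lin (k t) (s t)) (linear-∑ lin ts k s))

  chain-scale : ∀ {T : Set} {_⊑_ : T → T → Set} {A : T → Set} {k e : T → ℝ} → (∀ t → 0# ≤ e t) →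
                Chain _⊑_ A k → Chain _⊑_ A (λ t → k t * e t)
  chain-scale {k = k} {e} e≥0 ch = record
    { nonneg  = λ t → *-nonneg (nonneg t) (e≥0 t)
    ; allowed = λ p → allowed (factor p)
    ; linked  = λ p q → linked (factor p) (factor q)
    }
    where
    open Chain ch
    factor : ∀ {t} → 0# < k t * e t → 0# < k t
    factor {t} p with ≤⊎> (k t) 0#
    ... | inj₂ q = q
    ... | inj₁ q = ⊥-elim (0<⇒≉0 p (≈-trans (*-congʳ (≤-antisym q (nonneg t))) (zeroˡ (e t))))

  -- Besides linear equations, a condition on supports that passes to smaller ones. The solutions
  -- need not form a convex set; they are a union of cones, one for each admissible support.
  record System (W R : Set) : Set₁ where
    field
      L        : R → (W → ℝ) → ℝ
      L-linear : ∀ r → Linear (L r)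
      Good     : (W → Set) → Set
      good-⊆   : ∀ {P Q} → (∀ {w} → Q w → P w) → Good P → Good Q
      good-∅   : Good (λ _ → ⊥)

-- The nonnegative solutions x of a homogeneous linear system whose support
-- satisfies Good decompose uniquely along chains of supports, once a solution
-- has been chosen for each support.
module Support (em : ExcludedMiddle (suc 0ℓ)) (real : CompleteOrderedField)
  {W : Set} (ws : List W) (∈-ws : ∀ w → w List.∈ ws) {R : Set} (system : Linearity.System em real W R) where

  open RealLemmas em real
  open Linearity em real
  open System system
  open Peeling em real
  open Linear

  record Solution (x : W → ℝ) : Set where
    field
      nonneg : ∀ w → 0# ≤ x w
      kernel : ∀ r → L r x ≈ 0#
      good   : Good (λ w → 0# < x w)

  open Solution

  T : Set
  T = Subset (length ws)

  index : W → Fin (length ws)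
  index w = Any.index (∈-ws w)

  abstract

    positive? : ∀ (x : W → ℝ) i → Dec (0# < x (lookup ws i))
    positive? x i = em₀ (0# < x (lookup ws i))

    supp : (W → ℝ) → T
    supp x = ⟪ positive? x ⟫

    ∈-supp⁺ : ∀ {x} w → 0# < x w → index w ∈ supp x
    ∈-supp⁺ {x} w lt = ∈⟪⟫⁺ (positive? x) (subst (λ w → 0# < x w) (lookup-index (∈-ws w)) lt)

    ∈-supp⁻′ : ∀ {x i} → i ∈ supp x → 0# < x (lookup ws i)
    ∈-supp⁻′ {x} = ∈⟪⟫⁻ (positive? x)

    ∈-supp⁻ : ∀ {x} w → index w ∈ supp x → 0# < x w
    ∈-supp⁻ {x} w i∈ = subst (λ w → 0# < x w) (sym (lookup-index (∈-ws w))) (∈-supp⁻′ {x} i∈)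

    supp-⊆ : ∀ {x y} → (∀ w → 0# < x w → 0# < y w) → supp x ⊆ supp y
    supp-⊆ {x} {y} f i∈ = ∈⟪⟫⁺ (positive? y) (f _ (∈-supp⁻′ {x} i∈))

  supp-cong : ∀ {x y} → x ≋ y → supp x ≡ supp y
  supp-cong eq = ⊆-antisym (supp-⊆ (λ w → <-resp ≈-refl (eq w))) (supp-⊆ (λ w → <-resp ≈-refl (≈-sym (eq w))))

  A : T → Set
  A σ = ∃ λ x → Solution x × (∃ λ w → 0# < x w) × supp x ≡ σ

  pick : ∀ {σ} → Dec (A σ) → W → ℝ
  pick (yes (x , _)) = x
  pick (no _)        = λ _ → 0#

  abstract

    -- One solution with each attained support plays the part of a barycentre; chains of supports
    -- then give a barycentric subdivision.
    b : T → W → ℝ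
    b σ = pick (em₀ (A σ))

    b-solution : ∀ {σ} → A σ → Solution (b σ) × (∃ λ w → 0# < b σ w) × supp (b σ) ≡ σ
    b-solution {σ} a with em₀ (A σ)
    ... | yes (x , r) = r
    ... | no ¬a       = ⊥-elim (¬a a)

    b≥0 : ∀ σ w → 0# ≤ b σ w
    b≥0 σ w with em₀ (A σ)
    ... | yes (x , sx , _) = nonneg sx w
    ... | no _ = ≤-refl

  b-positive : ∀ {σ} → A σ → ∀ w → (index w ∈ σ → 0# < b σ w) × (0# < b σ w → index w ∈ σ)
  b-positive a w with b-solution a
  ... | _ , _ , eq = (λ i∈ → ∈-supp⁻ w (subst (index w ∈_) (sym eq) i∈)) ,
                     (λ lt → subst (index w ∈_) eq (∈-supp⁺ w lt))

  -- Reversed, because the least member of a chain must be visible in the combination: with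
  -- nonnegative entries the support of the combination is the union of the supports in the chain,
  -- that is, the largest of them.
  _⊑_ : T → T → Set
  σ ⊑ τ = τ ⊆ σ

  supp-zero : ∀ {x} → (∀ w → x w ≈ 0#) → ¬ A (supp x)
  supp-zero z (y , _ , (w , lt) , eq) =
    0<⇒≉0 (∈-supp⁻ w (subst (index w ∈_) eq (∈-supp⁺ w lt))) (z w)

  ⊑-trans : ∀ {σ τ υ} → σ ⊑ τ → τ ⊑ υ → σ ⊑ υ
  ⊑-trans p q = ⊆-trans q p

  ⊑-antisym : ∀ {σ τ} → A σ → A τ → σ ⊑ τ → τ ⊑ σ → σ ≡ τ
  ⊑-antisym _ _ p q = ⊆-antisym q p

  ⊑-refl : ∀ {σ} → A σ → σ ⊑ σ
  ⊑-refl _ = ⊆-refl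

  ts : List T
  ts = allSubsets (length ws)

  open Decomposition {W = W} ts (allSubsets-unique (length ws)) ∈-allSubsets _⊑_ A
    ⊑-refl ⊑-trans ⊑-antisym b supp supp-cong supp-zero public
  open Chain

  kb≥0 : ∀ {k} → Ch k → ∀ w {t} → t List.∈ ts → 0# ≤ k t * b t w
  kb≥0 ch w {t} _ = *-nonneg (nonneg ch t) (b≥0 t w)

  comb-positive : ∀ {k} → Ch k → ∀ {w} → 0# < comb k w → ∃ λ t → 0# < k t × 0# < b t w
  comb-positive {k} ch {w} lt with ∑-pos-member ts (kb≥0 ch w) lt
  ... | t , _ , p with ≤⊎> (k t) 0# | ≤⊎> (b t w) 0#
  ... | inj₂ q | inj₂ r = t , q , r
  ... | inj₁ q | _ = ⊥-elim (0<⇒≉0 p (≈-trans (*-congʳ (≤-antisym q (nonneg ch t))) (zeroˡ _)))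
  ... | _ | inj₁ r = ⊥-elim (0<⇒≉0 p (≈-trans (*-congˡ (≤-antisym r (b≥0 t w))) (zeroʳ _)))

  supp-least : ∀ {k} → Ch k → ∀ {t} → 0# < k t → (∀ {u} → 0# < k u → t ⊑ u) → supp (comb k) ≡ t
  supp-least {k} ch {t} lt le with b-solution (allowed ch lt)
  ... | sol , _ , eq = trans (⊆-antisym (supp-⊆ down) (supp-⊆ up)) eq
    where
    down : ∀ w → 0# < comb k w → 0# < b t w
    down w p with comb-positive ch p
    ... | u , ku , bu = proj₁ (b-positive (allowed ch lt) w) (le ku (proj₂ (b-positive (allowed ch ku) w) bu))
    up : ∀ w → 0# < b t w → 0# < comb k w
    up w p = ∑-pos (kb≥0 ch w) (∈-allSubsets t) (0<-* lt p)

  open Uniqueness supp-least public using (comb-injective)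

  comb-solution : ∀ {k} → Ch k → Solution (comb k)
  comb-solution {k} ch = record
    { nonneg = λ w → ∑-nonneg ts (kb≥0 ch w)
    ; kernel = λ r → ≈-trans (linear-∑ (L-linear r) ts k b) (∑-zero ts (λ {t} _ → term-zero r t))
    ; good   = good-comb (em₀ (∃ λ t → 0# < k t))
    }
    where
    term-zero : ∀ r t → k t * L r (b t) ≈ 0#
    term-zero r t with ≤⊎> (k t) 0#
    ... | inj₁ q = ≈-trans (*-congʳ (≤-antisym q (nonneg ch t))) (zeroˡ _)
    ... | inj₂ q = ≈-trans (*-congˡ (kernel (proj₁ (b-solution (allowed ch q))) r)) (zeroʳ _)
    good-comb : Dec (∃ λ t → 0# < k t) → Good (λ w → 0# < comb k w)
    good-comb (no none) = good-⊆ (λ p → none (let (t , q , _) = comb-positive ch p in t , q)) good-∅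
    good-comb (yes (t , lt)) with least _⊑_ A ⊑-refl ⊑-trans ch (λ _ → t ≡ t) ts (t , ∈-allSubsets t , lt , refl)
    ... | m , lm , _ , le = good-⊆ (λ {w} p → let (u , ku , bu) = comb-positive ch p in
            proj₁ (b-positive (allowed ch lm) w) (le (∈-allSubsets u) ku refl (proj₂ (b-positive (allowed ch ku) w) bu)))
            (good (proj₁ (b-solution (allowed ch lm))))

  module PeelSupport {x : W → ℝ} (sx : Solution x) (nz : ∃ λ w → 0# < x w) where

    σ : T
    σ = supp x

    aσ : A σ
    aσ = x , sx , nz , refl

    same : ∀ w → (0# < x w → 0# < b σ w) × (0# < b σ w → 0# < x w)
    same w = (λ lt → proj₁ (b-positive aσ w) (∈-supp⁺ w lt)) , (λ lt → ∈-supp⁻ w (proj₂ (b-positive aσ w) lt))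

    inverse-of : ∀ {w} → Dec (0# < b σ w) → ℝ
    inverse-of (yes p) = proj₁ (inv⁺ p)
    inverse-of (no _)  = 0#

    ratio : W → ℝ
    ratio w = x w * inverse-of {w} (em₀ (0# < b σ w))

    ratio-b : ∀ {w} → 0# < b σ w → ratio w * b σ w ≈ x w
    ratio-b {w} p with em₀ (0# < b σ w)
    ... | no ¬p = ⊥-elim (¬p p)
    ... | yes q with inv⁺ q
    ... | i , _ , eq = ≈-trans (solve 3 (λ x i b → (x :* i) :* b := x :* (b :* i)) ≈-refl (x w) i (b σ w))
                         (≈-trans (*-congˡ eq) (*-identityʳ _))

    ratio>0 : ∀ {w} → 0# < x w → 0# < ratio w
    ratio>0 {w} p with em₀ (0# < b σ w)
    ... | no ¬q = ⊥-elim (¬q (proj₁ (same w) p))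
    ... | yes q with inv⁺ q
    ... | i , i>0 , _ = 0<-* p i>0

    -- The minimal ratio is the largest `k` for which subtracting `k` times `b σ` keeps `x`
    -- nonnegative; a coordinate attaining it drops out of the support.
    smallest : ∃ λ w → 0# < x w × (∀ {v} → v List.∈ ws → 0# < x v → ratio w ≤ ratio v)
    smallest = argmin ws (λ w → 0# < x w) ratio (∈-ws (proj₁ nz)) (proj₂ nz)

    w₀ : W
    w₀ = proj₁ smallest

    k : ℝ
    k = ratio w₀

    k>0 : 0# < k
    k>0 = ratio>0 (proj₁ (proj₂ smallest))

    x′ : W → ℝ
    x′ w = x w - k * b σ w

    x′≥0 : ∀ w → 0# ≤ x′ w
    x′≥0 w with ≤⊎> (b σ w) 0#
    ... | inj₂ p = ≤⇒0≤ (≤-resp (*-comm _ _) (≈-trans (*-comm _ _) (ratio-b p))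
                     (*-monoˡ-≤ (b≥0 σ w) (proj₂ (proj₂ smallest) (∈-ws w) (proj₂ (same w) p))))
    ... | inj₁ q = ≤-resp ≈-refl (≈-sym (≈-trans (+-congˡ (-‿cong (≈-trans (*-congˡ (≤-antisym q (b≥0 σ w))) (zeroʳ k))))
                     (solve 1 (λ a → a :- con (+ 0) := a) ≈-refl (x w)))) (nonneg sx w)

    shrink : ∀ w → 0# < x′ w → 0# < x w
    shrink w p = <-≤-trans p (0≤⇒≤ (≤-resp ≈-refl (solve 2 (λ a c → c := a :- (a :- c)) ≈-refl (x w) (k * b σ w))
                   (*-nonneg (<⇒≤ k>0) (b≥0 σ w))))

    x′-solution : Solution x′
    x′-solution = record
      { nonneg = x′≥0
      ; kernel = λ r → ≈-trans (linear-minus (L-linear r) x k (b σ))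
          (≈-trans (+-cong (kernel sx r) (-‿cong (≈-trans (*-congˡ (kernel (proj₁ (b-solution aσ)) r)) (zeroʳ k))))
            (-‿inverseʳ 0#))
      ; good   = good-⊆ (λ {w} → shrink w) (good sx)
      }

    smaller-support : ∣ supp x′ ∣ ℕ.< ∣ supp x ∣
    smaller-support = p⊂q⇒∣p∣<∣q∣ (supp-⊆ shrink , index w₀ , ∈-supp⁺ w₀ (proj₁ (proj₂ smallest)) ,
      λ i∈ → 0<⇒≉0 (∈-supp⁻ w₀ i∈) (x≈y⇒x-y≈0 (≈-sym (ratio-b (proj₁ (same w₀) (proj₁ (proj₂ smallest)))))))

  some-positive : ∀ {x} → Solution x → ¬ (∀ w → x w ≈ 0#) → ∃ λ w → 0# < x w
  some-positive {x} sx nz with em₀ (∃ λ w → 0# < x w)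
  ... | yes ex = ex
  ... | no none = ⊥-elim (nz (λ w → ≤-antisym (≮⇒≥ (λ p → none (w , p))) (nonneg sx w)))

  peel-support : ∀ {x} → Solution x → ¬ (∀ w → x w ≈ 0#) →
    A (supp x) × ∃ λ k → 0# < k × Solution (λ w → x w - k * b (supp x) w) ×
    supp x ⊑ supp (λ w → x w - k * b (supp x) w) × ∣ supp (λ w → x w - k * b (supp x) w) ∣ ℕ.< ∣ supp x ∣
  peel-support sx nz = aσ , k , k>0 , x′-solution , supp-⊆ shrink , smaller-support
    where open PeelSupport sx (some-positive sx nz)

  open Existence Solution (∣_∣ ∘ supp) peel-support public using (decompose)

  -- A linear functional τ that is positive on nonzero solutions identifies the
  -- solutions with τ x = 1 with the normalised chain weights.
  module Slice (τ : (W → ℝ) → ℝ) (τ-linear : Linear τ)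
    (τ-positive : ∀ {x} → Solution x → (∃ λ w → 0# < x w) → 0# < τ x) where

    invert : ∀ {σ} → Dec (A σ) → ℝ
    invert (yes a) = let (sol , nz , _) = b-solution a in proj₁ (inv⁺ (τ-positive sol nz))
    invert (no _)  = 0#

    scale : T → ℝ
    scale σ = invert (em₀ (A σ))

    invert≥0 : ∀ {σ} (d : Dec (A σ)) → 0# ≤ invert d
    invert≥0 (yes a) = <⇒≤ (proj₁ (proj₂ (inv⁺ (τ-positive (proj₁ (b-solution a)) (proj₁ (proj₂ (b-solution a)))))))
    invert≥0 (no _)  = ≤-refl

    invert-τ : ∀ {σ} (d : Dec (A σ)) → A σ → τ (b σ) * invert d ≈ 1#
    invert-τ (yes a) _ = proj₂ (proj₂ (inv⁺ (τ-positive (proj₁ (b-solution a)) (proj₁ (proj₂ (b-solution a))))))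
    invert-τ (no ¬a) a = ⊥-elim (¬a a)

    scale≥0 : ∀ σ → 0# ≤ scale σ
    scale≥0 σ = invert≥0 (em₀ (A σ))

    scale-τ : ∀ {σ} → A σ → τ (b σ) * scale σ ≈ 1#
    scale-τ {σ} = invert-τ (em₀ (A σ))

    -- The point where the ray through `b σ` meets `τ = 1`; it is 0 when `σ` is no support.
    vertex : T → W → ℝ
    vertex σ w = scale σ * b σ w

    slice : (T → ℝ) → W → ℝ
    slice k w = ∑ ts (λ t → k t * vertex t w)

    slice≈comb : ∀ k → slice k ≋ comb (λ t → k t * scale t)
    slice≈comb k w = ∑-cong ts (λ t → ≈-sym (*-assoc (k t) (scale t) (b t w)))

    solution-cong : ∀ {x y} → x ≋ y → Solution x → Solution y
    solution-cong eq sx = record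
      { nonneg = λ w → ≤-resp ≈-refl (eq w) (nonneg sx w)
      ; kernel = λ r → ≈-trans (≈-sym (respects (L-linear r) eq)) (kernel sx r)
      ; good   = good-⊆ (<-resp ≈-refl (≈-sym (eq _))) (good sx)
      }

    slice-solution : ∀ {k} → Ch k → Solution (slice k)
    slice-solution {k} ch = solution-cong (λ w → ≈-sym (slice≈comb k w)) (comb-solution (chain-scale scale≥0 ch))

    off-chain : ∀ {k} → Ch k → ∀ {t} → ¬ A t → k t ≈ 0#
    off-chain ch {t} ¬a = ≤-antisym (≮⇒≥ (λ p → ¬a (allowed ch p))) (nonneg ch t)

    slice-τ : ∀ {k} → Ch k → τ (slice k) ≈ ∑ ts k
    slice-τ {k} ch = ≈-trans (linear-∑ τ-linear ts k vertex) (∑-cong ts (λ t → at-vertex t (em₀ (A t))))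
      where
      at-vertex : ∀ t → Dec (A t) → k t * τ (vertex t) ≈ k t
      at-vertex t (yes a) = ≈-trans (*-congˡ (≈-trans (homogeneous τ-linear (scale t) (b t))
        (≈-trans (*-comm _ _) (scale-τ a)))) (*-identityʳ _)
      at-vertex t (no ¬a) = ≈-trans (*-congʳ (off-chain ch ¬a)) (≈-trans (zeroˡ _) (≈-sym (off-chain ch ¬a)))

    slice-injective : ∀ {k l} → Ch k → Ch l → slice k ≋ slice l → k ≋ l
    slice-injective {k} {l} chk chl eq t with em₀ (A t)
    ... | no ¬a = ≈-trans (off-chain chk ¬a) (≈-sym (off-chain chl ¬a))
    ... | yes a = *-cancelˡ-≈ scale>0 (≈-trans (*-comm _ _) (≈-trans
            (comb-injective (chain-scale scale≥0 chk) (chain-scale scale≥0 chl)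
              (λ w → ≈-trans (≈-sym (slice≈comb k w)) (≈-trans (eq w) (slice≈comb l w))) t) (*-comm _ _)))
      where
      scale>0 : 0# < scale t
      scale>0 with ≤⊎> (scale t) 0#
      ... | inj₂ p = p
      ... | inj₁ q = ⊥-elim (0≉1 (≈-trans (≈-sym (zeroʳ _)) (≈-trans (*-congˡ (≈-sym (≤-antisym q (scale≥0 t)))) (scale-τ a))))

    slice-surjective : ∀ {x} → Solution x → ∃ λ k → Ch k × slice k ≋ x
    slice-surjective {x} sx = rescale (decompose sx)
      where
      rescale : (∃ λ c → Ch c × comb c ≋ x) → ∃ λ k → Ch k × slice k ≋ x
      rescale (c , ch , eq) = (λ t → c t * τ⁺ t (em₀ (A t))) , chain-scale (λ t → τ⁺≥0 t (em₀ (A t))) ch , λ w →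
          ≈-trans (slice≈comb _ w) (≈-trans (comb-cong (λ t → cancel t (em₀ (A t))) w) (eq w))
        where
        τ⁺ : ∀ t → Dec (A t) → ℝ
        τ⁺ t (yes _) = τ (b t)
        τ⁺ t (no _)  = 0#
        τ⁺≥0 : ∀ t (d : Dec (A t)) → 0# ≤ τ⁺ t d
        τ⁺≥0 t (yes a) = <⇒≤ (τ-positive (proj₁ (b-solution a)) (proj₁ (proj₂ (b-solution a))))
        τ⁺≥0 t (no _)  = ≤-refl
        cancel : ∀ t (d : Dec (A t)) → (c t * τ⁺ t d) * scale t ≈ c t
        cancel t (yes a) = ≈-trans (*-assoc _ _ _) (≈-trans (*-congˡ (scale-τ a)) (*-identityʳ _))
        cancel t (no ¬a) = ≈-trans (*-congʳ (zeroʳ _)) (≈-trans (zeroˡ _) (≈-sym (off-chain ch ¬a)))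

-- Spaces of chain weights and homeomorphisms.

module Spaces (em : ExcludedMiddle (suc 0ℓ)) (real : CompleteOrderedField) where

  open RealLemmas em real
  open Peeling em real
  open Compactness em real
  open Topology real using (Near; euclidean)

  uniform : ∀ {I J : Set} (js : List J) (F : J → (I → ℝ) → ℝ) → (∀ j → Contℝ (F j)) →
            ∀ p {ε} → 0# < ε → ∃ λ δ → 0# < δ × (∀ {q} → Near δ p q → ∀ {j} → j List.∈ js → Close ε (F j p) (F j q))
  uniform [] F cF p ε>0 = 1# , 0<1 , λ _ ()
  uniform {J = J} (j ∷ js) F cF p {ε} ε>0 = combine (cF j p ε>0) (uniform js F cF p ε>0)
    where
    Uniform : (J → Set) → Set
    Uniform P = ∃ λ δ → 0# < δ × (∀ {q} → Near δ p q → ∀ {j} → P j → Close ε (F j p) (F j q))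
    combine : (∃ λ δ → 0# < δ × (∀ {q} → Near δ p q → Close ε (F j p) (F j q))) → Uniform (List._∈ js) → Uniform (List._∈ (j ∷ js))
    combine (δ , δ>0 , near) (δ′ , δ′>0 , near′) = let (η , η>0 , le , le′) = smaller δ>0 δ′>0 in
      η , η>0 , λ n → λ { (here refl) → near (near-≤ le n) ; (there j∈) → near′ (near-≤ le′ n) j∈ }

  module ChainSpace {T : Set} (ts : List T) (∈-ts : ∀ t → t List.∈ ts)
    (_⊑_ : T → T → Set) (A : T → Set) where

    open Chain

    IsPoint : (T → ℝ) → Set
    IsPoint k = Chain _⊑_ A k × ∑ ts k ≈ 1#

    point-≤1 : ∀ {k} → IsPoint k → ∀ t → k t ≤ 1#
    point-≤1 (ch , total) t = ≤-trans (∑-≥-member (λ {t} _ → nonneg ch t) (∈-ts t)) (≈⇒≤ total)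

    -- Strict positivity is an open condition, so near a limit both conditions
    -- on the support are witnessed by nearby points.
    point-closed : ∀ {r} → Limit r IsPoint → IsPoint r
    point-closed {r} lim = record { nonneg = nn ; allowed = al ; linked = lk } , total
      where
      nn : ∀ t → 0# ≤ r t
      nn t = limit-≥0 (cont-coord t) lim (λ (ch , _) → nonneg ch t)
      total : ∑ ts r ≈ 1#
      total = x-y≈0⇒x≈y (limit-≈0 (cont-- (cont-∑ ts cont-coord) (cont-const 1#)) lim (λ (_ , eq) → x≈y⇒x-y≈0 eq))
      stays : ∀ {a b ε} → ε ≤ a → Close ε a b → 0# < b
      stays {a} {b} {ε} le (p , _) = <-resp ≈-refl (solve 3 (λ a b e → (e :- (a :- b)) :+ (a :- e) := b) ≈-refl a b ε)
        (0<-+ˡ (<⇒0< p) (≤⇒0≤ le))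
      al : ∀ {t} → 0# < r t → A t
      al lt = let (p , (ch , _) , n) = lim lt in allowed ch (stays ≤-refl (n _))
      lk : ∀ {t u} → 0# < r t → 0# < r u → t ⊑ u ⊎ u ⊑ t
      lk lt lu = let (ε , ε>0 , le , le′) = smaller lt lu ; (p , (ch , _) , n) = lim ε>0 in
        linked ch (stays le (n _)) (stays le′ (n _))

    module _ {X : Set} (c : X → T → ℝ) (sound : ∀ x → IsPoint (c x))
      (onto : ∀ {k} → IsPoint k → ∃ λ x → c x ≋ k) where

      chainSpace-compact : Compact c
      chainSpace-compact = bounded∧closed⇒compact c {0#} {1#} ts ∈-ts (λ x t → nonneg (proj₁ (sound x)) t)
        (λ x t → point-≤1 (sound x) t)
        (λ {r} lim → onto (point-closed (λ ε>0 → let (p , (x , eq) , n) = lim ε>0 in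
          p , resp (λ t → ≈-sym (eq t)) (sound x) , n)))
        where
        resp : ∀ {k l} → k ≋ l → IsPoint k → IsPoint l
        resp eq (ch , total) = chain-cong _⊑_ A eq ch , ≈-trans (∑-cong ts (λ t → ≈-sym (eq t))) total

  module _ {X I : Set} (cX : X → I → ℝ) where

    module Transport {Z H : Set} (cZ : Z → H → ℝ) (compact : Compact cZ)
      (ψ : Z → X) (ψ-cont : ContMap cZ cX ψ)
      (ψ-injective : ∀ {z z′} → cX (ψ z) ≋ cX (ψ z′) → cZ z ≋ cZ z′)
      (ψ⁻¹ : X → Z) (ψ-ψ⁻¹ : ∀ x → cX (ψ (ψ⁻¹ x)) ≋ cX x) where

      -- `ψ⁻¹` is any pointwise choice of preimages; injectivity and a compact source make the
      -- choice continuous.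
      ψ⁻¹-cont : ContMap cX cZ ψ⁻¹
      ψ⁻¹-cont x ε>0 with compact-injection cZ cX compact {ψ} ψ-cont ψ-injective (ψ⁻¹ x) ε>0
      ... | δ , δ>0 , near = δ , δ>0 , λ {x′} n → near (λ i → close-resp (≈-sym (ψ-ψ⁻¹ x i)) (≈-sym (ψ-ψ⁻¹ x′ i)) (n i))

  ContMap-∘ : ∀ {X Y Z I J H : Set} {cX : X → I → ℝ} {cY : Y → J → ℝ} {cZ : Z → H → ℝ} {f : X → Y} {g : Y → Z} →
              ContMap cX cY f → ContMap cY cZ g → ContMap cX cZ (g ∘ f)
  ContMap-∘ cf cg x ε>0 = let (δ , δ>0 , near) = cg _ ε>0 ; (η , η>0 , near′) = cf x δ>0 in
    η , η>0 , near ∘ near′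

  contMap-cong : ∀ {X Y I J : Set} (cX : X → I → ℝ) (cY : Y → J → ℝ) {f : X → Y} → ContMap cX cY f →
                 ∀ {x y} → cX x ≋ cX y → cY (f x) ≋ cY (f y)
  contMap-cong cX cY cf {x} {y} eq j = near-limit λ ε>0 → let (δ , δ>0 , near) = cf x ε>0 in
    near (λ i → close-≈ δ>0 (eq i)) j

  homeomorphism : ∀ {X Y I J : Set} (cX : X → I → ℝ) (cY : Y → J → ℝ) (f : X → Y) (g : Y → X) →
    ContMap cX cY f → ContMap cY cX g →
    (∀ y → cY (f (g y)) ≋ cY y) → (∀ x → cX (g (f x)) ≋ cX x) → Homeomorphism (euclidean cX) (euclidean cY)
  homeomorphism cX cY f g cf cg fg gf = record
    { inverse = record
      { to        = f
      ; from      = g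
      ; to-cong   = λ {x} {y} → contMap-cong cX cY cf {x} {y}
      ; from-cong = λ {x} {y} → contMap-cong cY cX cg {x} {y}
      ; inverse   = (λ {y} {x} x≈gy j → ≈-trans (contMap-cong cX cY cf {x} {g y} x≈gy j) (fg y j)) ,
                    (λ {x} {y} y≈fx i → ≈-trans (contMap-cong cY cX cg {y} {f x} y≈fx i) (gf x i))
      }
    ; to-continuous   = contMap⇒continuous cX cY cf
    ; from-continuous = contMap⇒continuous cY cX cg
    }

-- The order complex of the proper part in terms of cells.

module ProperPart (LG : GeneratorEnrichedLattice) where

  open Minors LG
  open Cells LG
  open MinorPoset LG

  Proper : Cell → Set
  Proper m = Valid m × m ⊴ top × m ≢ top

  K : SimplicialComplex
  K = orderComplex properPart

  open SimplicialComplex K using (Vertex; IsFace) renaming (_≈_ to _≈ᵛ_; _∈ᵛ_ to _∈ᵛ_)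

  -- The value `top` at `⊥₋` is a placeholder: the proper part omits that element.
  cellAt : M.Carrier → Cell
  cellAt ⊥₋    = top
  cellAt [ m ] = cellOf m

  key⇒cellAt : ∀ x {c} → key x ≡ just c → cellAt x ≡ c
  key⇒cellAt [ m ] eq = just-inj eq

  code : Vertex → Cell
  code v = cellAt (proj₁ v)

  code-proper : ∀ v → Proper (code v)
  code-proper (⊥₋ , ≢∅ , _) = ⊥-elim (≢∅ M.Eq.refl)
  code-proper ([ m ] , _ , ≢w) = cellOf-valid m , cellOf-⊴ m ,
    λ eq → ≢w (key-injective {[ m ]} {wholeᴹ} (cong just eq))

  code-cong : ∀ {v w} → v ≈ᵛ w → code v ≡ code w
  code-cong {⊥₋ , _}    {⊥₋ , _}     _            = refl
  code-cong {[ m ] , _} {[ m′ ] , _} InfEq.[ eq ] = cellOf-cong m m′ eq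

  code-injective : ∀ {v w} → code v ≡ code w → v ≈ᵛ w
  code-injective {⊥₋ , ≢∅ , _} = ⊥-elim (≢∅ M.Eq.refl)
  code-injective {[ _ ] , _} {⊥₋ , ≢∅ , _} = ⊥-elim (≢∅ M.Eq.refl)
  code-injective {[ m ] , _} {[ m′ ] , _} eq = InfEq.[ cellOf-injective m m′ eq ]

  vertexAt : ∀ {t} → Proper t → Vertex
  vertexAt {t} (v , t⊴ , t≢) = toM t ,
    (λ e → absurd (trans (sym (key-cong e)) (key-toM v t⊴))) ,
    (λ e → t≢ (just-inj (trans (sym (key-toM v t⊴)) (key-cong e))))
    where
    absurd : ¬ nothing ≡ just t
    absurd ()

  code-vertexAt : ∀ {t} (p : Proper t) → code (vertexAt p) ≡ t
  code-vertexAt {t} (v , t⊴ , _) = key⇒cellAt (toM t) (key-toM v t⊴)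

  ≤⇒⊴ : ∀ v w → proj₁ v M.≤ proj₁ w → code v ⊴ code w
  ≤⇒⊴ (⊥₋ , ≢∅ , _) _ _ = ⊥-elim (≢∅ M.Eq.refl)
  ≤⇒⊴ ([ m ] , _) ([ m′ ] , _) [ le ] = ≤ᴹ⇒⊴ m m′ le

  ⊴⇒≤ : ∀ v w → code v ⊴ code w → proj₁ v M.≤ proj₁ w
  ⊴⇒≤ (⊥₋ , ≢∅ , _) _ _ = ⊥-elim (≢∅ M.Eq.refl)
  ⊴⇒≤ ([ _ ] , _) (⊥₋ , ≢∅ , _) _ = ⊥-elim (≢∅ M.Eq.refl)
  ⊴⇒≤ ([ m ] , _) ([ m′ ] , _) le = [ ⊴⇒≤ᴹ m m′ le ]

  GoodCells : (Cell → Set) → Set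
  GoodCells P = (∀ {t} → P t → Proper t) × (∀ {t u} → P t → P u → t ⊴ u ⊎ u ⊴ t)

  face⇒good : ∀ {σ} → IsFace σ → GoodCells (λ t → ∃ λ v → v ∈ᵛ σ × code v ≡ t)
  face⇒good face =
    (λ { (v , _ , refl) → code-proper v }) ,
    (λ { (v , v∈ , refl) (w , w∈ , refl) → Sum.map (≤⇒⊴ v w) (≤⇒⊴ w v) (face {v} {w} v∈ w∈) })

  good⇒face : ∀ {σ} → GoodCells (λ t → ∃ λ v → v ∈ᵛ σ × code v ≡ t) → IsFace σ
  good⇒face (_ , linked) {v} {w} v∈ w∈ =
    Sum.map (⊴⇒≤ v w) (⊴⇒≤ w v) (linked (v , v∈ , refl) (w , w∈ , refl))

-- The common subdivision of the two fans.

module PLSphere (em : ExcludedMiddle (suc 0ℓ)) (real : CompleteOrderedField) (LG : GeneratorEnrichedLattice) where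

  open RealLemmas em real hiding (∑)
  open Peeling em real
  open Linearity em real
  open Compactness em real
  open Spaces em real
  open Topology real using (∑; RealisationPoint; Near)
  open RealisationPoint
  open GeneratorEnrichedLattice LG using (G)
  open Cells LG using (Cell; allCells; allCells-unique; ∈-allCells; top; valid-top; _⊴_)
  module PP = ProperPart LG
  open PP using (K)

  d : ℕ
  d = ∣ G ∣

  module F = Fan.FanAt em real LG top valid-top (enumerate G) (enumerate-∈ G) (enumerate-onto G) (enumerate-injective G)
  open F using (A; s) renaming (comb to h; Ch to ChF)
  open Chain

  -- Coordinates for both fans at once: a solution lists the coefficients of one vector in the fan
  -- of minors and in the fan of the boundary of the simplex. Its support names a cone of either
  -- fan, so the supports run through the cones of the common refinement.
  W : Set
  W = Cell ⊎ Fin (ℕ.suc d)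

  ws : List W
  ws = map inj₁ allCells ++ map inj₂ (allFin (ℕ.suc d))

  ∈-ws : ∀ w → w List.∈ ws
  ∈-ws (inj₁ t) = ∈-++⁺ˡ (∈-map⁺ inj₁ (∈-allCells t))
  ∈-ws (inj₂ i) = ∈-++⁺ʳ (map inj₁ allCells) (∈-map⁺ inj₂ (∈-allFin i))

  h-linear : ∀ j → Linear (λ c → h c j)
  h-linear j = record
    { respects        = λ eq → F.comb-cong eq j
    ; additive    = λ x y → F.comb-+ x y j
    ; homogeneous = λ k x → F.comb-scale k x j
    }

  -- A pair (c , y) is a solution when y is the vector (0 , h c) translated so
  -- as to have minimum 0.
  L : Fin d → (W → ℝ) → ℝ
  L j x = (x (inj₂ (Fin.suc j)) - x (inj₂ Fin.zero)) - h (x ∘ inj₁) j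

  L-linear : ∀ j → Linear (L j)
  L-linear j = record
    { respects        = λ eq → +-cong (+-cong (eq _) (-‿cong (eq _))) (-‿cong (respects (eq ∘ inj₁)))
    ; additive    = λ x y → ≈-trans (+-congˡ (-‿cong (additive (x ∘ inj₁) (y ∘ inj₁))))
        (solve 6 (λ a a′ b b′ e e′ → ((a :+ a′) :- (b :+ b′)) :- (e :+ e′) := ((a :- b) :- e) :+ ((a′ :- b′) :- e′))
          ≈-refl _ _ _ _ _ _)
    ; homogeneous = λ k x → ≈-trans (+-congˡ (-‿cong (homogeneous k (x ∘ inj₁))))
        (solve 4 (λ k a b e → (k :* a :- k :* b) :- k :* e := k :* ((a :- b) :- e)) ≈-refl _ _ _ _)
    }
    where open Linear (h-linear j)

  Good : (W → Set) → Set
  Good P = PP.GoodCells (P ∘ inj₁) × ∃ λ i → ¬ P (inj₂ i)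

  good-⊆ : ∀ {P Q : W → Set} → (∀ {w} → Q w → P w) → Good P → Good Q
  good-⊆ sub ((al , lk) , i , ¬p) = ((λ q → al (sub q)) , (λ q q′ → lk (sub q) (sub q′))) , i , λ q → ¬p (sub q)

  system : System W (Fin d)
  system = record
    { L = L ; L-linear = L-linear ; Good = Good ; good-⊆ = good-⊆ ; good-∅ = ((λ ()) , λ ()) , Fin.zero , λ () }

  module S = Support em real ws ∈-ws system
  open S using (Solution; T)
  open Solution

  solution⇒chain : ∀ {x} → Solution x → ChF (x ∘ inj₁)
  solution⇒chain sx = record
    { nonneg  = λ t → nonneg sx (inj₁ t)
    ; allowed = proj₁ (proj₁ (good sx))
    ; linked  = proj₂ (proj₁ (good sx))
    }

  difference : ∀ {x} → Solution x → ∀ i → ∃ λ e → x (inj₂ i) - x (inj₂ Fin.zero) ≈ e × (∀ {y} → Solution y → (x ∘ inj₁) ≋ (y ∘ inj₁) → y (inj₂ i) - y (inj₂ Fin.zero) ≈ e)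
  difference sx Fin.zero    = 0# , -‿inverseʳ _ , λ _ _ → -‿inverseʳ _
  difference {x} sx (Fin.suc j) = h (x ∘ inj₁) j , x-y≈0⇒x≈y (kernel sx j) , λ sy eq →
    ≈-trans (x-y≈0⇒x≈y (kernel sy j)) (F.comb-cong (λ t → ≈-sym (eq t)) j)

  zero-at : ∀ {x} → Solution x → ∃ λ i → x (inj₂ i) ≈ 0#
  zero-at sx = let (i , ¬p) = proj₂ (good sx) in i , ≤-antisym (≮⇒≥ ¬p) (nonneg sx (inj₂ i))

  -- The cell coordinates fix the differences of the others, and the minimum 0 fixes the
  -- translation. At a zero `i₀` of `x`, the entry of `x` at `i` is the entry of `y` at `i` minus
  -- that at `i₀`, hence no larger than the former; the other inequality is symmetric.
  cells⇒all : ∀ {x y} → Solution x → Solution y → (x ∘ inj₁) ≋ (y ∘ inj₁) → x ≋ y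
  cells⇒all sx sy eq (inj₁ t) = eq t
  cells⇒all {x} {y} sx sy eq (inj₂ i) = ≤-antisym (below sx sy eq i) (below sy sx (λ t → ≈-sym (eq t)) i)
    where
    below : ∀ {x y} → Solution x → Solution y → (x ∘ inj₁) ≋ (y ∘ inj₁) → ∀ i → x (inj₂ i) ≤ y (inj₂ i)
    below {x} {y} sx sy eq i with zero-at sx
    ... | i₀ , z with difference sx i | difference sx i₀
    ... | e , ex , ey | e₀ , ex₀ , ey₀ = 0≤⇒≤ (≤-resp ≈-refl (≈-sym (≈-trans
            (solve 5 (λ a b c x₀ y₀ → b :- a := (c :+ ((b :- y₀) :- (a :- x₀))) :- (((c :- y₀)) :- (con (+ 0) :- x₀))) ≈-refl
               (x (inj₂ i)) (y (inj₂ i)) (y (inj₂ i₀)) (x (inj₂ Fin.zero)) (y (inj₂ Fin.zero)))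
            (≈-trans (+-cong (+-congˡ (x≈y⇒x-y≈0 (≈-trans (ey sy eq) (≈-sym ex))))
                     (-‿cong (x≈y⇒x-y≈0 (≈-trans (ey₀ sy eq) (≈-trans (≈-sym ex₀) (+-congʳ z))))))
              (solve 1 (λ c → (c :+ con (+ 0)) :- con (+ 0) := c) ≈-refl _))))
            (nonneg sy (inj₂ i₀)))

  y⇒cells : ∀ {x y} → Solution x → Solution y → (∀ i → x (inj₂ i) ≈ y (inj₂ i)) → (x ∘ inj₁) ≋ (y ∘ inj₁)
  y⇒cells sx sy eq = F.fan-injective (solution⇒chain sx) (solution⇒chain sy) λ j →
    ≈-trans (≈-sym (x-y≈0⇒x≈y (kernel sx j))) (≈-trans (+-cong (eq _) (-‿cong (eq _))) (x-y≈0⇒x≈y (kernel sy j)))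

  zero-solution : Solution (λ _ → 0#)
  zero-solution = record
    { nonneg = λ _ → ≤-refl ; kernel = λ j → linear-zero (L-linear j) (λ _ → ≈-refl)
    ; good = ((λ p → ⊥-elim (proj₂ p ≈-refl)) , λ p → ⊥-elim (proj₂ p ≈-refl)) , Fin.zero , λ p → proj₂ p ≈-refl }

  vanishes : ∀ {A : Set} {xs : List A} {f : A → ℝ} → (∀ x → 0# ≤ f x) → (∀ x → x List.∈ xs) → ¬ 0# < ∑ xs f → ∀ x → f x ≈ 0#
  vanishes f≥0 ∈xs ¬p x = ≤-antisym (≤-trans (∑-≥-member (λ {x} _ → f≥0 x) (∈xs x)) (≮⇒≥ ¬p)) (f≥0 x)

  τ ρ : (W → ℝ) → ℝ
  τ x = ∑ allCells (x ∘ inj₁)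
  ρ x = ∑ (allFin (ℕ.suc d)) (x ∘ inj₂)

  sum-linear : ∀ {A : Set} (xs : List A) (e : A → W) → Linear (λ x → ∑ xs (x ∘ e))
  sum-linear xs e = record
    { respects        = λ eq → ∑-cong xs (λ a → eq (e a))
    ; additive    = λ x y → ∑-+ xs (x ∘ e) (y ∘ e)
    ; homogeneous = λ k x → ∑-*ˡ k xs (x ∘ e)
    }

  τ-positive : ∀ {x} → Solution x → (∃ λ w → 0# < x w) → 0# < τ x
  τ-positive {x} sx (w , lt) with em₀ (0# < τ x)
  ... | yes p = p
  ... | no ¬p = ⊥-elim (0<⇒≉0 lt (cells⇒all sx zero-solution (vanishes (nonneg sx ∘ inj₁) ∈-allCells ¬p) w))

  ρ-positive : ∀ {x} → Solution x → (∃ λ w → 0# < x w) → 0# < ρ x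
  ρ-positive {x} sx (w , lt) with em₀ (0# < ρ x)
  ... | yes p = p
  ... | no ¬p = ⊥-elim (0<⇒≉0 lt (cells⇒all sx zero-solution
          (y⇒cells sx zero-solution (vanishes (nonneg sx ∘ inj₂) ∈-allFin ¬p)) w))

  -- The same rays are normalised twice: by the total of the cell coordinates, which gives points of
  -- `K`, and by the total of the others, which gives points of the boundary of the simplex.
  module Sτ = S.Slice τ (sum-linear allCells inj₁) τ-positive
  module Sρ = S.Slice ρ (sum-linear (allFin (ℕ.suc d)) inj₂) ρ-positive

  solution-from : ∀ {c} → ChF c → ∃ λ x → Solution x × (x ∘ inj₁) ≋ c
  solution-from {c} ch = build (argmin (allFin (ℕ.suc d)) (λ i → i ≡ i) v (∈-allFin Fin.zero) refl)
    where
    v : Fin (ℕ.suc d) → ℝ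
    v Fin.zero    = 0#
    v (Fin.suc j) = h c j
    build : (∃ λ i₀ → i₀ ≡ i₀ × (∀ {i} → i List.∈ allFin (ℕ.suc d) → i ≡ i → v i₀ ≤ v i)) →
            ∃ λ x → Solution x × (x ∘ inj₁) ≋ c
    build (i₀ , _ , le) = x , record
        { nonneg = λ { (inj₁ t) → nonneg ch t ; (inj₂ i) → ≤⇒0≤ (le (∈-allFin i) refl) }
        ; kernel = λ j → solve 2 (λ a b → ((a :- b) :- (con (+ 0) :- b)) :- a := con (+ 0)) ≈-refl (h c j) (v i₀)
        -- An entry attaining the minimum becomes 0, which supplies the vertex missing from a face
        -- of the boundary.
        ; good   = (allowed ch , linked ch) , i₀ , λ p → proj₂ p (≈-sym (-‿inverseʳ (v i₀)))
        } , λ _ → ≈-refl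
      where
      x : W → ℝ
      x (inj₁ t) = c t
      x (inj₂ i) = v i - v i₀

  -- Every subset of the coordinates counts as a vertex, which makes the vertex set finite at once;
  -- a subset that is no support lies in no face.
  K′ : SimplicialComplex
  K′ = record
    { vertices    = ≡.setoid T
    ; IsFace      = λ σ → (∀ {t} → t List.∈ σ → S.A t) × (∀ {t u} → t List.∈ σ → u List.∈ σ → t S.⊑ u ⊎ u S.⊑ t)
    ; down-closed = λ sub (al , lk) → (λ t∈ → al (sub t∈)) , λ t∈ u∈ → lk (sub t∈) (sub u∈)
    }

  Good′ : (T → Set) → Set
  Good′ P = (∀ {t} → P t → S.A t) × (∀ {t u} → P t → P u → t S.⊑ u ⊎ u S.⊑ t)

  ∂ : SimplicialComplex
  ∂ = ∂simplex d

  codingK : Coding K Cell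
  codingK = record
    { code           = PP.code
    ; code-cong      = λ {v} {w} → PP.code-cong {v} {w}
    ; code-injective = λ {v} {w} → PP.code-injective {v} {w}
    ; Good           = PP.GoodCells
    ; good-⊆         = λ sub (al , lk) → (λ q → al (sub q)) , λ q q′ → lk (sub q) (sub q′)
    ; decode         = λ (al , _) p → PP.vertexAt (al p) , PP.code-vertexAt (al p)
    ; face⇒good      = λ {σ} → PP.face⇒good {σ}
    ; good⇒face      = λ {σ} → PP.good⇒face {σ}
    }

  codingK′ : Coding K′ T
  codingK′ = record
    { code           = λ t → t
    ; code-cong      = λ e → e
    ; code-injective = λ e → e
    ; Good           = Good′
    ; good-⊆         = λ sub (al , lk) → (λ q → al (sub q)) , λ q q′ → lk (sub q) (sub q′)
    ; decode         = λ _ {t} _ → t , refl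
    ; face⇒good      = λ (al , lk) → (λ { (_ , v∈ , refl) → al v∈ }) ,
                       λ { (_ , v∈ , refl) (_ , w∈ , refl) → lk v∈ w∈ }
    ; good⇒face      = λ (al , lk) → (λ v∈ → al (_ , v∈ , refl)) , λ v∈ w∈ → lk (_ , v∈ , refl) (_ , w∈ , refl)
    }

  coding∂ : Coding ∂ (Fin (ℕ.suc d))
  coding∂ = record
    { code           = λ i → i
    ; code-cong      = λ e → e
    ; code-injective = λ e → e
    ; Good           = λ P → ∃ λ i → ¬ P i
    ; good-⊆         = λ sub (i , ¬p) → i , λ q → ¬p (sub q)
    ; decode         = λ _ {t} _ → t , refl
    ; face⇒good      = λ (i , i∉) → i , λ { (_ , v∈ , refl) → i∉ v∈ }
    ; good⇒face      = λ (i , ¬p) → i , λ i∈ → ¬p (_ , i∈ , refl)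
    }

  module RK = Realisation em real K allCells allCells-unique ∈-allCells codingK
  module RK′ = Realisation em real K′ S.ts (allSubsets-unique _) ∈-allSubsets codingK′
  module R∂ = Realisation em real ∂ (allFin (ℕ.suc d)) (Unique.allFin⁺ _) ∈-allFin coding∂

  chain′ : (p : RealisationPoint K′) → S.Ch (RK′.weights p)
  chain′ p = record
    { nonneg  = RK′.weights≥0 p
    ; allowed = proj₁ (RK′.Point.good (RK′.toPoint p))
    ; linked  = proj₂ (RK′.Point.good (RK′.toPoint p))
    }

  point′ : ∀ {k} → S.Ch k → ∑ S.ts k ≈ 1# → RK′.Point
  point′ {k} ch total = record
    { weight = k ; weight≥0 = nonneg ch ; good = allowed ch , linked ch ; total≈1 = total }

  ψ-point : RealisationPoint K′ → RK.Point
  ψ-point p = record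
    { weight   = Sτ.slice (RK′.weights p) ∘ inj₁
    ; weight≥0 = nonneg sol ∘ inj₁
    ; good     = proj₁ (good sol)
    ; total≈1  = ≈-trans (Sτ.slice-τ (chain′ p)) (RK′.Point.total≈1 (RK′.toPoint p))
    }
    where
    sol : Solution (Sτ.slice (RK′.weights p))
    sol = Sτ.slice-solution (chain′ p)

  φ-point : RealisationPoint K′ → R∂.Point
  φ-point p = record
    { weight   = Sρ.slice (RK′.weights p) ∘ inj₂
    ; weight≥0 = nonneg sol ∘ inj₂
    ; good     = proj₂ (good sol)
    ; total≈1  = ≈-trans (Sρ.slice-τ (chain′ p)) (RK′.Point.total≈1 (RK′.toPoint p))
    }
    where
    sol : Solution (Sρ.slice (RK′.weights p))
    sol = Sρ.slice-solution (chain′ p)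

  ψ : RealisationPoint K′ → RealisationPoint K
  ψ p = RK.fromPoint (ψ-point p)

  φ : RealisationPoint K′ → RealisationPoint ∂
  φ p = R∂.fromPoint (φ-point p)

  abstract

    compact′ : Compact (coord {K = K′})
    compact′ = CS.chainSpace-compact coord
      (λ p → chain-cong S._⊑_ S.A (RK′.weights-code p) (chain′ p) ,
             ≈-trans (∑-cong S.ts (λ t → ≈-sym (RK′.weights-code p t))) (RK′.Point.total≈1 (RK′.toPoint p)))
      (λ (ch , total) → RK′.fromPoint (point′ ch total) , λ _ → ≈-refl)
      where module CS = ChainSpace S.ts ∈-allSubsets S._⊑_ S.A

  SliceContinuous : ∀ {J : Set} → List J → (J → T → ℝ) → RealisationPoint K′ → ℝ → Set
  SliceContinuous js e p ε = ∃ λ δ → 0# < δ ×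
    (∀ (q : RealisationPoint K′) → Near δ (coord p) (coord q) → ∀ {j} → j List.∈ js →
      Close ε (∑ S.ts (λ t → RK′.weights p t * e j t)) (∑ S.ts (λ t → RK′.weights q t * e j t)))

  slice-cont : ∀ {J : Set} (js : List J) (e : J → T → ℝ) (p : RealisationPoint K′) {ε : ℝ} → 0# < ε →
               SliceContinuous js e p ε
  slice-cont {J} js e p {ε} ε>0 = convert (uniform js F (λ j →
      cont-∑ S.ts (λ t → cont-* (cont-coord t) (cont-const (e j t)))) (coord p) ε>0)
    where
    F : J → (T → ℝ) → ℝ
    F j x = ∑ S.ts (λ t → x t * e j t)
    same : ∀ (q : RealisationPoint K′) j → F j (coord q) ≈ F j (RK′.weights q)
    same q j = ∑-cong S.ts (λ t → *-congʳ (≈-sym (RK′.weights-code q t)))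
    convert : (∃ λ δ → 0# < δ × (∀ {x} → Near δ (coord p) x → ∀ {j} → j List.∈ js → Close ε (F j (coord p)) (F j x))) →
              SliceContinuous js e p ε
    convert (δ , δ>0 , near) = δ , δ>0 , λ q n {j} j∈ → close-resp (same p j) (same q j) (near n j∈)

  abstract

    ψ-cont : ContMap (coord {K = K′}) (coord {K = K}) ψ
    ψ-cont p ε>0 = let (δ , δ>0 , near) = slice-cont allCells (λ c t → Sτ.vertex t (inj₁ c)) p ε>0 in
      δ , δ>0 , λ {q} n v → near q n (∈-allCells (PP.code v))

    φ-cont : ContMap (coord {K = K′}) (coord {K = ∂}) φ
    φ-cont p ε>0 = let (δ , δ>0 , near) = slice-cont (allFin (ℕ.suc d)) (λ i t → Sρ.vertex t (inj₂ i)) p ε>0 in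
      δ , δ>0 , λ {q} n i → near q n (∈-allFin i)

  coord≋ : ∀ p q → RK′.weights p ≋ RK′.weights q → coord p ≋ coord q
  coord≋ p q eq t = ≈-trans (≈-sym (RK′.weights-code p t)) (≈-trans (eq t) (RK′.weights-code q t))

  abstract

    ψ-injective : ∀ {p q : RealisationPoint K′} → coord (ψ p) ≋ coord (ψ q) → coord p ≋ coord q
    ψ-injective {p} {q} eq = coord≋ p q (Sτ.slice-injective (chain′ p) (chain′ q)
      (cells⇒all (Sτ.slice-solution (chain′ p)) (Sτ.slice-solution (chain′ q)) λ t →
        ≈-trans (≈-sym (RK.weights-fromPoint (ψ-point p) t))
          (≈-trans (RK.coord⇒weights (ψ p) (ψ q) eq t) (RK.weights-fromPoint (ψ-point q) t))))

    φ-injective : ∀ {p q : RealisationPoint K′} → coord (φ p) ≋ coord (φ q) → coord p ≋ coord q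
    φ-injective {p} {q} eq = coord≋ p q (Sρ.slice-injective (chain′ p) (chain′ q)
      (cells⇒all sp sq (y⇒cells sp sq eq)))
      where
      sp : Solution (Sρ.slice (RK′.weights p))
      sp = Sρ.slice-solution (chain′ p)
      sq : Solution (Sρ.slice (RK′.weights q))
      sq = Sρ.slice-solution (chain′ q)

  chainK : (p : RealisationPoint K) → ChF (RK.weights p)
  chainK p = record
    { nonneg  = RK.weights≥0 p
    ; allowed = proj₁ (RK.Point.good (RK.toPoint p))
    ; linked  = proj₂ (RK.Point.good (RK.toPoint p))
    }

  weights-point′ : ∀ {k} (ch : S.Ch k) total t → RK′.weights (RK′.fromPoint (point′ ch total)) t ≈ k t
  weights-point′ ch total = RK′.weights-fromPoint (point′ ch total)

  slice-weights : ∀ {k} (e : T → ℝ) (ch : S.Ch k) total →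
    ∑ S.ts (λ t → RK′.weights (RK′.fromPoint (point′ ch total)) t * e t) ≈ ∑ S.ts (λ t → k t * e t)
  slice-weights e ch total = ∑-cong S.ts (λ t → *-congʳ (weights-point′ ch total t))

  abstract

    ψ-surjective : ∀ (q : RealisationPoint K) → ∃ λ p → coord (ψ p) ≋ coord q
    ψ-surjective q = from-solution (solution-from (chainK q))
      where
      from-slice : ∀ {x} → (x ∘ inj₁) ≋ RK.weights q → (∃ λ k → S.Ch k × Sτ.slice k ≋ x) → ∃ λ p → coord (ψ p) ≋ coord q
      from-slice {x} cells (k , ch , eq) = RK′.fromPoint (point′ ch sum-k) , λ v →
          ≈-trans (slice-weights (λ t → Sτ.vertex t (inj₁ (PP.code v))) ch sum-k)
            (≈-trans (eq (inj₁ (PP.code v))) (≈-trans (cells (PP.code v)) (RK.weights-code q v)))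
        where
        sum-k : ∑ S.ts k ≈ 1#
        sum-k = ≈-trans (≈-sym (Sτ.slice-τ ch)) (≈-trans (∑-cong allCells (λ t → ≈-trans (eq (inj₁ t)) (cells t)))
                  (RK.Point.total≈1 (RK.toPoint q)))
      from-solution : (∃ λ x → Solution x × (x ∘ inj₁) ≋ RK.weights q) → ∃ λ p → coord (ψ p) ≋ coord q
      from-solution (x , sx , cells) = from-slice {x} cells (Sτ.slice-surjective sx)

    φ-surjective : ∀ (q : RealisationPoint ∂) → ∃ λ p → coord (φ p) ≋ coord q
    φ-surjective q = from-fan (F.fan-surjective (λ j → y (Fin.suc j) - y Fin.zero))
      where
      y : Fin (ℕ.suc d) → ℝ
      y = coord q
      y-good : ∃ λ i → ¬ 0# < y i
      y-good = let (i , i∉) = isFace q in i , λ p → 0<⇒≉0 p (support q i i∉)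
      total-y : ∑ (allFin (ℕ.suc d)) y ≈ 1#
      total-y = ≈-trans (∑-cong (allFin (ℕ.suc d)) (λ i → ≈-sym (R∂.weights-code q i))) (R∂.Point.total≈1 (R∂.toPoint q))
      from-fan : (∃ λ c → ChF c × h c ≋ (λ j → y (Fin.suc j) - y Fin.zero)) → ∃ λ p → coord (φ p) ≋ coord q
      from-fan (c , ch , hc) = from-slice (Sρ.slice-surjective sx)
        where
        x : W → ℝ
        x (inj₁ t) = c t
        x (inj₂ i) = y i
        sx : Solution x
        sx = record
          { nonneg = λ { (inj₁ t) → nonneg ch t ; (inj₂ i) → RealisationPoint.nonneg q i }
          ; kernel = λ j → x≈y⇒x-y≈0 (≈-sym (hc j))
          ; good   = (allowed ch , linked ch) , y-good
          }
        from-slice : (∃ λ k → S.Ch k × Sρ.slice k ≋ x) → ∃ λ p → coord (φ p) ≋ coord q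
        from-slice (k , chk , eq) = RK′.fromPoint (point′ chk sum-k) , λ i →
            ≈-trans (slice-weights (λ t → Sρ.vertex t (inj₂ i)) chk sum-k) (eq (inj₂ i))
          where
          sum-k : ∑ S.ts k ≈ 1#
          sum-k = ≈-trans (≈-sym (Sρ.slice-τ chk)) (≈-trans (∑-cong (allFin (ℕ.suc d)) (λ i → eq (inj₂ i))) total-y)

-- The piecewise linear homeomorphism.

module PLHomeomorphism (em : ExcludedMiddle (suc 0ℓ)) (real : CompleteOrderedField) (LG : GeneratorEnrichedLattice) where

  open RealLemmas em real hiding (∑; zero; inverse)
  open Peeling em real
  open Compactness em real
  open Spaces em real
  open Topology real renaming (∣_∣ to ∥_∥)
  open RealisationPoint
  open PLSphere em real LG
  open Cells LG using (Cell; _⊴_)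

  K : SimplicialComplex
  K = PP.K

  ψ-cong : ∀ {p q : RealisationPoint K′} → coord p ≋ coord q → coord (ψ p) ≋ coord (ψ q)
  ψ-cong {p} {q} eq v = ∑-cong S.ts (λ t → *-congʳ (RK′.coord⇒weights p q eq t))

  φ-cong : ∀ {p q : RealisationPoint K′} → coord p ≋ coord q → coord (φ p) ≋ coord (φ q)
  φ-cong {p} {q} eq v = ∑-cong S.ts (λ t → *-congʳ (RK′.coord⇒weights p q eq t))

  ψ⁻¹ : RealisationPoint K → RealisationPoint K′
  ψ⁻¹ q = proj₁ (ψ-surjective q)

  φ⁻¹ : RealisationPoint ∂ → RealisationPoint K′
  φ⁻¹ q = proj₁ (φ-surjective q)

  ψ⁻¹-ψ : ∀ p → coord (ψ⁻¹ (ψ p)) ≋ coord p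
  ψ⁻¹-ψ p = ψ-injective {ψ⁻¹ (ψ p)} {p} (proj₂ (ψ-surjective (ψ p)))

  φ⁻¹-φ : ∀ p → coord (φ⁻¹ (φ p)) ≋ coord p
  φ⁻¹-φ p = φ-injective {φ⁻¹ (φ p)} {p} (proj₂ (φ-surjective (φ p)))

  f : RealisationPoint K → RealisationPoint ∂
  f q = φ (ψ⁻¹ q)

  g : RealisationPoint ∂ → RealisationPoint K
  g q = ψ (φ⁻¹ q)

  homeo : Homeomorphism ∥ K ∥ ∥ ∂ ∥
  homeo = homeomorphism coord coord f g
    (ContMap-∘ {cX = coord} {cY = coord} {cZ = coord} {f = ψ⁻¹} {g = φ}
      (Transport.ψ⁻¹-cont (coord {K = K}) (coord {K = K′}) compact′ ψ ψ-cont (λ {p} {q} → ψ-injective {p} {q}) ψ⁻¹ (proj₂ ∘ ψ-surjective)) φ-cont)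
    (ContMap-∘ {cX = coord} {cY = coord} {cZ = coord} {f = φ⁻¹} {g = ψ}
      (Transport.ψ⁻¹-cont (coord {K = ∂}) (coord {K = K′}) compact′ φ φ-cont (λ {p} {q} → φ-injective {p} {q}) φ⁻¹ (proj₂ ∘ φ-surjective)) ψ-cont)
    (λ y i → ≈-trans (φ-cong {ψ⁻¹ (ψ (φ⁻¹ y))} {φ⁻¹ y} (ψ⁻¹-ψ (φ⁻¹ y)) i) (proj₂ (φ-surjective y) i))
    (λ x v → ≈-trans (ψ-cong {φ⁻¹ (φ (ψ⁻¹ x))} {ψ⁻¹ x} (φ⁻¹-φ (ψ⁻¹ x)) v) (proj₂ (ψ-surjective x) v))

  subdivision : Subdivision K
  subdivision = record
    { complex     = K′
    ; finite      = S.ts , ∈-allSubsets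
    ; bijection   = record
      { to        = ψ
      ; cong      = λ {p} {q} → ψ-cong {p} {q}
      ; bijective = (λ {p} {q} → ψ-injective {p} {q}) , λ q → ψ⁻¹ q , λ {p} eq v →
          ≈-trans (ψ-cong {p} {ψ⁻¹ q} eq v) (proj₂ (ψ-surjective q) v)
      }
    ; linear      = (λ t v → Sτ.vertex t (inj₁ (PP.code v))) , λ p v →
                    ≈-sym (RK′.face-sum p (λ t → Sτ.vertex t (inj₁ (PP.code v))))
    ; subordinate = λ σ face → RK.select (Carrier σ) , (λ {x} {y} → RK.select-face (Carrier σ) (carrier-good σ face) {x} {y}) , supported σ
    }
    where
    Carrier : List S.T → Cell → Set
    Carrier σ c = ∃ λ t → t List.∈ σ × 0# < S.b t (inj₁ c)
    -- Of two comparable supports the larger contains both cells, and the cells in one support form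
    -- a chain.
    carrier-good : ∀ σ → SimplicialComplex.IsFace K′ σ → PP.GoodCells (Carrier σ)
    carrier-good σ (al , lk) =
      (λ (t , t∈ , lt) → proj₁ (proj₁ (S.Solution.good (proj₁ (S.b-solution (al t∈))))) lt) ,
      λ (t , t∈ , lt) (u , u∈ , lu) → link (al t∈) (al u∈) lt lu (lk t∈ u∈)
      where
      both : ∀ {t c e} → S.A t → 0# < S.b t (inj₁ c) → 0# < S.b t (inj₁ e) → c ⊴ e ⊎ e ⊴ c
      both a lt lu = proj₂ (proj₁ (S.Solution.good (proj₁ (S.b-solution a)))) lt lu
      link : ∀ {t u c e} → S.A t → S.A u → 0# < S.b t (inj₁ c) → 0# < S.b u (inj₁ e) → t S.⊑ u ⊎ u S.⊑ t → c ⊴ e ⊎ e ⊴ c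
      link at au lt lu (inj₁ u⊆t) = both at lt (proj₁ (S.b-positive at _) (u⊆t (proj₂ (S.b-positive au _) lu)))
      link at au lt lu (inj₂ t⊆u) = both au (proj₁ (S.b-positive au _) (t⊆u (proj₂ (S.b-positive at _) lt))) lu
    supported : ∀ σ (p : RealisationPoint K′) → SupportedOn K′ σ (coord p) → SupportedOn K (RK.select (Carrier σ)) (coord (ψ p))
    supported σ p sup v v∉ = ∑-zero S.ts (λ {t} _ → vanish t (em₀ (t List.∈ σ)))
      where
      vanish : ∀ t → Dec (t List.∈ σ) → RK′.weights p t * Sτ.vertex t (inj₁ (PP.code v)) ≈ 0#
      vanish t (no t∉) = ≈-trans (*-congʳ (≈-trans (RK′.weights-code p t) (sup t t∉))) (zeroˡ _)
      vanish t (yes t∈) = ≈-trans (*-congˡ (≈-trans (*-congˡ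
        (≤-antisym (≮⇒≥ (λ lt → v∉ (RK.∈-select⁺ (Carrier σ) {v} (t , t∈ , lt)))) (S.b≥0 t _))) (zeroʳ _))) (zeroʳ _)

  isPLSphere : IsPLSphere K
  isPLSphere = d , homeo , subdivision , (λ t i → Sρ.vertex t (inj₂ i)) , λ p i →
    ≈-trans (φ-cong {ψ⁻¹ (ψ p)} {p} (ψ⁻¹-ψ p) i) (≈-sym (RK′.face-sum p (λ t → Sρ.vertex t (inj₂ i))))

-- Directions, norms and Euclidean spaces.

module Directions (em : ExcludedMiddle (suc 0ℓ)) (real : CompleteOrderedField) where

  open RealLemmas em real
  open Peeling em real
  open Compactness em real
  open SquareRoot em real
  open Spaces em real
  open Topology real using (Near; euclidean; ∥_∥²)

  square-zero : ∀ {x} → x * x ≈ 0# → x ≈ 0#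
  square-zero {x} eq with ≤⊎> x 0# | ≤⊎> 0# x
  ... | inj₂ p | _      = ⊥-elim (0<⇒≉0 (0<-* p p) eq)
  ... | inj₁ p | inj₁ q = ≤-antisym p q
  ... | inj₁ _ | inj₂ q = ⊥-elim (0<⇒≉0 (0<-* (0<-neg q) (0<-neg q))
        (≈-trans (solve 1 (λ x → (:- x) :* (:- x) := x :* x) ≈-refl x) eq))

  square-injective : ∀ {x y} → 0# ≤ x → 0# ≤ y → x * x ≈ y * y → x ≈ y
  square-injective {x} {y} x≥0 y≥0 eq with ≤⊎> (x + y) 0#
  ... | inj₂ p = x-y≈0⇒x≈y (*-cancel-0 p (≈-trans
        (solve 2 (λ x y → (x :+ y) :* (x :- y) := x :* x :- y :* y) ≈-refl x y) (x≈y⇒x-y≈0 eq)))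
  ... | inj₁ p = ≈-trans (≤-antisym (≤-trans (x≤x+y y≥0) p) x≥0)
        (≤-antisym y≥0 (≤-trans (≤-resp ≈-refl (+-comm y x) (x≤x+y x≥0)) p))

  module _ {d : ℕ} where

    inner : (Fin d → ℝ) → (Fin d → ℝ) → ℝ
    inner x w = ∑ (allFin d) (λ i → x i * w i)

    -- Proportionality with a nonnegative factor, stated without division: polynomial equations and
    -- a weak inequality, so that the relation passes to limits.
    Parallel : (Fin d → ℝ) → (Fin d → ℝ) → Set
    Parallel x w = (∀ i j → x i * w j ≈ x j * w i) × 0# ≤ inner x w

    norm≥0 : ∀ (x : Fin d → ℝ) → 0# ≤ ∥ x ∥²
    norm≥0 x = ∑-nonneg (allFin d) (λ {i} _ → 0≤x² (x i))

    norm-zero : ∀ (x : Fin d → ℝ) → ∥ x ∥² ≈ 0# → ∀ i → x i ≈ 0#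
    norm-zero x eq i = square-zero (∑-zero-member {f = λ i → x i * x i} (λ {i} _ → 0≤x² (x i)) eq (∈-allFin i))

    norm-cong : ∀ {x y : Fin d → ℝ} → x ≋ y → ∥ x ∥² ≈ ∥ y ∥²
    norm-cong eq = ∑-cong (allFin d) (λ i → *-cong (eq i) (eq i))

    norm-scale : ∀ k (x : Fin d → ℝ) → ∥ (λ i → k * x i) ∥² ≈ (k * k) * ∥ x ∥²
    norm-scale k x = ≈-trans (∑-cong (allFin d) (λ i → solve 2 (λ k x → (k :* x) :* (k :* x) := (k :* k) :* (x :* x)) ≈-refl k (x i)))
      (∑-*ˡ (k * k) (allFin d) _)

    norm>0 : ∀ (x : Fin d → ℝ) → ¬ (∀ i → x i ≈ 0#) → 0# < ∥ x ∥²
    norm>0 x nz with ≤⊎> ∥ x ∥² 0#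
    ... | inj₂ p = p
    ... | inj₁ q = ⊥-elim (nz (norm-zero x (≤-antisym q (norm≥0 x))))

    parallel-expand : ∀ {x w : Fin d → ℝ} → Parallel x w → ∀ i → ∥ x ∥² * w i ≈ inner x w * x i
    parallel-expand {x} {w} (par , _) i = ≈-trans (≈-sym (∑-*ʳ (w i) (allFin d) (λ j → x j * x j)))
      (≈-trans (∑-cong (allFin d) (λ j → ≈-trans (*-assoc (x j) (x j) (w i)) (≈-trans (*-congˡ (≈-sym (par i j)))
        (solve 3 (λ a b c → a :* (b :* c) := (a :* c) :* b) ≈-refl (x j) (x i) (w j)))))
        (∑-*ʳ (x i) (allFin d) (λ j → x j * w j)))

    parallel-scale : ∀ {k} (w : Fin d → ℝ) → 0# ≤ k → Parallel (λ i → k * w i) w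
    parallel-scale {k} w k≥0 = (λ i j → solve 3 (λ k a b → (k :* a) :* b := (k :* b) :* a) ≈-refl k (w i) (w j)) ,
      ≤-resp ≈-refl (≈-sym (≈-trans (∑-cong (allFin d) (λ i → *-assoc k (w i) (w i))) (∑-*ˡ k (allFin d) _)))
        (*-nonneg k≥0 (norm≥0 w))

    parallel-scaleʳ : ∀ {k} (w : Fin d → ℝ) → 0# ≤ k → Parallel w (λ i → k * w i)
    parallel-scaleʳ {k} w k≥0 = (λ i j → solve 3 (λ k a b → a :* (k :* b) := b :* (k :* a)) ≈-refl k (w i) (w j)) ,
      ≤-resp ≈-refl (≈-sym (≈-trans (∑-cong (allFin d) (λ i → solve 2 (λ k a → a :* (k :* a) := k :* (a :* a)) ≈-refl k (w i)))
        (∑-*ˡ k (allFin d) _))) (*-nonneg k≥0 (norm≥0 w))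

    inner>0 : ∀ {x w : Fin d → ℝ} → Parallel x w → 0# < ∥ x ∥² → ¬ (∀ i → w i ≈ 0#) → 0# < inner x w
    inner>0 {x} {w} par N>0 nz with ≤⊎> (inner x w) 0#
    ... | inj₂ p = p
    ... | inj₁ q = ⊥-elim (nz (λ i → *-cancel-0 N>0 (≈-trans (parallel-expand par i)
            (≈-trans (*-congʳ (≤-antisym q (proj₂ par))) (zeroˡ _)))))

    -- Expanding `w` along either vector gives `a x = b y` with nonnegative `a` and `b`. Equal norms
    -- force `a = b`, and `a` is positive because `w` is not zero.
    parallel-unique : ∀ {x y w : Fin d → ℝ} → Parallel x w → Parallel y w → ∥ x ∥² ≈ ∥ y ∥² → 0# < ∥ x ∥² →
                      ¬ (∀ i → w i ≈ 0#) → x ≋ y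
    parallel-unique {x} {y} {w} px py eq N>0 nz i = *-cancelˡ-≈ a>0
      (≈-trans (same i) (*-congʳ (≈-sym a≈b)))
      where
      a b : ℝ
      a = inner x w
      b = inner y w
      a>0 : 0# < a
      a>0 = inner>0 px N>0 nz
      same : ∀ i → a * x i ≈ b * y i
      same i = ≈-trans (≈-sym (parallel-expand px i)) (≈-trans (*-congʳ eq) (parallel-expand py i))
      a≈b : a ≈ b
      a≈b = square-injective (<⇒≤ a>0) (proj₂ py) (*-cancelˡ-≈ N>0 (≈-trans (*-comm _ _)
        (≈-trans (≈-sym (norm-scale a x)) (≈-trans (norm-cong same) (≈-trans (norm-scale b y)
          (≈-trans (*-comm _ _) (*-congʳ (≈-sym eq))))))))

    square-≤1 : ∀ {a} → a * a ≤ 1# → a ≤ 1# × - 1# ≤ a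
    square-≤1 {a} le = upper le , 0≤⇒≤ (≤-resp ≈-refl (solve 1 (λ a → con (+ 1) :- (:- a) := a :- (:- con (+ 1))) ≈-refl a)
        (≤⇒0≤ (upper (≤-resp (solve 1 (λ a → a :* a := (:- a) :* (:- a)) ≈-refl a) ≈-refl le))))
      where
      upper : ∀ {a} → a * a ≤ 1# → a ≤ 1#
      upper {a} le = ≮⇒≥ λ 1<a → <⇒≱ (<-trans 1<a (<-resp (*-identityʳ a) ≈-refl (*-monoˡ-< (<-trans 0<1 1<a) 1<a))) le

    coordinate-bounds : ∀ (x : Fin d → ℝ) → ∥ x ∥² ≤ 1# → ∀ i → x i ≤ 1# × - 1# ≤ x i
    coordinate-bounds x le i = square-≤1 (≤-trans (∑-≥-member {f = λ i → x i * x i} (λ {i} _ → 0≤x² (x i)) (∈-allFin i)) le)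

    norm-cont : Contℝ {Fin d} ∥_∥²
    norm-cont = cont-∑ (allFin d) (λ i → cont-* (cont-coord i) (cont-coord i))

    ball-compact : Compact {Σ (Fin d → ℝ) λ p → ∥ p ∥² ≤ 1#} proj₁
    ball-compact = bounded∧closed⇒compact proj₁ (allFin d) ∈-allFin
      (λ (x , le) i → proj₂ (coordinate-bounds x le i)) (λ (x , le) i → proj₁ (coordinate-bounds x le i))
      (λ {r} lim → (r , 0≤⇒≤ (limit-≥0 (cont-- (cont-const 1#) norm-cont) lim
        (λ { (( x , le) , eq) → ≤⇒0≤ (≤-trans (≈⇒≤ (norm-cong eq)) le) }))) , λ _ → ≈-refl)

    sphere-compact : Compact {Σ (Fin d → ℝ) λ p → ∥ p ∥² ≈ 1#} proj₁
    sphere-compact = bounded∧closed⇒compact proj₁ (allFin d) ∈-allFin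
      (λ (x , eq) i → proj₂ (coordinate-bounds x (≈⇒≤ eq) i)) (λ (x , eq) i → proj₁ (coordinate-bounds x (≈⇒≤ eq) i))
      (λ {r} lim → (r , x-y≈0⇒x≈y (limit-≈0 (cont-- norm-cont (cont-const 1#)) lim
        (λ { ((x , eq) , e) → x≈y⇒x-y≈0 (≈-trans (norm-cong e) eq) }))) , λ _ → ≈-refl)

  module _ {X Y I J : Set} (cX : X → I → ℝ) (cY : Y → J → ℝ) (f : X → Y) where

    Approached : X → Y → Set
    Approached x y = ∀ {ε} → 0# < ε → ∃ λ x′ → Near ε (cX x) (cX x′) × Near ε (cY y) (cY (f x′))

    graph-point : X → Y → I ⊎ J → ℝ
    graph-point x y = Sum.[ cX x , cY y ]

    graph-limit : ∀ {x y} → Approached x y → Limit (graph-point x y) (λ p → ∃ λ x′ → p ≡ graph-point x′ (f x′))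
    graph-limit app ε>0 = let (x′ , n , n′) = app ε>0 in graph-point x′ (f x′) , (x′ , refl) , λ
      { (inj₁ i) → n i ; (inj₂ j) → n′ j }

    -- A continuous equation between argument and value extends from the graph to its closure, taken
    -- in the product of the two coordinate spaces.
    closed-≈0 : ∀ {F} → Contℝ {I ⊎ J} F → (∀ x′ → F (graph-point x′ (f x′)) ≈ 0#) →
                ∀ x y → Approached x y → F (graph-point x y) ≈ 0#
    closed-≈0 cF z x y app = limit-≈0 cF (graph-limit app) (λ { (x′ , refl) → z x′ })

    closed-≥0 : ∀ {F} → Contℝ {I ⊎ J} F → (∀ x′ → 0# ≤ F (graph-point x′ (f x′))) →
                ∀ x y → Approached x y → 0# ≤ F (graph-point x y)
    closed-≥0 cF z x y app = limit-≥0 cF (graph-limit app) (λ { (x′ , refl) → z x′ })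

  -- `W` collects the points near which `f` takes values only at points of `V`. It is open by
  -- halving `δ`; that it contains the image of `V` is the continuity of the inverse.
  compact-inducing : ∀ {X Y I J : Set} (cX : X → I → ℝ) (cY : Y → J → ℝ) → Compact cX → ∀ {f : X → Y} → ContMap cX cY f →
    (∀ {x x′} → cY (f x) ≋ cY (f x′) → cX x ≋ cX x′) →
    ∀ V → TopologicalSpace.Open (euclidean cX) V → ∃ λ W → TopologicalSpace.Open (euclidean cY) W × V ≐ (W ∘ f)
  compact-inducing {X} {Y} cX cY compact {f} cf injective V open-V = W , open-W , to , from
    where
    W : Y → Set
    W y = ∃ λ δ → 0# < δ × (∀ x → Near δ (cY y) (cY (f x)) → V x)
    open-W : TopologicalSpace.Open (euclidean cY) W
    open-W {y} (δ , δ>0 , near) = let (h , h>0 , h+h) = half-of δ>0 in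
      h , h>0 , λ {y′} n → h , h>0 , λ x n′ → near x (λ j → close-trans h+h (n j) (n′ j))
    to : ∀ {x} → V x → W (f x)
    to {x} vx = let (ε , ε>0 , inV) = open-V vx
                    (δ , δ>0 , near) = compact-injection cX cY compact {f} cf injective x ε>0 in
      δ , δ>0 , λ x′ n → inV (near n)
    from : ∀ {x} → W (f x) → V x
    from {x} (δ , δ>0 , near) = near x (λ j → close-≈ δ>0 ≈-refl)

  -- Distinct points differ in some coordinate, where two strips of half the difference separate
  -- them.
  euclidean-hausdorff : ∀ {X I : Set} (c : X → I → ℝ) → Hausdorff (euclidean c)
  euclidean-hausdorff {X} {I} c x y x≉y = separate (em₀ (∃ λ i → ¬ c x i ≈ c y i))
    where
    stable : ∀ {P : Set} → Dec P → ¬ ¬ P → P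
    stable (yes p) _ = p
    stable (no ¬p) ¬¬p = ⊥-elim (¬¬p ¬p)
    Strip : I → ℝ → X → X → Set
    Strip i h x z = Close h (c z i) (c x i)
    open-strip : ∀ i h x → TopologicalSpace.Open (euclidean c) (Strip i h x)
    open-strip i h x {z} (p , q) = let (δ , δ>0 , le , le′) = smaller (<⇒0< p) (<⇒0< q) in δ , δ>0 , λ {z′} n →
      0<⇒< (<-resp ≈-refl (solve 4 (λ h x z z′ → (h :- (z :- x)) :- (z′ :- z) := h :- (z′ :- x)) ≈-refl h (c x i) (c z i) (c z′ i))
        (<⇒0< (<-≤-trans (proj₂ (n i)) le))) ,
      0<⇒< (<-resp ≈-refl (solve 4 (λ h x z z′ → (h :- (x :- z)) :- (z :- z′) := h :- (x :- z′)) ≈-refl h (c x i) (c z i) (c z′ i))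
        (<⇒0< (<-≤-trans (proj₁ (n i)) le′)))
    Separated : Set₁
    Separated = ∃ λ V → ∃ λ W → TopologicalSpace.Open (euclidean c) V × TopologicalSpace.Open (euclidean c) W ×
                V x × W y × ¬ (V ≬ W)
    strips : ∀ i h → 0# < h → (∀ z → Strip i h x z → ¬ Strip i h y z) → Separated
    strips i h h>0 apart = Strip i h x , Strip i h y , open-strip i h x , open-strip i h y ,
      close-≈ h>0 ≈-refl , close-≈ h>0 ≈-refl , λ (z , p , q) → apart z p q
    too-close : ∀ {a b z h} → b < a → h + h ≈ a - b → Close h z b → ¬ Close h z a
    too-close lt h+h p q = <⇒≱ (proj₂ (close-trans h+h (close-sym p) q)) ≤-refl
    separate : Dec (∃ λ i → ¬ c x i ≈ c y i) → Separated
    separate (no none) = ⊥-elim (x≉y (λ i → stable (c x i ≈? c y i) (λ ne → none (i , ne))))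
    separate (yes (i , ne)) with ≤⊎> (c x i) (c y i)
    ... | inj₂ lt = let (h , h>0 , h+h) = half-of (<⇒0< lt) in
          strips i h h>0 (λ z p q → too-close lt h+h q p)
    ... | inj₁ le = let (h , h>0 , h+h) = half-of (<⇒0< {c x i} {c y i} (le , ne)) in
          strips i h h>0 (λ z p q → too-close (le , ne) h+h p q)

-- The realised order complex as a space of weights.

module MinorSpace (em : ExcludedMiddle (suc 0ℓ)) (real : CompleteOrderedField) (LG : GeneratorEnrichedLattice) where

  open RealLemmas em real
  open Peeling em real
  open Spaces em real
  open Cells LG using (Cell; _⊴_; allCells; allCells-unique; ∈-allCells)
  open ProperPart LG using (Proper)

  open ChainSpace allCells ∈-allCells _⊴_ Proper public using (IsPoint; point-closed; chainSpace-compact)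

  X : Set
  X = Σ (Cell → ℝ) IsPoint

  open Chain

  module Restricted (y₀ : Cell) (k : Cell → ℝ) where

    -- The weights away from the summit `y₀`. They are all that the fan of `y₀` can see, since `y₀`
    -- has the zero vector there.
    interior : Cell → ℝ
    interior t = k t - at y₀ (k y₀) t

    interior-at : interior y₀ ≈ 0#
    interior-at = x≈y⇒x-y≈0 (≈-sym at-self)

    interior-off : ∀ {t} → t ≢ y₀ → interior t ≈ k t
    interior-off {t} t≢ = ≈-trans (+-congˡ (-‿cong (at-other t≢))) (solve 1 (λ a → a :- con (+ 0) := a) ≈-refl (k t))

    split : ∀ t → k t ≈ interior t + at y₀ (k y₀) t
    split t = solve 2 (λ a b → a := (a :- b) :+ b) ≈-refl (k t) (at y₀ (k y₀) t)

    interior-total : ∑ allCells interior ≈ ∑ allCells k - k y₀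
    interior-total = x-y≈0⇒x≈y (≈-trans (solve 3 (λ a b e → a :- (b :- e) := (a :+ e) :- b) ≈-refl _ _ _)
      (x≈y⇒x-y≈0 (≈-trans (+-congˡ (≈-sym total-at)) (≈-trans (≈-sym (∑-+ allCells interior (at y₀ (k y₀))))
        (∑-cong allCells (λ t → ≈-sym (split t)))))))
      where
      total-at : ∑ allCells (at y₀ (k y₀)) ≈ k y₀
      total-at = ≈-trans (∑-single allCells-unique (∈-allCells y₀) (λ {t} → at-other {t = t})) at-self

-- Weights and directions in a closed cell.

module ClosedCell (em : ExcludedMiddle (suc 0ℓ)) (real : CompleteOrderedField) (LG : GeneratorEnrichedLattice)
  (y₀ : Cells.Cell LG) (proper : ProperPart.Proper LG y₀)
  {d : ℕ} (γ : Fin d → Fin (GeneratorEnrichedLattice.size LG))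
  (γ-∈ : ∀ j → γ j ∈ proj₂ y₀) (γ-onto : ∀ {g} → g ∈ proj₂ y₀ → ∃ λ j → γ j ≡ g)
  (γ-injective : ∀ {i j} → γ i ≡ γ j → i ≡ j) where

  open RealLemmas em real
  open Peeling em real
  open Linearity em real using (chain-scale)
  open Compactness em real
  open SquareRoot em real
  open Spaces em real
  open Directions em real
  open Topology real using (∥_∥²)
  open MinorSpace em real LG
  open Cells LG using (Cell; Valid; _⊴_; allCells; allCells-unique; ∈-allCells; ⊴-refl; ⊴-trans; ⊴-antisym; antisym)
  open ProperPart LG using (Proper)
  private module FF = Fan em real LG
  open FF using (sgn-kept)
  module Fₘ = FF.FanAt y₀ (proj₁ proper) γ γ-∈ γ-onto γ-injective
  open Fₘ using () renaming (comb to h; Ch to Chₘ; A to Below)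
  open Chain

  Supported : (Cell → ℝ) → Set
  Supported k = ∀ {t} → 0# < k t → t ⊴ y₀

  -- The point of the closed cell with direction v: the summit y₀ has weight
  -- 1 − |v|² and the fan image of the remaining weights points towards v.
  Points : (Fin d → ℝ) → (Cell → ℝ) → Set
  Points v k = k y₀ ≈ 1# - ∥ v ∥² × Parallel v (h k)

  s-summit : ∀ j → Fₘ.s y₀ j ≈ 0#
  s-summit j = sgn-kept (λ γ≤ → proj₂ (v₀ (γ-∈ j)) (antisym γ≤ (proj₁ (v₀ (γ-∈ j)))))
      (subst (_∈ proj₂ y₀) (sym (∨-absorb (proj₁ (v₀ (γ-∈ j))))) (γ-∈ j))
    where
    v₀ : Valid y₀
    v₀ = proj₁ proper
    open Minors LG using (∨-absorb)

  module Point {k : Cell → ℝ} (isPoint : IsPoint k) (supported : Supported k) where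

    open Restricted y₀ k public

    interior-positive : ∀ {t} → 0# < interior t → t ≢ y₀ × 0# < k t
    interior-positive {t} p = off , <-resp ≈-refl (interior-off off) p
      where
      off : t ≢ y₀
      off refl = 0<⇒≉0 p interior-at

    interior-chain : Chₘ interior
    interior-chain = record
      { nonneg  = λ t → nn t (em₀ (t ≡ y₀))
      ; allowed = λ p → let (off , q) = interior-positive p in proj₁ (allowed (proj₁ isPoint) q) , supported q , off
      ; linked  = λ p q → linked (proj₁ isPoint) (proj₂ (interior-positive p)) (proj₂ (interior-positive q))
      }
      where
      nn : ∀ t → Dec (t ≡ y₀) → 0# ≤ interior t
      nn t (yes refl) = ≈⇒≤ (≈-sym interior-at)
      nn t (no t≢) = ≤-resp ≈-refl (≈-sym (interior-off t≢)) (nonneg (proj₁ isPoint) t)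

    total : ∑ allCells interior ≈ 1# - k y₀
    total = ≈-trans interior-total (+-congʳ (proj₂ isPoint))

    h-interior : h interior ≋ h k
    h-interior j = ≈-trans (Fₘ.comb-minus allCells-unique ∈-allCells k y₀ (k y₀) j)
      (≈-trans (+-congˡ (-‿cong (≈-trans (*-congˡ (s-summit j)) (zeroʳ _)))) (solve 1 (λ a → a :- con (+ 0) := a) ≈-refl (h k j)))

    interior-vanishes : 1# - k y₀ ≈ 0# → ∀ t → interior t ≈ 0#
    interior-vanishes eq t = ∑-zero-member {f = interior} (λ {t} _ → nonneg interior-chain t) (≈-trans total eq) (∈-allCells t)

    -- Some weight lies off the summit, and by uniqueness of decompositions only zero weights
    -- combine to the zero vector.
    h-nonzero : 0# < 1# - k y₀ → ¬ (∀ j → h k j ≈ 0#)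
    h-nonzero p z = 0<⇒≉0 p (≈-trans (≈-sym total) (∑-zero allCells (λ {t} _ → vanish t)))
      where
      vanish : ∀ t → interior t ≈ 0#
      vanish = Fₘ.fan-injective interior-chain (empty-chain _⊴_ Below) (λ j → ≈-trans (h-interior j) (≈-trans (z j)
        (≈-sym (Fₘ.comb-zero (λ _ → ≈-refl) j))))

  norm≈ : ∀ {v k} → Points v k → ∥ v ∥² ≈ 1# - k y₀
  norm≈ {v} {k} (eq , _) = ≈-trans (solve 1 (λ n → n := con (+ 1) :- (con (+ 1) :- n)) ≈-refl ∥ v ∥²) (+-congˡ (-‿cong (≈-sym eq)))

  -- The summit weight is fixed by the norm of `v`. Both `h k` and `h l` point along `v`; with `a`
  -- and `b` their inner products with `v`, the interiors of `k` and `l` multiplied by `b` and `a`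
  -- have the same image, and agree by uniqueness in the fan. Both interiors have total `∥ v ∥²`,
  -- whence `a = b`. If `v` is 0, all weight is at the summit.
  weights-unique : ∀ {v k l} → IsPoint k → Supported k → IsPoint l → Supported l → Points v k → Points v l → k ≋ l
  weights-unique {v} {k} {l} pk sk pl sl rk rl t =
    ≈-trans (K.split t) (≈-trans (+-cong (same (≤⊎> ∥ v ∥² 0#)) (summit (em₀ (t ≡ y₀)))) (≈-sym (L.split t)))
    where
    module K = Point pk sk
    module L = Point pl sl
    k≈l : k y₀ ≈ l y₀
    k≈l = ≈-trans (proj₁ rk) (≈-sym (proj₁ rl))
    summit : (e : Dec (t ≡ y₀)) → term e (k y₀) ≈ term e (l y₀)
    summit e = term-cong e e (λ z → z) (λ z → z) k≈l
    same : ∥ v ∥² ≤ 0# ⊎ 0# < ∥ v ∥² → K.interior t ≈ L.interior t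
    same (inj₁ le) = ≈-trans (K.interior-vanishes (≈-trans (≈-sym (norm≈ {v} {k} rk)) N≈0) t)
        (≈-sym (L.interior-vanishes (≈-trans (≈-sym (norm≈ {v} {l} rl)) N≈0) t))
      where
      N≈0 : ∥ v ∥² ≈ 0#
      N≈0 = ≤-antisym le (norm≥0 v)
    same (inj₂ N>0) = *-cancelˡ-≈ b>0 (≈-trans (*-comm b _) (≈-trans (scaled t) (≈-trans (*-comm _ a) (*-congʳ a≈b))))
      where
      a b : ℝ
      a = inner v (h k)
      b = inner v (h l)
      a>0 : 0# < a
      a>0 = inner>0 (proj₂ rk) N>0 (K.h-nonzero (<-resp ≈-refl (norm≈ {v} {k} rk) N>0))
      b>0 : 0# < b
      b>0 = inner>0 (proj₂ rl) N>0 (L.h-nonzero (<-resp ≈-refl (norm≈ {v} {l} rl) N>0))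
      h-scaled : ∀ {c : Cell → ℝ} e j → h (λ t → c t * e) j ≈ e * h c j
      h-scaled {c} e j = ≈-trans (Fₘ.comb-cong (λ t → *-comm (c t) e) j) (Fₘ.comb-scale e c j)
      scaled : (λ t → K.interior t * b) ≋ (λ t → L.interior t * a)
      scaled = Fₘ.fan-injective (chain-scale (λ _ → <⇒≤ b>0) K.interior-chain) (chain-scale (λ _ → <⇒≤ a>0) L.interior-chain) λ j →
          ≈-trans (h-scaled {K.interior} b j) (≈-trans (*-congˡ (K.h-interior j))
            (≈-trans (*-cancelˡ-≈ N>0 (≈-trans (solve 3 (λ n b w → n :* (b :* w) := b :* (n :* w)) ≈-refl ∥ v ∥² b (h k j))
              (≈-trans (*-congˡ (parallel-expand (proj₂ rk) j))
                (≈-trans (solve 3 (λ a b v → b :* (a :* v) := a :* (b :* v)) ≈-refl a b (v j))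
                  (≈-trans (*-congˡ (≈-sym (parallel-expand (proj₂ rl) j)))
                    (solve 3 (λ n a w → a :* (n :* w) := n :* (a :* w)) ≈-refl ∥ v ∥² a (h l j)))))))
              (≈-trans (*-congˡ (≈-sym (L.h-interior j))) (≈-sym (h-scaled {L.interior} a j)))))
      a≈b : a ≈ b
      a≈b = *-cancelˡ-≈ N>0 (≈-sym (≈-trans (*-congʳ (≈-trans (norm≈ {v} {k} rk) (≈-sym K.total)))
        (≈-trans (≈-sym (∑-*ʳ b allCells K.interior)) (≈-trans (∑-cong allCells scaled) (≈-trans (∑-*ʳ a allCells L.interior)
          (*-congʳ (≈-trans L.total (≈-sym (norm≈ {v} {l} rl)))))))))

  direction-unique : ∀ {v w k} → IsPoint k → Supported k → Points v k → Points w k → v ≋ w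
  direction-unique {v} {w} {k} pk sk rv rw = go (≤⊎> ∥ v ∥² 0#)
    where
    module K = Point pk sk
    v≈w : ∥ v ∥² ≈ ∥ w ∥²
    v≈w = ≈-trans (norm≈ {v} {k} rv) (≈-sym (norm≈ {w} {k} rw))
    go : ∥ v ∥² ≤ 0# ⊎ 0# < ∥ v ∥² → v ≋ w
    go (inj₁ le) i = ≈-trans (norm-zero v (≤-antisym le (norm≥0 v)) i)
      (≈-sym (norm-zero w (≤-antisym (≤-resp v≈w ≈-refl le) (norm≥0 w)) i))
    go (inj₂ N>0) = parallel-unique (proj₂ rv) (proj₂ rw) v≈w N>0 (K.h-nonzero (<-resp ≈-refl (norm≈ {v} {k} rv) N>0))

  -- Rescale `h k` to squared length `1 − k y₀`, which takes a square root; if all weight is at the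
  -- summit, the factor 0 is taken.
  direction-exists : ∀ {k} → IsPoint k → Supported k → ∃ λ v → ∥ v ∥² ≤ 1# × Points v k
  direction-exists {k} pk sk = go (≤⊎> (1# - k y₀) 0#)
    where
    module K = Point pk sk
    N≤1 : 1# - k y₀ ≤ 1#
    N≤1 = 0≤⇒≤ (≤-resp ≈-refl (solve 1 (λ a → a := con (+ 1) :- (con (+ 1) :- a)) ≈-refl (k y₀)) (nonneg (proj₁ pk) y₀))
    N≥0 : 0# ≤ 1# - k y₀
    N≥0 = ≤-resp ≈-refl K.total (∑-nonneg allCells (λ {t} _ → nonneg K.interior-chain t))
    summit : ∀ {n} → n ≈ 1# - k y₀ → k y₀ ≈ 1# - n
    summit eq = ≈-trans (solve 1 (λ n → n := con (+ 1) :- (con (+ 1) :- n)) ≈-refl (k y₀)) (+-congˡ (-‿cong (≈-sym eq)))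
    go : 1# - k y₀ ≤ 0# ⊎ 0# < 1# - k y₀ → ∃ λ v → ∥ v ∥² ≤ 1# × Points v k
    go (inj₁ le) = (λ i → 0# * h k i) , ≤-trans (≈⇒≤ N≈0) (<⇒≤ 0<1) ,
        summit (≈-trans N≈0 (≤-antisym N≥0 le)) , parallel-scale (h k) ≤-refl
      where
      N≈0 : ∥ (λ i → 0# * h k i) ∥² ≈ 0#
      N≈0 = ≈-trans (norm-scale 0# (h k)) (≈-trans (*-congʳ (zeroˡ 0#)) (zeroˡ _))
    go (inj₂ N>0) = scale (inv⁺ (norm>0 (h k) (K.h-nonzero N>0)))
      where
      scale : (∃ λ i → 0# < i × ∥ h k ∥² * i ≈ 1#) → ∃ λ v → ∥ v ∥² ≤ 1# × Points v k
      scale (i , i>0 , Mi≈1) = root (sqrt (*-nonneg N≥0 (<⇒≤ i>0)))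
        where
        root : (∃ λ b → 0# ≤ b × b * b ≈ (1# - k y₀) * i) → ∃ λ v → ∥ v ∥² ≤ 1# × Points v k
        root (b , b≥0 , b²) = (λ j → b * h k j) , ≤-trans (≈⇒≤ norm) N≤1 , summit norm , parallel-scale (h k) b≥0
          where
          norm : ∥ (λ j → b * h k j) ∥² ≈ 1# - k y₀
          norm = ≈-trans (norm-scale b (h k)) (≈-trans (*-congʳ b²)
            (≈-trans (solve 3 (λ n i m → (n :* i) :* m := n :* (m :* i)) ≈-refl (1# - k y₀) i ∥ h k ∥²)
              (≈-trans (*-congˡ Mi≈1) (*-identityʳ _))))

  -- Decompose `v` in the fan, rescale the coefficients to total `∥ v ∥²`, and give the remaining
  -- `1 − ∥ v ∥²` to the summit.
  weights-exist : ∀ v → ∥ v ∥² ≤ 1# → ∃ λ k → IsPoint k × Supported k × Points v k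
  weights-exist v N≤1 = from-fan (Fₘ.fan-surjective v)
    where
    Goal : Set
    Goal = ∃ λ k → IsPoint k × Supported k × Points v k
    from-fan : (∃ λ c → Chₘ c × h c ≋ v) → Goal
    from-fan (c , ch , hc) = factor (≤⊎> (∑ allCells c) 0#)
      where
      build : ∀ α → 0# ≤ α → α * ∑ allCells c ≈ ∥ v ∥² → Goal
      build α α≥0 αT = k , (record { nonneg = nn ; allowed = al ; linked = lk } , total-k) , supported , summit ,
          ((λ i j → ≈-trans (*-congˡ (hk j)) (≈-trans (proj₁ par i j) (*-congˡ (≈-sym (hk i))))) ,
           ≤-resp ≈-refl (∑-cong (allFin d) (λ i → *-congˡ (≈-sym (hk i)))) (proj₂ par))
        where
        e : ℝ
        e = 1# - ∥ v ∥²
        k : Cell → ℝ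
        k t = α * c t + at y₀ e t
        at≥0 : ∀ t → 0# ≤ at y₀ e t
        at≥0 t with em₀ (t ≡ y₀)
        ... | yes _ = ≤⇒0≤ N≤1
        ... | no _  = ≤-refl
        nn : ∀ t → 0# ≤ k t
        nn t = 0≤-+ (*-nonneg α≥0 (nonneg ch t)) (at≥0 t)
        cases : ∀ {t} → 0# < k t → t ≡ y₀ ⊎ 0# < c t
        cases {t} p with em₀ (t ≡ y₀) | ≤⊎> (c t) 0#
        ... | yes eq | _      = inj₁ eq
        ... | no _   | inj₂ q = inj₂ q
        ... | no _   | inj₁ q = ⊥-elim (0<⇒≉0 p (≈-trans (+-identityʳ _) (≈-trans (*-congˡ (≤-antisym q (nonneg ch t))) (zeroʳ α))))
        below-proper : ∀ {t} → Below t → Proper t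
        below-proper (v , t⊴ , t≢) = v , ⊴-trans t⊴ (proj₁ (proj₂ proper)) ,
          λ { refl → proj₂ (proj₂ proper) (⊴-antisym (proj₁ proper) v (proj₁ (proj₂ proper)) t⊴) }
        al : ∀ {t} → 0# < k t → Proper t
        al p = Sum.[ (λ { refl → proper }) , (λ q → below-proper (allowed ch q)) ] (cases p)
        supported : Supported k
        supported p = Sum.[ (λ { refl → ⊴-refl (proj₁ proper) }) , (λ q → proj₁ (proj₂ (allowed ch q))) ] (cases p)
        lk : ∀ {t u} → 0# < k t → 0# < k u → t ⊴ u ⊎ u ⊴ t
        lk {t} {u} p q = link (cases p) (cases q)
          where
          link : t ≡ y₀ ⊎ 0# < c t → u ≡ y₀ ⊎ 0# < c u → t ⊴ u ⊎ u ⊴ t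
          link (inj₁ refl) _ = inj₂ (supported q)
          link (inj₂ _) (inj₁ refl) = inj₁ (supported p)
          link (inj₂ p′) (inj₂ q′) = linked ch p′ q′
        total-k : ∑ allCells k ≈ 1#
        total-k = ≈-trans (∑-+ allCells _ _) (≈-trans (+-cong (≈-trans (∑-*ˡ α allCells c) αT)
            (≈-trans (∑-single allCells-unique (∈-allCells y₀) (λ {t} → at-other {t = t})) at-self))
          (solve 1 (λ n → n :+ (con (+ 1) :- n) := con (+ 1)) ≈-refl ∥ v ∥²))
        c-summit : c y₀ ≈ 0#
        c-summit = ≤-antisym (≮⇒≥ (λ p → proj₂ (proj₂ (allowed ch p)) refl)) (nonneg ch y₀)
        summit : k y₀ ≈ e
        summit = ≈-trans (+-cong (≈-trans (*-congˡ c-summit) (zeroʳ α)) at-self) (+-identityˡ e)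
        hk : ∀ j → h k j ≈ α * v j
        hk j = ≈-trans (Fₘ.comb-+ (λ t → α * c t) (at y₀ e) j)
          (≈-trans (+-cong (≈-trans (Fₘ.comb-scale α c j) (*-congˡ (hc j)))
            (≈-trans (Fₘ.comb-at allCells-unique ∈-allCells y₀ e j) (≈-trans (*-congˡ (s-summit j)) (zeroʳ e))))
            (+-identityʳ _))
        par : Parallel v (λ j → α * v j)
        par = parallel-scaleʳ v α≥0
      factor : ∑ allCells c ≤ 0# ⊎ 0# < ∑ allCells c → Goal
      factor (inj₂ T>0) = let (i , i>0 , Ti≈1) = inv⁺ T>0 in build (∥ v ∥² * i) (*-nonneg (norm≥0 v) (<⇒≤ i>0))
        (≈-trans (solve 3 (λ n i t → (n :* i) :* t := n :* (t :* i)) ≈-refl ∥ v ∥² i (∑ allCells c))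
          (≈-trans (*-congˡ Ti≈1) (*-identityʳ _)))
      -- Vanishing coefficients mean `v = 0`; the factor 0 then leaves all weight to the summit.
      factor (inj₁ T≤0) = build 0# ≤-refl (≈-trans (zeroˡ _) (≈-sym (∑-zero (allFin d) (λ {j} _ → ≈-trans (*-congˡ (v≈0 j)) (zeroʳ _)))))
        where
        v≈0 : ∀ j → v j ≈ 0#
        v≈0 j = ≈-trans (≈-sym (hc j)) (Fₘ.comb-zero (λ t → ≤-antisym
          (≤-trans (∑-≥-member {f = c} (λ {t} _ → nonneg ch t) (∈-allCells t)) T≤0) (nonneg ch t)) j)

-- Characteristic maps.

module CharacteristicMap (em : ExcludedMiddle (suc 0ℓ)) (real : CompleteOrderedField) (LG : GeneratorEnrichedLattice)
  (y₀ : Cells.Cell LG) (proper : ProperPart.Proper LG y₀)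
  {d : ℕ} (γ : Fin d → Fin (GeneratorEnrichedLattice.size LG))
  (γ-∈ : ∀ j → γ j ∈ proj₂ y₀) (γ-onto : ∀ {g} → g ∈ proj₂ y₀ → ∃ λ j → γ j ≡ g)
  (γ-injective : ∀ {i j} → γ i ≡ γ j → i ≡ j) where

  open RealLemmas em real
  open Peeling em real
  open Compactness em real
  open Spaces em real
  open Directions em real
  open Topology real using (∥_∥²)
  open MinorSpace em real LG
  open Cells LG using (Cell; _⊴_; allCells)
  open ClosedCell em real LG y₀ proper γ γ-∈ γ-onto γ-injective
  open Chain

  Ball : Set
  Ball = Σ (Fin d → ℝ) λ p → ∥ p ∥² ≤ 1#

  abstract

    X-compact : Compact {X} proj₁
    X-compact = chainSpace-compact proj₁ proj₂ (λ pk → (_ , pk) , λ _ → ≈-refl)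

    χ-weights : ∀ (v : Ball) → ∃ λ k → IsPoint k × Supported k × Points (proj₁ v) k
    χ-weights (v , le) = weights-exist v le

  χ : Ball → X
  χ v = let (k , pk , _) = χ-weights v in k , pk

  χ-supported : ∀ v → Supported (proj₁ (χ v))
  χ-supported v = proj₁ (proj₂ (proj₂ (χ-weights v)))

  χ-points : ∀ v → Points (proj₁ v) (proj₁ (χ v))
  χ-points v = proj₂ (proj₂ (proj₂ (χ-weights v)))

  χ-unique : ∀ v {k} → IsPoint k → Supported k → Points (proj₁ v) k → proj₁ (χ v) ≋ k
  χ-unique v pk sk rk = weights-unique {proj₁ v} (proj₂ (χ v)) (χ-supported v) pk sk (χ-points v) rk

  -- Each condition that singles out `χ v` is a vanishing coordinate, a polynomial equation or a
  -- weak inequality. So it holds for limits of the graph, and `χ-unique` identifies them.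
  χ-closed : ClosedGraph {Ball} {X} proj₁ proj₁ χ
  χ-closed {v , le} {k , pk} app = χ-unique (v , le) pk supported (summit , parallel , nonneg-inner)
    where
    h : (Cell → ℝ) → Fin d → ℝ
    h = Fₘ.comb
    supported : Supported k
    supported {t} p with em₀ (t ⊴ y₀)
    ... | yes t⊴ = t⊴
    ... | no t⋬ = ⊥-elim (0<⇒≉0 p (closed-≈0 proj₁ proj₁ χ (cont-coord (inj₂ t)) (λ v′ →
            ≤-antisym (≮⇒≥ (λ q → t⋬ (χ-supported v′ q))) (nonneg (proj₁ (proj₂ (χ v′))) t)) (v , le) (k , pk) app))
    norm-c : Contℝ {Fin d ⊎ Cell} (λ p → ∥ p ∘ inj₁ ∥²)
    norm-c = cont-∑ (allFin d) (λ i → cont-* (cont-coord (inj₁ i)) (cont-coord (inj₁ i)))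
    h-c : ∀ j → Contℝ {Fin d ⊎ Cell} (λ p → h (p ∘ inj₂) j)
    h-c j = cont-∑ allCells (λ t → cont-* (cont-coord (inj₂ t)) (cont-const (Fₘ.s t j)))
    summit : k y₀ ≈ 1# - ∥ v ∥²
    summit = x-y≈0⇒x≈y (closed-≈0 proj₁ proj₁ χ (cont-- (cont-coord (inj₂ y₀)) (cont-- (cont-const 1#) norm-c))
      (λ v′ → x≈y⇒x-y≈0 (proj₁ (χ-points v′))) (v , le) (k , pk) app)
    parallel : ∀ i j → v i * h k j ≈ v j * h k i
    parallel i j = x-y≈0⇒x≈y (closed-≈0 proj₁ proj₁ χ
      (cont-- (cont-* (cont-coord (inj₁ i)) (h-c j)) (cont-* (cont-coord (inj₁ j)) (h-c i)))
      (λ v′ → x≈y⇒x-y≈0 (proj₁ (proj₂ (χ-points v′)) i j)) (v , le) (k , pk) app)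
    nonneg-inner : 0# ≤ inner v (h k)
    nonneg-inner = closed-≥0 proj₁ proj₁ χ (cont-∑ (allFin d) (λ i → cont-* (cont-coord (inj₁ i)) (h-c i)))
      (λ v′ → proj₂ (proj₂ (χ-points v′))) (v , le) (k , pk) app

  abstract

    χ-cont : ContMap {Ball} {X} proj₁ proj₁ χ
    χ-cont = closedGraph⇒contMap proj₁ proj₁ X-compact {χ} (λ {v} {k} → χ-closed {v} {k})

    χ-injective : ∀ {v w} → proj₁ (χ v) ≋ proj₁ (χ w) → proj₁ v ≋ proj₁ w
    χ-injective {v} {w} eq = direction-unique {proj₁ v} {proj₁ w} (proj₂ (χ v)) (χ-supported v) (χ-points v)
      (≈-trans (eq y₀) (proj₁ (χ-points w)) ,
       (λ i j → ≈-trans (*-congˡ (h-eq j)) (≈-trans (proj₁ (proj₂ (χ-points w)) i j) (*-congˡ (≈-sym (h-eq i))))) ,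
       ≤-resp ≈-refl (∑-cong (allFin d) (λ i → *-congˡ (≈-sym (h-eq i)))) (proj₂ (proj₂ (χ-points w))))
      where
      h-eq : ∀ j → Fₘ.comb (proj₁ (χ v)) j ≈ Fₘ.comb (proj₁ (χ w)) j
      h-eq = Fₘ.comb-cong eq

    χ-norm : ∀ v → ∥ proj₁ v ∥² ≈ 1# - proj₁ (χ v) y₀
    χ-norm v = norm≈ {proj₁ v} (χ-points v)

    χ-onto : ∀ (k : X) → Supported (proj₁ k) → ∃ λ v → proj₁ (χ v) ≋ proj₁ k
    χ-onto (k , pk) sk = let (v , le , rv) = direction-exists pk sk in (v , le) , χ-unique (v , le) pk sk rv

-- The whole space is a sphere.

module Sphere (em : ExcludedMiddle (suc 0ℓ)) (real : CompleteOrderedField) (LG : GeneratorEnrichedLattice)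
  {d : ℕ} (γ : Fin d → Fin (GeneratorEnrichedLattice.size LG))
  (γ-∈ : ∀ j → γ j ∈ GeneratorEnrichedLattice.G LG)
  (γ-onto : ∀ {g} → g ∈ GeneratorEnrichedLattice.G LG → ∃ λ j → γ j ≡ g)
  (γ-injective : ∀ {i j} → γ i ≡ γ j → i ≡ j) where

  open RealLemmas em real
  open Peeling em real
  open Linearity em real using (chain-scale)
  open Compactness em real
  open SquareRoot em real
  open Spaces em real
  open Directions em real
  open Topology real using (∥_∥²)
  open MinorSpace em real LG
  open Cells LG using (Cell; _⊴_; allCells; ∈-allCells; top; valid-top)
  open ProperPart LG using (Proper)
  open Chain

  module Fₜ = Fan.FanAt em real LG top valid-top γ γ-∈ γ-onto γ-injective
  open Fₜ using () renaming (comb to h)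

  SpherePoint : Set
  SpherePoint = Σ (Fin d → ℝ) λ p → ∥ p ∥² ≈ 1#

  h-nonzero : ∀ {k} → IsPoint k → ¬ (∀ j → h k j ≈ 0#)
  h-nonzero {k} (ch , total) z = 0≉1 (≈-trans (≈-sym (∑-zero allCells (λ {t} _ → vanish t))) total)
    where
    vanish : ∀ t → k t ≈ 0#
    vanish = Fₜ.fan-injective ch (empty-chain _⊴_ Proper) (λ j → ≈-trans (z j) (≈-sym (Fₜ.comb-zero (λ _ → ≈-refl) j)))

  abstract

    directed : ∀ (k : X) → ∃ λ (x : SpherePoint) → Parallel (proj₁ x) (h (proj₁ k))
    directed (k , pk) with inv⁺ (norm>0 (h k) (h-nonzero pk))
    ... | i , i>0 , Ni≈1 with sqrt (<⇒≤ i>0)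
    ... | b , b≥0 , b² = ((λ j → b * h k j) , ≈-trans (norm-scale b (h k)) (≈-trans (*-congʳ b²)
            (≈-trans (*-comm i _) Ni≈1))) , parallel-scale (h k) b≥0

  σ : X → SpherePoint
  σ k = proj₁ (directed k)

  σ-parallel : ∀ k → Parallel (proj₁ (σ k)) (h (proj₁ k))
  σ-parallel k = proj₂ (directed k)

  unit>0 : ∀ (x : SpherePoint) → 0# < ∥ proj₁ x ∥²
  unit>0 (x , eq) = <-resp ≈-refl (≈-sym eq) 0<1

  σ-unique : ∀ (k : X) (x : SpherePoint) → Parallel (proj₁ x) (h (proj₁ k)) → proj₁ (σ k) ≋ proj₁ x
  σ-unique k x par = parallel-unique (σ-parallel k) par (≈-trans (proj₂ (σ k)) (≈-sym (proj₂ x))) (unit>0 (σ k)) (h-nonzero (proj₂ k))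

  σ-closed : ClosedGraph {X} {SpherePoint} proj₁ proj₁ σ
  σ-closed {k} {x} app = σ-unique k x (parallel , nonneg-inner)
    where
    h-c : ∀ j → Contℝ {Cell ⊎ Fin d} (λ p → h (p ∘ inj₁) j)
    h-c j = cont-∑ allCells (λ t → cont-* (cont-coord (inj₁ t)) (cont-const (Fₜ.s t j)))
    parallel : ∀ i j → proj₁ x i * h (proj₁ k) j ≈ proj₁ x j * h (proj₁ k) i
    parallel i j = x-y≈0⇒x≈y (closed-≈0 proj₁ proj₁ σ
      (cont-- (cont-* (cont-coord (inj₂ i)) (h-c j)) (cont-* (cont-coord (inj₂ j)) (h-c i)))
      (λ k′ → x≈y⇒x-y≈0 (proj₁ (σ-parallel k′) i j)) k x app)
    nonneg-inner : 0# ≤ inner (proj₁ x) (h (proj₁ k))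
    nonneg-inner = closed-≥0 proj₁ proj₁ σ (cont-∑ (allFin d) (λ i → cont-* (cont-coord (inj₂ i)) (h-c i)))
      (λ k′ → proj₂ (σ-parallel k′)) k x app

  abstract

    σ-cont : ContMap {X} {SpherePoint} proj₁ proj₁ σ
    σ-cont = closedGraph⇒contMap proj₁ proj₁ sphere-compact {σ} (λ {k} {x} → σ-closed {k} {x})

    X-compact : Compact {X} proj₁
    X-compact = chainSpace-compact proj₁ proj₂ (λ pk → (_ , pk) , λ _ → ≈-refl)

    -- `h` takes `k` and `l` to positive multiples, by `a` and `b`, of one unit vector. So `k` times
    -- `b` agrees with `l` times `a` by uniqueness in the fan, and total weight 1 gives `a = b`.
    σ-injective : ∀ {k l} → proj₁ (σ k) ≋ proj₁ (σ l) → proj₁ k ≋ proj₁ l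
    σ-injective {k} {l} eq t = *-cancelˡ-≈ b>0 (≈-trans (*-comm b _) (≈-trans (scaled t) (≈-trans (*-comm _ a) (*-congʳ a≈b))))
      where
      a b : ℝ
      a = inner (proj₁ (σ k)) (h (proj₁ k))
      b = inner (proj₁ (σ l)) (h (proj₁ l))
      a>0 : 0# < a
      a>0 = inner>0 (σ-parallel k) (unit>0 (σ k)) (h-nonzero (proj₂ k))
      b>0 : 0# < b
      b>0 = inner>0 (σ-parallel l) (unit>0 (σ l)) (h-nonzero (proj₂ l))
      expand : ∀ k j → h (proj₁ k) j ≈ inner (proj₁ (σ k)) (h (proj₁ k)) * proj₁ (σ k) j
      expand k j = ≈-trans (≈-sym (*-identityˡ _)) (≈-trans (*-congʳ (≈-sym (proj₂ (σ k)))) (parallel-expand (σ-parallel k) j))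
      h-scaled : ∀ (c : Cell → ℝ) e j → h (λ t → c t * e) j ≈ e * h c j
      h-scaled c e j = ≈-trans (Fₜ.comb-cong (λ t → *-comm (c t) e) j) (Fₜ.comb-scale e c j)
      scaled : (λ t → proj₁ k t * b) ≋ (λ t → proj₁ l t * a)
      scaled = Fₜ.fan-injective (chain-scale (λ _ → <⇒≤ b>0) (proj₁ (proj₂ k))) (chain-scale (λ _ → <⇒≤ a>0) (proj₁ (proj₂ l))) λ j →
        ≈-trans (h-scaled (proj₁ k) b j) (≈-trans (*-congˡ (expand k j)) (≈-trans (*-congˡ (*-congˡ (eq j)))
          (≈-trans (solve 3 (λ a b x → b :* (a :* x) := a :* (b :* x)) ≈-refl a b (proj₁ (σ l) j))
            (≈-trans (*-congˡ (≈-sym (expand l j))) (≈-sym (h-scaled (proj₁ l) a j))))))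
      a≈b : a ≈ b
      a≈b = ≈-sym (≈-trans (≈-sym (*-identityˡ b)) (≈-trans (*-congʳ (≈-sym (proj₂ (proj₂ k))))
        (≈-trans (≈-sym (∑-*ʳ b allCells (proj₁ k))) (≈-trans (∑-cong allCells scaled)
          (≈-trans (∑-*ʳ a allCells (proj₁ l)) (≈-trans (*-congʳ (proj₂ (proj₂ l))) (*-identityˡ a)))))))

    -- The coefficients of a unit vector in the fan have positive total, since otherwise the vector
    -- would vanish; dividing by the total gives the weights.
    σ-onto : ∀ (x : SpherePoint) → ∃ λ k → proj₁ (σ k) ≋ proj₁ x
    σ-onto (x , unit) = from-fan (Fₜ.fan-surjective x)
      where
      from-fan : (∃ λ c → Fₜ.Ch c × h c ≋ x) → ∃ λ k → proj₁ (σ k) ≋ x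
      from-fan (c , ch , hc) = normalise (inv⁺ total>0)
        where
        total>0 : 0# < ∑ allCells c
        total>0 with ≤⊎> (∑ allCells c) 0#
        ... | inj₂ p = p
        ... | inj₁ q = ⊥-elim (0≉1 (≈-trans (≈-sym (∑-zero (allFin d) (λ {j} _ → ≈-trans (*-congˡ (x≈0 j)) (zeroʳ _)))) unit))
          where
          x≈0 : ∀ j → x j ≈ 0#
          x≈0 j = ≈-trans (≈-sym (hc j)) (Fₜ.comb-zero (λ t → ≤-antisym
            (≤-trans (∑-≥-member {f = c} (λ {t} _ → nonneg ch t) (∈-allCells t)) q) (nonneg ch t)) j)
        normalise : (∃ λ i → 0# < i × ∑ allCells c * i ≈ 1#) → ∃ λ k → proj₁ (σ k) ≋ x
        normalise (i , i>0 , Ti≈1) = k , σ-unique k (x , unit)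
            ((λ a b → ≈-trans (*-congˡ (hk b)) (≈-trans (proj₁ par a b) (*-congˡ (≈-sym (hk a))))) ,
             ≤-resp ≈-refl (∑-cong (allFin d) (λ a → *-congˡ (≈-sym (hk a)))) (proj₂ par))
          where
          k : X
          k = (λ t → c t * i) , chain-scale (λ _ → <⇒≤ i>0) ch , ≈-trans (∑-*ʳ i allCells c) Ti≈1
          hk : ∀ j → h (proj₁ k) j ≈ i * x j
          hk j = ≈-trans (Fₜ.comb-cong (λ t → *-comm (c t) i) j) (≈-trans (Fₜ.comb-scale i c j) (*-congˡ (hc j)))
          par : Parallel x (λ j → i * x j)
          par = parallel-scaleʳ x (<⇒≤ i>0)

  σ⁻¹ : SpherePoint → X
  σ⁻¹ x = proj₁ (σ-onto x)

  σ-homeomorphism : Homeomorphism (Topology.euclidean real {X} proj₁) (Topology.euclidean real {SpherePoint} proj₁)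
  σ-homeomorphism = homeomorphism proj₁ proj₁ σ σ⁻¹ σ-cont
    (Transport.ψ⁻¹-cont proj₁ proj₁ X-compact σ σ-cont (λ {k} {l} → σ-injective {k} {l}) σ⁻¹ (proj₂ ∘ σ-onto))
    (proj₂ ∘ σ-onto) (λ k → σ-injective {σ⁻¹ (σ k)} {k} (proj₂ (σ-onto (σ k))))

-- The regular CW complex and its face poset.

lookup-injective : ∀ {A : Set} {xs : List A} → Unique xs → ∀ {i j} → lookup xs i ≡ lookup xs j → i ≡ j
lookup-injective {xs = x ∷ xs} (x∉ AllPairs.∷ u) {Fin.zero}  {Fin.zero}  eq = refl
lookup-injective {xs = x ∷ xs} (x∉ AllPairs.∷ u) {Fin.zero}  {Fin.suc j} eq = ⊥-elim (All.lookup x∉ (∈-lookup j) eq)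
lookup-injective {xs = x ∷ xs} (x∉ AllPairs.∷ u) {Fin.suc i} {Fin.zero}  eq = ⊥-elim (All.lookup x∉ (∈-lookup i) (sym eq))
lookup-injective {xs = x ∷ xs} (x∉ AllPairs.∷ u) {Fin.suc i} {Fin.suc j} eq = cong Fin.suc (lookup-injective u eq)

module CellComplex (em : ExcludedMiddle (suc 0ℓ)) (real : CompleteOrderedField) (LG : GeneratorEnrichedLattice) where

  open RealLemmas em real hiding (zero)
  open Peeling em real
  open Compactness em real using (contMap⇒continuous)
  open Spaces em real using (contMap-cong)
  open Directions em real using (compact-inducing; euclidean-hausdorff; ball-compact)
  open Topology real using (∥_∥²; euclidean; RegularCWComplex)
  open MinorSpace em real LG using (X)
  open Cells LG using (Cell; Valid; _⊴_; allCells; allCells-unique; ∈-allCells; ⊴-refl; ⊴-trans; ⊴-antisym; top; valid-top; _≟ᶜ_; cellOf; cellOf-valid; cellOf-⊴)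
  open Facets LG using (rank; rank-<)
  open ProperPart LG using (Proper)
  open Chain

  proper? : ∀ c → Dec (Proper c)
  proper? c = em₀ (Proper c)

  properCells : List Cell
  properCells = filter proper? allCells

  N : ℕ
  N = length properCells

  cell : Fin N → Cell
  cell = lookup properCells

  cell-proper : ∀ i → Proper (cell i)
  cell-proper i = proj₂ (∈-filter⁻ proper? {xs = allCells} (∈-lookup {xs = properCells} i))

  cell-onto : ∀ {c} → Proper c → ∃ λ i → cell i ≡ c
  cell-onto {c} p = Any.index c∈ , sym (lookup-index c∈)
    where
    c∈ : c List.∈ properCells
    c∈ = ∈-filter⁺ proper? (∈-allCells c) p

  cell-injective : ∀ {i j} → cell i ≡ cell j → i ≡ j
  cell-injective = lookup-injective (Unique.filter⁺ proper? allCells-unique)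

  dim : Fin N → ℕ
  dim i = rank (cell i)

  module χ (i : Fin N) = CharacteristicMap em real LG (cell i) (cell-proper i)
    (enumerate (proj₂ (cell i))) (enumerate-∈ (proj₂ (cell i))) (enumerate-onto (proj₂ (cell i))) (enumerate-injective (proj₂ (cell i)))

  space : TopologicalSpace
  space = euclidean {X} proj₁

  Ball : ℕ → Set
  Ball n = Σ (Fin n → ℝ) λ p → ∥ p ∥² ≤ 1#

  Supported : Fin N → (Cell → ℝ) → Set
  Supported i k = ∀ {t} → 0# < k t → t ⊴ cell i

  ClosedCell′ OpenCell′ : Fin N → X → Set
  ClosedCell′ i x = ∃ λ b → proj₁ (χ.χ i b) ≋ proj₁ x
  OpenCell′ i x = ∃ λ b → ∥ proj₁ b ∥² < 1# × proj₁ (χ.χ i b) ≋ proj₁ x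

  supported⇒closed : ∀ {i x} → Supported i (proj₁ x) → ClosedCell′ i x
  supported⇒closed {i} {x} sup = χ.χ-onto i x sup

  closed⇒supported : ∀ {i x} → ClosedCell′ i x → Supported i (proj₁ x)
  closed⇒supported {i} (b , eq) lt = χ.χ-supported i b (<-resp ≈-refl (≈-sym (eq _)) lt)

  -- By `χ-norm` the weight at the summit is `1 − ∥ b ∥²`, so the open ball corresponds to positive
  -- weight there.
  open⇒top : ∀ {i x} → OpenCell′ i x → 0# < proj₁ x (cell i) × Supported i (proj₁ x)
  open⇒top {i} {x} (b , lt , eq) = <-resp ≈-refl (≈-trans (solve 1 (λ a → con (+ 1) :- (con (+ 1) :- a) := a) ≈-refl _) (eq (cell i)))
      (<⇒0< (<-resp (χ.χ-norm i b) ≈-refl lt)) ,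
    λ {t} → closed⇒supported {i} {x} (b , eq) {t}

  top⇒open : ∀ {i x} → 0# < proj₁ x (cell i) → Supported i (proj₁ x) → OpenCell′ i x
  top⇒open {i} {x} lt sup = locate (χ.χ-onto i x sup)
    where
    locate : ClosedCell′ i x → OpenCell′ i x
    locate (b , eq) = b , 0<⇒< (<-resp ≈-refl (≈-trans
        (solve 1 (λ a → a := con (+ 1) :- (con (+ 1) :- a)) ≈-refl _) (+-congˡ (-‿cong (≈-sym (χ.χ-norm i b)))))
      (<-resp ≈-refl (≈-sym (eq (cell i))) lt)) , eq

  -- The greatest member of the support, found as the least one for the reversed order; it names the
  -- open cell that contains the point.
  highest : ∀ (x : X) → ∃ λ i → 0# < proj₁ x (cell i) × Supported i (proj₁ x)
  highest (k , ch , total) = from-least (least (λ t u → u ⊴ t) Proper (λ (v , _) → ⊴-refl v) (λ p q → ⊴-trans q p)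
      reversed (λ t → t ≡ t) allCells positive)
    where
    reversed : Chain (λ t u → u ⊴ t) Proper k
    reversed = record { nonneg = nonneg ch ; allowed = allowed ch ; linked = λ p q → linked ch q p }
    positive : ∃ λ t → t List.∈ allCells × 0# < k t × t ≡ t
    positive = let (t , t∈ , lt) = ∑-pos-member allCells (λ {t} _ → nonneg ch t) (<-resp ≈-refl (≈-sym total) 0<1) in
      t , t∈ , lt , refl
    from-least : (∃ λ t → 0# < k t × t ≡ t × (∀ {u} → u List.∈ allCells → 0# < k u → u ≡ u → u ⊴ t)) →
                 ∃ λ i → 0# < k (cell i) × Supported i k
    from-least (t , lt , _ , le) = place (cell-onto (allowed ch lt))
      where
      place : (∃ λ i → cell i ≡ t) → ∃ λ i → 0# < k (cell i) × Supported i k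
      place (i , refl) = i , lt , λ lu → le (∈-allCells _) lu refl

  complex : RegularCWComplex
  complex = record
    { space          = space
    ; hausdorff      = euclidean-hausdorff proj₁
    ; cells          = N
    ; dim            = dim
    ; characteristic = λ i → record { to = χ.χ i ; cong = λ {b} {b′} → contMap-cong proj₁ proj₁ {χ.χ i} (χ.χ-cont i) {b} {b′} }
    ; embedding      = λ i → record
      { injective  = λ {b} {b′} → χ.χ-injective i {b} {b′}
      ; continuous = contMap⇒continuous proj₁ proj₁ {χ.χ i} (χ.χ-cont i)
      ; inducing   = compact-inducing proj₁ proj₁ ball-compact {χ.χ i} (χ.χ-cont i) (λ {b} {b′} → χ.χ-injective i {b} {b′})
      }
    ; covering       = λ x → let (i , lt , sup) = highest x in i , top⇒open {i} {x} lt sup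
    ; disjoint       = λ {i} {j} {x} oi oj → let (lt , sup) = open⇒top {i} {x} oi ; (lt′ , sup′) = open⇒top {j} {x} oj in
        cell-injective (⊴-antisym (proj₁ (cell-proper i)) (proj₁ (cell-proper j)) (sup′ lt) (sup lt′))
    ; boundary       = boundary
    }
    where
    boundary : ∀ i (b : Ball (dim i)) → ∥ proj₁ b ∥² ≈ 1# → ∃ λ j → dim j ℕ.< dim i × OpenCell′ j (χ.χ i b)
    -- On the bounding sphere the summit has weight 0, so the highest member is a different cell
    -- below it.
    boundary i b on-sphere = let (j , lt , sup) = highest (χ.χ i b) in j ,
        rank-< (proj₁ (cell-proper j)) (proj₁ (cell-proper i)) (χ.χ-supported i b lt) (λ eq → 0<⇒≉0 lt (vanishes eq)) ,
        top⇒open {j} {χ.χ i b} lt sup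
      where
      vanishes : ∀ {c} → c ≡ cell i → proj₁ (χ.χ i b) c ≈ 0#
      vanishes refl = ≈-trans (solve 1 (λ a → a := con (+ 1) :- (con (+ 1) :- a)) ≈-refl _)
        (x≈y⇒x-y≈0 (≈-trans (≈-sym on-sphere) (χ.χ-norm i b)))

  open RegularCWComplex complex using (_⊑_; facePoset)
  module FP = Poset facePoset

  ⊴⇒⊑ : ∀ {i j} → cell i ⊴ cell j → i ⊑ j
  ⊴⇒⊑ {i} {j} le {x} c = supported⇒closed {j} {x} (λ lt → ⊴-trans (closed⇒supported {i} {x} c lt) le)

  -- Test the inclusion at the vertex `cell i`, the point with all its weight there.
  ⊑⇒⊴ : ∀ {i j} → i ⊑ j → cell i ⊴ cell j
  ⊑⇒⊴ {i} {j} sub = closed⇒supported {j} {x} (sub {x} (supported⇒closed {i} {x} supported)) (<-resp ≈-refl (≈-sym at-self) 0<1)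
    where
    only : ∀ {t} → 0# < at (cell i) 1# t → t ≡ cell i
    only {t} lt with em₀ (t ≡ cell i)
    ... | yes eq = eq
    ... | no _   = ⊥-elim (proj₂ lt ≈-refl)
    at≥0 : ∀ t → 0# ≤ at (cell i) 1# t
    at≥0 t with em₀ (t ≡ cell i)
    ... | yes _ = <⇒≤ 0<1
    ... | no _  = ≤-refl
    refl-at : ∀ {t u} → t ≡ cell i → u ≡ cell i → t ⊴ u ⊎ u ⊴ t
    refl-at refl refl = inj₁ (⊴-refl (proj₁ (cell-proper i)))
    x : X
    x = at (cell i) 1# , record
        { nonneg  = at≥0
        ; allowed = λ lt → subst Proper (sym (only lt)) (cell-proper i)
        ; linked  = λ p q → refl-at (only p) (only q)
        } , ≈-trans (∑-single allCells-unique (∈-allCells (cell i)) (λ {t} → at-other {t = t})) at-self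
    supported : Supported i (proj₁ x)
    supported lt = subst (_⊴ cell i) (sym (only lt)) (⊴-refl (proj₁ (cell-proper i)))

  open Minors LG
  open MinorPoset LG using (module M; key; key-cong; toM; key-toM)
  open Cells LG using (⊴⇒≤ᴹ; ≤ᴹ⇒⊴)

  -- `⊥±` is a default for pairs that are no minors; `faceView` rules it out for valid cells below
  -- `top`.
  faceOf : Cell → Fin N ±
  faceOf c with c ≟ᶜ top | proper? c
  ... | yes _ | _     = ⊤±
  ... | no _  | yes p = Ext.[ proj₁ (cell-onto p) ]
  ... | no _  | no _  = ⊥±

  data FaceView (c : Cell) : Fin N ± → Set where
    whole-face  : c ≡ top → FaceView c ⊤±
    proper-face : ∀ i → cell i ≡ c → FaceView c Ext.[ i ]

  faceView : ∀ {c} → Valid c → c ⊴ top → FaceView c (faceOf c)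
  faceView {c} v c⊴ with c ≟ᶜ top | proper? c
  ... | yes eq | _     = whole-face eq
  ... | no _   | yes p = proper-face (proj₁ (cell-onto p)) (proj₂ (cell-onto p))
  ... | no ≢   | no ¬p = ⊥-elim (¬p (v , c⊴ , ≢))

  fromKey : Maybe Cell → Fin N ±
  fromKey nothing  = ⊥±
  fromKey (just c) = faceOf c

  face : M.Carrier → Fin N ±
  face = fromKey ∘ key

  face-mono : ∀ {x y} → x M.≤ y → face x FP.≤ face y
  face-mono {⊥₋} _ = Extrema.⊥±≤_ _⊑_ _
  face-mono {[ m ]} {[ n ]} Infimum.[ le ] =
      compare (faceView (cellOf-valid m) (cellOf-⊴ m)) (faceView (cellOf-valid n) (cellOf-⊴ n))
    where
    m⊴n : cellOf m ⊴ cellOf n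
    m⊴n = ≤ᴹ⇒⊴ m n le
    compare : ∀ {a b} → FaceView (cellOf m) a → FaceView (cellOf n) b → a FP.≤ b
    compare _ (whole-face _) = Extrema._≤⊤± _⊑_ _
    compare (whole-face eq) (proper-face j eq′) = ⊥-elim (proj₂ (proj₂ (cell-proper j)) (trans eq′
      (⊴-antisym (cellOf-valid n) valid-top (cellOf-⊴ n) (subst (_⊴ cellOf n) eq m⊴n))))
    compare (proper-face i eq) (proper-face j eq′) = Supremum.[ Infimum.[ (λ {x} → ⊴⇒⊑ {i} {j} (subst₂ _⊴_ (sym eq) (sym eq′) m⊴n) {x}) ] ]

  face-cancel : ∀ {x y} → face x FP.≤ face y → x M.≤ y
  face-cancel {⊥₋} _ = Infimum.⊥₋≤ _
  face-cancel {[ m ]} {⊥₋} le = ⊥-elim (compare (faceView (cellOf-valid m) (cellOf-⊴ m)) le)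
    where
    compare : ∀ {a} → FaceView (cellOf m) a → ¬ a FP.≤ ⊥±
    compare (proper-face _ _) Supremum.[ () ]
  face-cancel {[ m ]} {[ n ]} le = Infimum.[ ⊴⇒≤ᴹ m n
      (compare (faceView (cellOf-valid m) (cellOf-⊴ m)) (faceView (cellOf-valid n) (cellOf-⊴ n)) le) ]
    where
    compare : ∀ {a b} → FaceView (cellOf m) a → FaceView (cellOf n) b → a FP.≤ b → cellOf m ⊴ cellOf n
    compare _ (whole-face eq) _ = subst (cellOf m ⊴_) (sym eq) (cellOf-⊴ m)
    compare (proper-face i eq) (proper-face j eq′) Supremum.[ Infimum.[ sub ] ] = subst₂ _⊴_ eq eq′ (⊑⇒⊴ {i} {j} (λ {x} → sub {x}))

  M≅facePoset : M ≅ facePoset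
  M≅facePoset = face , record
    { isOrderMonomorphism = record
      { isOrderHomomorphism = record
        { cong = λ {x} {y} x≈y → FP.Eq.reflexive (cong fromKey (key-cong x≈y))
        ; mono = face-mono
        }
      ; injective = λ {x} {y} eq → M.antisym (face-cancel {x} {y} (FP.reflexive eq)) (face-cancel {y} {x} (FP.reflexive (FP.Eq.sym eq)))
      ; cancel    = face-cancel
      }
    ; surjective = λ y → let (x , eq) = preimage y in
        x , λ {z} z≈x → FP.Eq.reflexive (trans (cong fromKey (key-cong z≈x)) eq)
    }
    where
    preimage : ∀ y → ∃ λ x → face x ≡ y
    preimage ⊥± = ⊥₋ , refl
    preimage ⊤± = wholeᴹ , at-top (faceView valid-top (⊴-refl valid-top))
      where
      at-top : ∀ {a} → FaceView top a → a ≡ ⊤±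
      at-top (whole-face _)     = refl
      at-top (proper-face i eq) = ⊥-elim (proj₂ (proj₂ (cell-proper i)) eq)
    preimage Ext.[ i ] = toM (cell i) , trans (cong fromKey (key-toM v c⊴)) (at-cell (faceView v c⊴))
      where
      v : Valid (cell i)
      v = proj₁ (cell-proper i)
      c⊴ : cell i ⊴ top
      c⊴ = proj₁ (proj₂ (cell-proper i))
      at-cell : ∀ {a} → FaceView (cell i) a → a ≡ Ext.[ i ]
      at-cell (whole-face eq)    = ⊥-elim (proj₂ (proj₂ (cell-proper i)) eq)
      at-cell (proper-face j eq) = cong Ext.[_] (cell-injective eq)

-- The length `m` is left free: the unit sphere is indexed by one less than the dimension of its
-- ambient space, and a chosen generator writes the size of `G` as a successor.
enumeration : ∀ {n m} (p : Subset n) → ∣ p ∣ ≡ m → Σ (Fin m → Fin n) λ γ →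
  (∀ j → γ j ∈ p) × (∀ {g} → g ∈ p → ∃ λ j → γ j ≡ g) × (∀ {i j} → γ i ≡ γ j → i ≡ j)
enumeration p refl = enumerate p , enumerate-∈ p , enumerate-onto p , enumerate-injective p

module _ (em : ExcludedMiddle (suc 0ℓ)) (real : CompleteOrderedField) (LG : GeneratorEnrichedLattice) where

  open GeneratorEnrichedLattice LG using (G)

  isSphere : Nonempty G → Topology.IsSphere real (CellComplex.complex em real LG)
  isSphere (g , g∈) = let (γ , γ-∈ , γ-onto , γ-injective) = enumeration G (∣p-x∣ g∈) in
    _ , Sphere.σ-homeomorphism em real LG γ γ-∈ γ-onto γ-injective

corollary5p4 : (LG : GeneratorEnrichedLattice) →
    let open GeneratorEnrichedLattice LG using (G)
        open Minors LG
    in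
    Eulerian M ×
    (Nonempty G →
     ExcludedMiddle (suc 0ℓ) →
     (real : CompleteOrderedField) →
     let open Topology real in
     IsPLSphere (orderComplex properPart) ×
     Σ RegularCWComplex (λ C →
       IsSphere C × M ≅ RegularCWComplex.facePoset C))
corollary5p4 LG = MinorPoset.eulerian LG , λ nonempty em real →
  PLHomeomorphism.isPLSphere em real LG ,
  CellComplex.complex em real LG , isSphere em real LG nonempty , CellComplex.M≅facePoset em real LG
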